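{- For each $k>0$ and $0\le r\le k$, $$\det(\mathsf{G}_k^{(r)})=\prod_{s=1}^{\lfloor (k-r)/2\rfloor}\left(\frac{u_{s+r}(x-1)}{u_{s-1}(x-1)}\right)^{\mathsf{m}_{k,r+2s}},$$ as an identity of rational functions in the indeterminate $x$.
   Context: Chebyshev polynomials: $u_0(y)=1$, $u_1(y)=y$, $u_j(y)=yu_{j-1}(y)-u_{j-2}(y)$. A Motzkin path of length $k$ is $p=(a_1,\dots,a_k)\in\{ -1,0,1\}^k$ with all partial sums $\ge0$; its rank is $\sum a_i$; $\mathcal{P}_k^r$ is the set of paths of length $k$ and rank $r$, and $\mathsf{m}_{k,r}=|\mathcal{P}_k^r|$. Each path is a 1-factor: vertices $1,\dots,k$, with $i<j$ joined iff $a_i=1$ and $j$ is minimal with $a_i+\cdots+a_j=0$; unpaired positions with $a_i=1$ are white, others black. A Motzkin $k$-diagram is a graph on top vertices $1,\dots,k$ and bottom vertices $1',\dots,k'$ with each vertex on at most one edge and edges non-crossing inside the rectangle; its rank is its number of vertical (top–bottom) edges. Product: $d_1d_2=x^\kappa d_3$ where $d_1$ is stacked above $d_2$ (bottom vertex $j'$ of $d_1$ identified with top vertex $j$ of $d_2$), $d_3$ joins two outer vertices iff they are connected by a path, and $\kappa$ is the number of closed loops in the middle row. For $p,q\in\mathcal{P}_k^r$, $d_p^q$ has bottom-row horizontal edges those of $p$, top-row horizontal edges those of $q$, and vertical edges joining the white positions of $p$ (bottom) to those of $q$ (top) in left-to-right order. The Gram matrix $\mathsf{G}_k^{(r)}$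 is indexed by $\mathcal{P}_k^r\times\mathcal{P}_k^r$ with $(p,q)$ entry $\langle p,q\rangle=x^\kappa$ if $d_p^pd_q^q=x^\kappa d$ with $d$ of rank $r$, and $0$ otherwise. -}

module Defs where

open import Data.Bool using (Bool; true; false; if_then_else_; _∧_; not)
open import Data.Nat using (ℕ; zero; suc; _∸_; ⌊_/2⌋; _<ᵇ_; _≡ᵇ_)
open import Data.Integer as ℤ using (ℤ)
open import Data.List using (List; []; _∷_; map; filter; length; upTo; replicate; _++_; foldr)
open import Data.Maybe using (Maybe; just; nothing)
open import Relation.Binary.PropositionalEquality using (_≡_)
open import Relation.Nullary.Decidable using (T?)

Poly : Set
Poly = List ℤ

coeff : Poly → ℕ → ℤ
coeff []      _       = ℤ.0ℤ
coeff (a ∷ _) zero    = a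
coeff (_ ∷ p) (suc n) = coeff p n

infix 4 _≈P_
_≈P_ : Poly → Poly → Set
p ≈P q = ∀ n → coeff p n ≡ coeff q n

infixl 6 _+P_
_+P_ : Poly → Poly → Poly
[]      +P q       = q
(a ∷ p) +P []      = a ∷ p
(a ∷ p) +P (b ∷ q) = (a ℤ.+ b) ∷ (p +P q)

negP : Poly → Poly
negP = map (λ a → ℤ.- a)

infixl 7 _*P_
_*P_ : Poly → Poly → Poly
[]      *P q = []
(a ∷ p) *P q = map (a ℤ.*_) q +P (ℤ.0ℤ ∷ (p *P q))

oneP : Poly
oneP = ℤ.1ℤ ∷ []

xPow : ℕ → Poly
xPow n = replicate n ℤ.0ℤ ++ (ℤ.1ℤ ∷ [])

powP : Poly → ℕ → Poly
powP p zero    = oneP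
powP p (suc n) = p *P powP p n

-- u_j(x-1), Chebyshev: u_0 = 1, u_1(y) = y, u_j = y u_{j-1} - u_{j-2}, at y = x - 1
xMinus1 : Poly
xMinus1 = ℤ.-1ℤ ∷ ℤ.1ℤ ∷ []

uAt : ℕ → Poly
uAt zero          = oneP
uAt (suc zero)    = xMinus1
uAt (suc (suc j)) = xMinus1 *P uAt (suc j) +P negP (uAt j)

record Frac : Set where
  constructor _/F_
  field
    num : Poly
    den : Poly
open Frac public

infix 4 _≈F_
_≈F_ : Frac → Frac → Set
f ≈F g = num f *P den g ≈P num g *P den f

infixl 7 _*F_
_*F_ : Frac → Frac → Frac
f *F g = (num f *P num g) /F (den f *P den g)

oneF : Frac
oneF = oneP /F oneP

powF : Frac → ℕ → Frac
powF f zero    = oneF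
powF f (suc n) = f *F powF f n

prodF : List Frac → Frac
prodF = foldr _*F_ oneF

polyF : Poly → Frac
polyF p = p /F oneP

-- Determinant of an n×n matrix (entries indexed by ℕ, only i,j < n used),
-- by Laplace (cofactor) expansion along the first row.

Matrix : Set
Matrix = ℕ → ℕ → Poly

altSign : ℕ → Poly → Poly
altSign zero    p = p
altSign (suc j) p = negP (altSign j p)

minor : ℕ → Matrix → Matrix
minor j M a b = M (suc a) (if b <ᵇ j then b else suc b)

sumP : List Poly → Poly
sumP = foldr _+P_ []

det : ℕ → Matrix → Poly
det zero    M = oneP
det (suc n) M = sumP (map (λ j → altSign j (M 0 j *P det n (minor j M))) (upTo (suc n)))

data Step : Set where
  up flat down : Step

allSeqs : ℕ → List (List Step)
allSeqs zero    = [] ∷ []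
allSeqs (suc k) = Data.List.concatMap (λ s → map (s ∷_) (allSeqs k)) (up ∷ flat ∷ down ∷ [])

validFrom : ℕ → List Step → Bool
validFrom h []           = true
validFrom h (up ∷ xs)    = validFrom (suc h) xs
validFrom h (flat ∷ xs)  = validFrom h xs
validFrom zero (down ∷ xs)    = false
validFrom (suc h) (down ∷ xs) = validFrom h xs

-- final height (= rank, for valid paths)
heightFrom : ℕ → List Step → ℕ
heightFrom h []          = h
heightFrom h (up ∷ xs)   = heightFrom (suc h) xs
heightFrom h (flat ∷ xs) = heightFrom h xs
heightFrom h (down ∷ xs) = heightFrom (h ∸ 1) xs

isMotzkin : List Step → Bool
isMotzkin = validFrom 0

rank : List Step → ℕ
rank = heightFrom 0

-- the set P_k^r, as a list (each path listed exactly once)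
paths : ℕ → ℕ → List (List Step)
paths k r = filter (λ p → T? (isMotzkin p ∧ (rank p ≡ᵇ r))) (allSeqs k)

mot : ℕ → ℕ → ℕ
mot k r = length (paths k r)

nthS : List Step → ℕ → Maybe Step
nthS []       _       = nothing
nthS (s ∷ _)  zero    = just s
nthS (_ ∷ xs) (suc i) = nthS xs i

dropL : ∀ {A : Set} → ℕ → List A → List A
dropL zero    xs       = xs
dropL (suc n) []       = []
dropL (suc n) (_ ∷ xs) = dropL n xs

-- scanning positions pos, pos+1, ... with current partial sum d ≥ 1,
-- return the first position where the partial sum becomes 0
findClose : List Step → ℕ → ℕ → Maybe ℕ
findClose []          pos d = nothing
findClose (up ∷ xs)   pos d = findClose xs (suc pos) (suc d)
findClose (flat ∷ xs) pos d = findClose xs (suc pos) d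
findClose (down ∷ xs) pos d = if d ≡ᵇ 1 then just pos else findClose xs (suc pos) (d ∸ 1)

closeOf : List Step → ℕ → Maybe ℕ
closeOf p i with nthS p i
... | just up = findClose (dropL (suc i) p) (suc i) 1
... | _       = nothing

eqM : Maybe ℕ → ℕ → Bool
eqM (just a) b = a ≡ᵇ b
eqM nothing  b = false

firstWith : (ℕ → Bool) → List ℕ → Maybe ℕ
firstWith P []       = nothing
firstWith P (j ∷ js) = if P j then just j else firstWith P js

arcPartner : List Step → ℕ → Maybe ℕ
arcPartner p i = firstWith (λ j → eqM (closeOf p i) j ∨' eqM (closeOf p j) i) (upTo (length p))
  where
  _∨'_ : Bool → Bool → Bool
  true  ∨' _ = true
  false ∨' b = b

isUp : List Step → ℕ → Bool
isUp p i with nthS p i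
... | just up = true
... | _       = false

isNothing : Maybe ℕ → Bool
isNothing nothing  = true
isNothing (just _) = false

whites : List Step → List ℕ
whites p = filter (λ i → T? (isUp p i ∧ isNothing (closeOf p i))) (upTo (length p))

indexOf : ℕ → List ℕ → Maybe ℕ
indexOf a []       = nothing
indexOf a (b ∷ bs) = if a ≡ᵇ b then just 0 else Data.Maybe.map suc (indexOf a bs)

nthN : List ℕ → ℕ → Maybe ℕ
nthN []       _       = nothing
nthN (a ∷ _)  zero    = just a
nthN (_ ∷ as) (suc i) = nthN as i

-- Motzkin diagrams: top vertices (top i) and bottom vertices (bot i), i < k,
-- each vertex with at most one partner.

data Vert : Set where
  top bot : ℕ → Vert

record Diagram : Set where
  field
    size    : ℕ
    partner : Vert → Maybe Vert
open Diagram public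

_>>=M_ : ∀ {A B : Set} → Maybe A → (A → Maybe B) → Maybe B
nothing >>=M f = nothing
just a  >>=M f = f a

dpq : List Step → List Step → Diagram
size    (dpq p q) = length p
partner (dpq p q) (top i) with arcPartner q i
... | just j  = just (top j)
... | nothing = indexOf i (whites q) >>=M λ n → Data.Maybe.map bot (nthN (whites p) n)
partner (dpq p q) (bot i) with arcPartner p i
... | just j  = just (bot j)
... | nothing = indexOf i (whites p) >>=M λ n → Data.Maybe.map top (nthN (whites q) n)

-- Product d1 d2 (d1 stacked above d2). Middle vertex j = bottom j' of d1 = top j of d2.
-- Path following uses fuel; 2k+2 steps always suffice for diagrams on k points.

module _ (d1 d2 : Diagram) where
  mutual
    walkDown : ℕ → ℕ → Maybe Vert
    walkDown zero    j = nothing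
    walkDown (suc f) j with partner d2 (top j)
    ... | nothing      = nothing
    ... | just (bot b) = just (bot b)
    ... | just (top m) = walkUp f m

    walkUp : ℕ → ℕ → Maybe Vert
    walkUp zero    j = nothing
    walkUp (suc f) j with partner d1 (bot j)
    ... | nothing      = nothing
    ... | just (top t) = just (top t)
    ... | just (bot m) = walkDown f m

  fuel : ℕ
  fuel = suc (suc (size d1 Data.Nat.+ size d1))

  composeD : Diagram
  size    composeD = size d1
  partner composeD (top t) with partner d1 (top t)
  ... | nothing      = nothing
  ... | just (top u) = just (top u)
  ... | just (bot j) = walkDown fuel j
  partner composeD (bot b) with partner d2 (bot b)
  ... | nothing      = nothing
  ... | just (bot c) = just (bot c)
  ... | just (top j) = walkUp fuel j

  -- does the walk from middle vertex j (first along d2, then d1, ...) close up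
  -- into a loop in the middle row whose least vertex is j?
  loopFrom : ℕ → ℕ → ℕ → Bool
  loopFrom zero    j c = false
  loopFrom (suc f) j c with partner d2 (top c)
  ... | just (top c2) with partner d1 (bot c2)
  ...   | just (bot c3) = if (c2 <ᵇ j) Data.Bool.∨ (c3 <ᵇ j) then false
                          else (if c3 ≡ᵇ j then true else loopFrom f j c3)
  ...   | _ = false
  loopFrom (suc f) j c | _ = false

  loops : ℕ
  loops = length (filter (λ j → T? (loopFrom fuel j j)) (upTo (size d1)))

isBot : Maybe Vert → Bool
isBot (just (bot _)) = true
isBot _              = false

rankD : Diagram → ℕ
rankD d = length (filter (λ t → T? (isBot (partner d (top t)))) (upTo (size d)))

gramEntry : ℕ → List Step → List Step → Poly
gramEntry r p q =
  if rankD (composeD (dpq p p) (dpq q q)) ≡ᵇ r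
  then xPow (loops (dpq p p) (dpq q q))
  else []

nthP : List (List Step) → ℕ → List Step
nthP []       _       = []
nthP (p ∷ _)  zero    = p
nthP (_ ∷ ps) (suc i) = nthP ps i

gram : ℕ → ℕ → Matrix
gram k r i j = gramEntry r (nthP (paths k r) i) (nthP (paths k r) j)

detGram : ℕ → ℕ → Poly
detGram k r = det (mot k r) (gram k r)

rhs : ℕ → ℕ → Frac
rhs k r = prodF (map (λ s → powF (uAt (s Data.Nat.+ r) /F uAt (s ∸ 1)) (mot k (r Data.Nat.+ 2 Data.Nat.* s)))
                     (map suc (upTo ⌊ k ∸ r /2⌋)))

{-# OPTIONS --safe #-}
module Submission where

-- Let u_j be the Chebyshev values at x - 1 and ρ_h = u_{h+1} / u_h.  Closed curves are evaluated by
-- a state sum over height functions of the regions of the plane: neighbouring regions have heights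
-- differing by at most one, a straightened zigzag costs nothing, and a loop in a region of height h
-- contributes ρ_h + 1 + 1 / ρ_{h-1} = x (with last term missing if h = 0).  Hence ⟨p, q⟩ is the sum,
-- over the height paths π read along the middle row, of A(p, π) B(q, π), where A(p, π) and B(q, π)
-- see only one of the two paths.  The height paths that count are the Motzkin paths of rank r, and
-- A and B are triangular for the lexicographic order, with diagonal entries ∏ ρ_h (over the down
-- steps of the path from h + 1 to h) and 1.  So the determinant is the product of these weights over
-- all paths; its recursion on the last step is that of the right hand side.  It suffices to
-- take for x the integers ≥ 3, where no u_j vanishes, since these values determine polynomials.

open import Defs
open import Data.Bool using (Bool; true; false; if_then_else_; _∧_; _∨_; T)
open import Data.Empty using (⊥)
open import Data.List using (List; []; _∷_; _++_; map; length; filter; replicate; applyUpTo; upTo; drop)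
open import Data.Nat as ℕ using (ℕ; zero; suc; _<_; _≤_; z≤n; s≤s)
open import Data.Product using (Σ; ∃; _×_; _,_; proj₁; proj₂)
open import Data.Sum using (_⊎_; inj₁; inj₂)
open import Data.Unit using (⊤)
open import Function using (_∘_; id; Equivalence)
open import Relation.Binary.PropositionalEquality hiding ([_])
open import Relation.Nullary using (yes; no; contradiction)
open import Relation.Nullary.Decidable using (T?; dec⇒maybe)
open import Tactic.RingSolver using (solve-∀)

-- `loops` and `composeD` follow lines through the middle row for as long as they run, while a state
-- sum advances along this row one position at a time. The bridge is the connection pattern of the
-- lines still open after m positions: each is dead (it ends at an isolated vertex), is joined by an
-- arc to another one on the same side, or is linked to one on the other side. A pattern stands for
-- a partial state sum, and a letter of `p` or `q` acts on it by a local move that straightens a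
-- line or closes a circuit, with a factor x for the circuit. No vertex is lost on the way, so the
-- circuits closed are those that `loops` counts. The zeros of the Gram matrix come from the right
-- end, where every open line is required to step up. A dead line has a flat step and the two ends
-- of an arc have inverse steps, so only the pattern in which all open lines cross between the sides
-- survives, with value 1. The ratios ρ force a passage to numbers: the state sum needs all u_j to
-- be invertible.

-- Determinants by columns, and the determinant of a product of triangular matrices.

module Determinant where
  open import Data.List.Properties using (map-++; ++-assoc; map-applyUpTo)
  open import Data.Rational using (ℚ; _+_; _*_; -_; 0ℚ; 1ℚ)
  open import Data.Rational.Properties using (_≟_; +-*-commutativeRing; *-identityʳ; *-identityˡ; *-zeroˡ; *-zeroʳ; +-identityʳ; +-identityˡ)
  open import Tactic.RingSolver.Core.AlmostCommutativeRing using (AlmostCommutativeRing; fromCommutativeRing)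
  open import Level using (0ℓ)

  ring : AlmostCommutativeRing 0ℓ 0ℓ
  ring = fromCommutativeRing +-*-commutativeRing (λ q → dec⇒maybe (0ℚ ≟ q))

  ∑ : ℕ → (ℕ → ℚ) → ℚ
  ∑ zero    f = 0ℚ
  ∑ (suc n) f = f 0 + ∑ n (f ∘ suc)

  ∏ : ℕ → (ℕ → ℚ) → ℚ
  ∏ zero    f = 1ℚ
  ∏ (suc n) f = f 0 * ∏ n (f ∘ suc)

  ∑-cong : ∀ n {f g : ℕ → ℚ} → (∀ i → i ℕ.< n → f i ≡ g i) → ∑ n f ≡ ∑ n g
  ∑-cong zero    e = refl
  ∑-cong (suc n) e = cong₂ _+_ (e 0 (s≤s z≤n)) (∑-cong n (λ i i<n → e (suc i) (s≤s i<n)))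

  ∑-zero : ∀ n {f : ℕ → ℚ} → (∀ i → i ℕ.< n → f i ≡ 0ℚ) → ∑ n f ≡ 0ℚ
  ∑-zero zero    e = refl
  ∑-zero (suc n) e rewrite e 0 (s≤s z≤n) | ∑-zero n (λ i i<n → e (suc i) (s≤s i<n)) = refl

  ∏-cong : ∀ n {f g : ℕ → ℚ} → (∀ i → i ℕ.< n → f i ≡ g i) → ∏ n f ≡ ∏ n g
  ∏-cong zero    e = refl
  ∏-cong (suc n) e = cong₂ _*_ (e 0 (s≤s z≤n)) (∏-cong n (λ i i<n → e (suc i) (s≤s i<n)))

  interchange : ∀ a b c d → (a + b) + (c + d) ≡ (a + c) + (b + d)
  interchange = solve-∀ ring

  ∑-+ : ∀ n (f g : ℕ → ℚ) → ∑ n (λ i → f i + g i) ≡ ∑ n f + ∑ n g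
  ∑-+ zero    f g = refl
  ∑-+ (suc n) f g rewrite ∑-+ n (f ∘ suc) (g ∘ suc) = interchange (f 0) (g 0) _ _

  distribˡ : ∀ a b c → a * (b + c) ≡ a * b + a * c
  distribˡ = solve-∀ ring

  ∑-*ˡ : ∀ n c (f : ℕ → ℚ) → c * ∑ n f ≡ ∑ n (λ i → c * f i)
  ∑-*ˡ zero    c f = *-zeroʳ c
  ∑-*ˡ (suc n) c f rewrite sym (∑-*ˡ n c (f ∘ suc)) = distribˡ c (f 0) _

  ∑-swap : ∀ m n (f : ℕ → ℕ → ℚ) → ∑ m (λ i → ∑ n (f i)) ≡ ∑ n (λ j → ∑ m (λ i → f i j))
  ∑-swap zero    n f = sym (∑-zero n (λ _ _ → refl))
  ∑-swap (suc m) n f rewrite ∑-swap m n (f ∘ suc) = sym (∑-+ n (f 0) _)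

  Column : Set
  Column = ℕ → ℚ

  tail : Column → Column
  tail u i = u (suc i)

  -- Laplace expansion along the first row, on the list of columns.  The first argument of
  -- `expand` holds the columns to the left of the current one, already without their first row.
  mutual
    detC : ℕ → List Column → ℚ
    detC zero    []      = 1ℚ
    detC zero    (_ ∷ _) = 0ℚ
    detC (suc n) vs      = expand n [] vs

    expand : ℕ → List Column → List Column → ℚ
    expand n ps []       = 0ℚ
    expand n ps (v ∷ vs) =
      v 0 * detC n (ps ++ map tail vs) + - expand n (ps ++ (tail v) ∷ []) vs

  private
    mid : ∀ (ps qs rs : List Column) v → (ps ++ v ∷ qs) ++ rs ≡ ps ++ v ∷ (qs ++ rs)
    mid ps qs rs v = ++-assoc ps (v ∷ qs) rs

    lin-tail : ∀ a b x d e f g → x * (a * d + b * e) + - (a * f + b * g)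
             ≡ a * (x * d + - f) + b * (x * e + - g)
    lin-tail = solve-∀ ring

    lin-both : ∀ u0 w0 a b d f g → (a * u0 + b * w0) * d + - (a * f + b * g)
             ≡ a * (u0 * d + - f) + b * (w0 * d + - g)
    lin-both = solve-∀ ring

    zero-both : ∀ a b → 0ℚ ≡ a * 0ℚ + b * 0ℚ
    zero-both = solve-∀ ring

  mutual
    -- The relation is asked for in the first `n` rows only, because the columns met in
    -- `detC-triangular` are controlled only there. With both coefficients 0 it shows that a zero
    -- column makes the determinant vanish.
    detC-linear : ∀ n ps qs {u v w} a b → (∀ i → i ℕ.< n → v i ≡ a * u i + b * w i) →
      detC n (ps ++ v ∷ qs) ≡ a * detC n (ps ++ u ∷ qs) + b * detC n (ps ++ w ∷ qs)
    detC-linear zero    []      qs a b e = zero-both a b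
    detC-linear zero    (_ ∷ _) qs a b e = zero-both a b
    detC-linear (suc n) ps      qs a b e = expand-linearʳ n [] ps qs a b e

    expand-linearˡ : ∀ n ps qs rs {u v w} a b → (∀ i → i ℕ.< n → v i ≡ a * u i + b * w i) →
      expand n (ps ++ v ∷ qs) rs ≡ a * expand n (ps ++ u ∷ qs) rs + b * expand n (ps ++ w ∷ qs) rs
    expand-linearˡ n ps qs []       a b e = zero-both a b
    expand-linearˡ n ps qs (r ∷ rs) {u} {v} {w} a b e
      rewrite mid ps qs (map tail rs) v | mid ps qs (map tail rs) u | mid ps qs (map tail rs) w
            | mid ps qs ((tail r) ∷ []) v | mid ps qs ((tail r) ∷ []) u | mid ps qs ((tail r) ∷ []) w
            | detC-linear n ps (qs ++ map tail rs) {u} {v} {w} a b e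
            | expand-linearˡ n ps (qs ++ (tail r) ∷ []) rs {u} {v} {w} a b e
      = lin-tail a b (r 0) _ _ _ _

    expand-linearʳ : ∀ n ps qs rs {u v w} a b → (∀ i → i ℕ.< suc n → v i ≡ a * u i + b * w i) →
      expand n ps (qs ++ v ∷ rs) ≡ a * expand n ps (qs ++ u ∷ rs) + b * expand n ps (qs ++ w ∷ rs)
    expand-linearʳ n ps [] rs {u} {v} {w} a b e
      rewrite expand-linearˡ n ps [] rs {tail u} {tail v} {tail w} a b (λ i i<n → e (suc i) (s≤s i<n)) | e 0 (s≤s z≤n)
      = lin-both (u 0) (w 0) a b _ _ _
    expand-linearʳ n ps (q ∷ qs) rs {u} {v} {w} a b e
      rewrite map-++ tail qs (v ∷ rs) | map-++ tail qs (u ∷ rs) | map-++ tail qs (w ∷ rs)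
            | sym (++-assoc ps (map tail qs) ((tail v) ∷ map tail rs))
            | sym (++-assoc ps (map tail qs) ((tail u) ∷ map tail rs))
            | sym (++-assoc ps (map tail qs) ((tail w) ∷ map tail rs))
            | detC-linear n (ps ++ map tail qs) (map tail rs) {tail u} {tail v} {tail w} a b (λ i i<n → e (suc i) (s≤s i<n))
            | expand-linearʳ n (ps ++ (tail q) ∷ []) qs rs {u} {v} {w} a b e
      = lin-tail a b (q 0) _ _ _ _

  private
    one-zero : ∀ a → a ≡ 1ℚ * a + 0ℚ * a
    one-zero = solve-∀ ring

    one-zero′ : ∀ a → 1ℚ * a + 0ℚ * a ≡ a
    one-zero′ = solve-∀ ring

  -- Columns are functions, so columns that agree in every row need not be identical; linearity with
  -- coefficients 1 and 0 replaces one by the other.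
  detC-cong : ∀ n ps qs {u v} → u ≗ v → detC n (ps ++ u ∷ qs) ≡ detC n (ps ++ v ∷ qs)
  detC-cong n ps qs {u} {v} e =
    trans (detC-linear n ps qs {v} {u} {v} 1ℚ 0ℚ (λ i _ → trans (e i) (one-zero (v i)))) (one-zero′ _)

  private
    zero-tail : ∀ x → x * 0ℚ + - 0ℚ ≡ 0ℚ
    zero-tail = solve-∀ ring

    cancel : ∀ {x y d e f} → x ≡ y → e ≡ d → f ≡ 0ℚ → x * d + - (y * e + - f) ≡ 0ℚ
    cancel {x} {d = d} refl refl refl = solved x d
      where
      solved : ∀ x d → x * d + - (x * d + - 0ℚ) ≡ 0ℚ
      solved = solve-∀ ring

  mutual
    detC-adjacent : ∀ n ps qs {u v} → u ≗ v → detC n (ps ++ u ∷ v ∷ qs) ≡ 0ℚ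
    detC-adjacent zero    []      qs e = refl
    detC-adjacent zero    (_ ∷ _) qs e = refl
    detC-adjacent (suc n) ps      qs e = expand-adjacentʳ n [] ps qs e

    expand-adjacentˡ : ∀ n ps qs rs {u v} → u ≗ v → expand n (ps ++ u ∷ v ∷ qs) rs ≡ 0ℚ
    expand-adjacentˡ n ps qs []       e = refl
    expand-adjacentˡ n ps qs (r ∷ rs) {u} {v} e
      rewrite ++-assoc ps (u ∷ v ∷ qs) (map tail rs) | ++-assoc ps (u ∷ v ∷ qs) ((tail r) ∷ [])
            | detC-adjacent n ps (qs ++ map tail rs) e
            | expand-adjacentˡ n ps (qs ++ (tail r) ∷ []) rs e
      = zero-tail (r 0)

    -- When the expansion reaches the pair, both columns contribute the same entry times the same
    -- minor, with opposite signs. In all later terms both stand among the columns already passed.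
    expand-adjacentʳ : ∀ n ps qs rs {u v} → u ≗ v → expand n ps (qs ++ u ∷ v ∷ rs) ≡ 0ℚ
    expand-adjacentʳ n ps [] rs {u} {v} e = begin
      u 0 * detC n (ps ++ tail v ∷ map tail rs)
        + - (v 0 * detC n ((ps ++ tail u ∷ []) ++ map tail rs) + - expand n ((ps ++ tail u ∷ []) ++ tail v ∷ []) rs)
        ≡⟨ cong₂ (λ xs ys → u 0 * detC n (ps ++ tail v ∷ map tail rs) + - (v 0 * detC n xs + - expand n ys rs))
             (++-assoc ps (tail u ∷ []) (map tail rs)) (++-assoc ps (tail u ∷ []) (tail v ∷ [])) ⟩
      u 0 * detC n (ps ++ tail v ∷ map tail rs)
        + - (v 0 * detC n (ps ++ tail u ∷ map tail rs) + - expand n (ps ++ tail u ∷ tail v ∷ []) rs)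
        ≡⟨ cancel (e 0) (detC-cong n ps (map tail rs) {tail u} {tail v} (e ∘ suc))
             (expand-adjacentˡ n ps [] rs {tail u} {tail v} (e ∘ suc)) ⟩
      0ℚ ∎
      where open ≡-Reasoning
    expand-adjacentʳ n ps (q ∷ qs) rs {u} {v} e
      rewrite map-++ tail qs (u ∷ v ∷ rs)
            | sym (++-assoc ps (map tail qs) ((tail u) ∷ (tail v) ∷ map tail rs))
            | detC-adjacent n (ps ++ map tail qs) (map tail rs) {tail u} {tail v} (e ∘ suc)
            | expand-adjacentʳ n (ps ++ (tail q) ∷ []) qs rs e
      = zero-tail (q 0)

  private
    sum-of-two : ∀ a b → a + b ≡ 1ℚ * a + 1ℚ * b
    sum-of-two = solve-∀ ring

    swap-from : ∀ d e f g → d ≡ 0ℚ → g ≡ 0ℚ →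
      1ℚ * (1ℚ * d + 1ℚ * e) + 1ℚ * (1ℚ * f + 1ℚ * g) ≡ 0ℚ → e ≡ - f
    swap-from _ e f _ refl refl h = trans (solved e f) (trans (cong (_+ - f) h) (+-identityˡ _))
      where
      solved : ∀ e f → e ≡ (1ℚ * (1ℚ * 0ℚ + 1ℚ * e) + 1ℚ * (1ℚ * f + 1ℚ * 0ℚ)) + - f
      solved = solve-∀ ring

  -- Polarisation: the determinant with `u+v` in both places vanishes and splits into four, of which
  -- the two with a repeated column vanish as well.
  detC-swap : ∀ n ps qs u v → detC n (ps ++ u ∷ v ∷ qs) ≡ - detC n (ps ++ v ∷ u ∷ qs)
  detC-swap n ps qs u v =
    swap-from _ _ _ _ (detC-adjacent n ps qs {u} (λ _ → refl)) (detC-adjacent n ps qs {v} (λ _ → refl))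
      (trans (sym expanded) (detC-adjacent n ps qs {u+v} (λ _ → refl)))
    where
    u+v : Column
    u+v i = u i + v i

    second : ∀ w → detC n (ps ++ w ∷ u+v ∷ qs) ≡ 1ℚ * detC n (ps ++ w ∷ u ∷ qs) + 1ℚ * detC n (ps ++ w ∷ v ∷ qs)
    second w
      rewrite sym (++-assoc ps (w ∷ []) (u+v ∷ qs)) | sym (++-assoc ps (w ∷ []) (u ∷ qs))
            | sym (++-assoc ps (w ∷ []) (v ∷ qs))
      = detC-linear n (ps ++ w ∷ []) qs {u} {u+v} {v} 1ℚ 1ℚ (λ i _ → sum-of-two (u i) (v i))

    expanded : detC n (ps ++ u+v ∷ u+v ∷ qs) ≡ _
    expanded = trans (detC-linear n ps (u+v ∷ qs) {u} {u+v} {v} 1ℚ 1ℚ (λ i _ → sum-of-two (u i) (v i)))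
                     (cong₂ (λ s t → 1ℚ * s + 1ℚ * t) (second u) (second v))

  detC-repeated : ∀ n ps qs rs v → detC n (ps ++ v ∷ qs ++ v ∷ rs) ≡ 0ℚ
  detC-repeated n ps []       rs v = detC-adjacent n ps rs {v} (λ _ → refl)
  detC-repeated n ps (q ∷ qs) rs v = begin
    detC n (ps ++ v ∷ q ∷ (qs ++ v ∷ rs))          ≡⟨ detC-swap n ps (qs ++ v ∷ rs) v q ⟩
    - detC n (ps ++ q ∷ v ∷ (qs ++ v ∷ rs))        ≡⟨ cong (λ l → - detC n l) (++-assoc ps (q ∷ []) _) ⟨
    - detC n ((ps ++ q ∷ []) ++ v ∷ qs ++ v ∷ rs)  ≡⟨ cong -_ (detC-repeated n (ps ++ q ∷ []) qs rs v) ⟩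
    - 0ℚ                                           ≡⟨⟩
    0ℚ ∎
    where open ≡-Reasoning

  linComb : (ℕ → ℚ) → List Column → Column
  linComb c []       i = 0ℚ
  linComb c (w ∷ ws) i = c 0 * w i + linComb (c ∘ suc) ws i

  -- The prefix `ps` collects the columns whose multiples have already been removed, so that the
  -- induction can run through `ws`.
  detC-columnOp : ∀ n ps ws c {u v} → (∀ i → v i ≡ u i + linComb c ws i) →
    detC n (v ∷ ps ++ ws) ≡ detC n (u ∷ ps ++ ws)
  detC-columnOp n ps []       c {u} e = detC-cong n [] (ps ++ []) (λ i → trans (e i) (+-identityʳ (u i)))
  detC-columnOp n ps (w ∷ ws) c {u} {v} e = begin
    detC n (v ∷ ps ++ w ∷ ws)
      ≡⟨ detC-linear n [] (ps ++ w ∷ ws) {u′} {v} {w} 1ℚ (c 0) (λ i _ → trans (e i) (regroup (u i) (c 0 * w i) _)) ⟩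
    1ℚ * detC n (u′ ∷ ps ++ w ∷ ws) + c 0 * detC n (w ∷ ps ++ w ∷ ws)
      ≡⟨ cong (λ t → 1ℚ * detC n (u′ ∷ ps ++ w ∷ ws) + c 0 * t) (detC-repeated n [] ps ws w) ⟩
    1ℚ * detC n (u′ ∷ ps ++ w ∷ ws) + c 0 * 0ℚ
      ≡⟨ simp _ (c 0) ⟩
    detC n (u′ ∷ ps ++ w ∷ ws)
      ≡⟨ cong (λ l → detC n (u′ ∷ l)) (++-assoc ps (w ∷ []) ws) ⟨
    detC n (u′ ∷ (ps ++ w ∷ []) ++ ws)
      ≡⟨ detC-columnOp n (ps ++ w ∷ []) ws (c ∘ suc) {u} {u′} (λ i → refl) ⟩
    detC n (u ∷ (ps ++ w ∷ []) ++ ws)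
      ≡⟨ cong (λ l → detC n (u ∷ l)) (++-assoc ps (w ∷ []) ws) ⟩
    detC n (u ∷ ps ++ w ∷ ws) ∎
    where
    open ≡-Reasoning
    u′ : Column
    u′ i = u i + linComb (c ∘ suc) ws i

    regroup : ∀ a b d → a + (b + d) ≡ 1ℚ * (a + d) + b
    regroup = solve-∀ ring

    simp : ∀ d b → 1ℚ * d + b * 0ℚ ≡ d
    simp = solve-∀ ring

  -- Forward substitution for the system whose matrix is the transpose of `B`. When `B` is upper
  -- unitriangular, equation 0 determines unknown 0, which is then eliminated from the other
  -- equations.
  forwardSolve : ℕ → (ℕ → ℕ → ℚ) → (ℕ → ℚ) → ℕ → ℚ
  forwardSolve zero    B b _       = 0ℚ
  forwardSolve (suc n) B b zero    = b 0
  forwardSolve (suc n) B b (suc j) = forwardSolve n (λ i p → B (suc i) (suc p)) (λ p → b (suc p) + - (B 0 (suc p) * b 0)) j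

  UpperTriangular : ℕ → (ℕ → ℕ → ℚ) → Set
  UpperTriangular n A = ∀ i p → i ℕ.< n → p ℕ.< i → A i p ≡ 0ℚ

  private
    tailUpper : ∀ {n A} → UpperTriangular (suc n) A → UpperTriangular n (λ i p → A (suc i) (suc p))
    tailUpper t i p i<n p<i = t (suc i) (suc p) (s≤s i<n) (s≤s p<i)

  forwardSolve-correct : ∀ n B b → UpperTriangular n B → (∀ i → i ℕ.< n → B i i ≡ 1ℚ) →
    ∀ p → p ℕ.< n → ∑ n (λ j → B j p * forwardSolve n B b j) ≡ b p
  forwardSolve-correct (suc n) B b t d zero p<n = begin
    B 0 0 * b 0 + ∑ n (λ j → B (suc j) 0 * v j)
      ≡⟨ cong₂ (λ s t → s * b 0 + t) (d 0 p<n)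
           (∑-zero n (λ j j<n → trans (cong (_* v j) (t (suc j) 0 (s≤s j<n) (s≤s z≤n))) (*-zeroˡ (v j)))) ⟩
    1ℚ * b 0 + 0ℚ  ≡⟨ simp (b 0) ⟩
    b 0            ∎
    where
    open ≡-Reasoning
    v : ℕ → ℚ
    v = forwardSolve n (λ i p → B (suc i) (suc p)) (λ p → b (suc p) + - (B 0 (suc p) * b 0))
    simp : ∀ a → 1ℚ * a + 0ℚ ≡ a
    simp = solve-∀ ring
  forwardSolve-correct (suc n) B b t d (suc p) (s≤s p<n) =
    trans (cong (B 0 (suc p) * b 0 +_)
            (forwardSolve-correct n (λ i p → B (suc i) (suc p)) (λ p → b (suc p) + - (B 0 (suc p) * b 0))
               (tailUpper {n} {B} t) (λ i i<n → d (suc i) (s≤s i<n)) p p<n))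
          (simp (B 0 (suc p) * b 0) (b (suc p)))
    where
    simp : ∀ a b → a + (b + - a) ≡ b
    simp = solve-∀ ring

  linComb-applyUpTo : ∀ n c (g : ℕ → Column) i → linComb c (applyUpTo g n) i ≡ ∑ n (λ j → c j * g j i)
  linComb-applyUpTo zero    c g i = refl
  linComb-applyUpTo (suc n) c g i = cong (c 0 * g 0 i +_) (linComb-applyUpTo n (c ∘ suc) (g ∘ suc) i)

  -- Multiplicativity is avoided by column operations. If v solves the system with right hand side
  -- e_0 for the transpose of `B`, the combination of the columns with coefficients v is the first
  -- column of `A`, which is a multiple of e_0. Since v_0 = 1, it may replace the first column, and
  -- removing the first row and column leaves a product of the same kind.
  detC-triangular : ∀ n A B (g : ℕ → Column) → UpperTriangular n A → UpperTriangular n B →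
    (∀ i → i ℕ.< n → B i i ≡ 1ℚ) →
    (∀ i j → i ℕ.< n → j ℕ.< n → g j i ≡ ∑ n (λ p → A i p * B j p)) →
    detC n (applyUpTo g n) ≡ ∏ n (λ i → A i i)
  detC-triangular zero    A B g tA tB dB e = refl
  detC-triangular (suc n) A B g tA tB dB e = begin
    detC (suc n) (g 0 ∷ ws)
      ≡⟨ detC-columnOp (suc n) [] ws (v ∘ suc) {g 0} {λ i → g 0 i + linComb (v ∘ suc) ws i} (λ i → refl) ⟨
    detC (suc n) (w ∷ ws)
      ≡⟨⟩
    w 0 * detC n (map tail ws) + - expand n (tail w ∷ []) ws
      ≡⟨ cong₂ (λ s t → s * detC n (map tail ws) + - t) (w-entry 0 (s≤s z≤n))
           -- Below its first row the new column is zero, hence 0 times itself plus 0 times itself.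
           (trans (expand-linearˡ n [] [] ws {tail w} {tail w} {tail w} 0ℚ 0ℚ (λ i i<n → trans
               (trans (w-entry (suc i) (s≤s i<n)) (tA (suc i) 0 (s≤s i<n) (s≤s z≤n))) (sym (zero-zero (tail w i)))))
             (zero-zero (expand n (tail w ∷ []) ws))) ⟩
    A 0 0 * detC n (map tail ws) + - 0ℚ
      ≡⟨ +-identityʳ _ ⟩
    A 0 0 * detC n (map tail ws)
      ≡⟨ cong (λ l → A 0 0 * detC n l) (map-applyUpTo (g ∘ suc) tail n) ⟩
    A 0 0 * detC n (applyUpTo (λ j i → g (suc j) (suc i)) n)
      ≡⟨ cong (A 0 0 *_) (detC-triangular n (λ i p → A (suc i) (suc p)) (λ i p → B (suc i) (suc p))
           (λ j i → g (suc j) (suc i)) (tailUpper {n} {A} tA) (tailUpper {n} {B} tB) (λ i i<n → dB (suc i) (s≤s i<n)) tail-entry) ⟩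
    A 0 0 * ∏ n (λ i → A (suc i) (suc i)) ∎
    where
    open ≡-Reasoning
    ws : List Column
    ws = applyUpTo (g ∘ suc) n
    δ : ℕ → ℚ
    δ zero    = 1ℚ
    δ (suc _) = 0ℚ
    v : ℕ → ℚ
    v = forwardSolve (suc n) B δ
    w : Column
    w i = g 0 i + linComb (v ∘ suc) ws i

    tail-entry : ∀ i j → i ℕ.< n → j ℕ.< n → g (suc j) (suc i) ≡ ∑ n (λ p → A (suc i) (suc p) * B (suc j) (suc p))
    tail-entry i j i<n j<n = trans (e (suc i) (suc j) (s≤s i<n) (s≤s j<n))
      (trans (cong (λ a → a * B (suc j) 0 + rest) (tA (suc i) 0 (s≤s i<n) (s≤s z≤n))) (simp (B (suc j) 0) rest))
      where
      rest : ℚ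
      rest = ∑ n (λ p → A (suc i) (suc p) * B (suc j) (suc p))
      simp : ∀ a b → 0ℚ * a + b ≡ b
      simp = solve-∀ ring

    zero-zero : ∀ a → 0ℚ * a + 0ℚ * a ≡ 0ℚ
    zero-zero = solve-∀ ring

    shuffle : ∀ a b c → c * (a * b) ≡ a * (b * c)
    shuffle = solve-∀ ring

    A∙δ : ∀ i → ∑ (suc n) (λ p → A i p * δ p) ≡ A i 0
    A∙δ i = trans (cong₂ _+_ (*-identityʳ (A i 0)) (∑-zero n (λ p _ → *-zeroʳ (A i (suc p))))) (+-identityʳ _)

    spread : ∀ i j → i ℕ.< suc n → j ℕ.< suc n →
      v j * g j i ≡ ∑ (suc n) (λ p → A i p * (B j p * v j))
    spread i j i<n j<n = begin
      v j * g j i                                ≡⟨ cong (v j *_) (e i j i<n j<n) ⟩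
      v j * ∑ (suc n) (λ p → A i p * B j p)      ≡⟨ ∑-*ˡ (suc n) (v j) (λ p → A i p * B j p) ⟩
      ∑ (suc n) (λ p → v j * (A i p * B j p))    ≡⟨ ∑-cong (suc n) (λ p _ → shuffle (A i p) (B j p) (v j)) ⟩
      ∑ (suc n) (λ p → A i p * (B j p * v j))    ∎

    w-entry : ∀ i → i ℕ.< suc n → w i ≡ A i 0
    w-entry i i<n = begin
      g 0 i + linComb (v ∘ suc) ws i
        ≡⟨ cong₂ _+_ (sym (*-identityˡ (g 0 i))) (linComb-applyUpTo n (v ∘ suc) (g ∘ suc) i) ⟩
      ∑ (suc n) (λ j → v j * g j i)
        ≡⟨ ∑-cong (suc n) (λ j j<n → spread i j i<n j<n) ⟩
      ∑ (suc n) (λ j → ∑ (suc n) (λ p → A i p * (B j p * v j)))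
        ≡⟨ ∑-swap (suc n) (suc n) (λ j p → A i p * (B j p * v j)) ⟩
      ∑ (suc n) (λ p → ∑ (suc n) (λ j → A i p * (B j p * v j)))
        ≡⟨ ∑-cong (suc n) (λ p p<n → trans (sym (∑-*ˡ (suc n) (A i p) (λ j → B j p * v j)))
             (cong (A i p *_) (forwardSolve-correct (suc n) B δ tB dB p p<n))) ⟩
      ∑ (suc n) (λ p → A i p * δ p)
        ≡⟨ A∙δ i ⟩
      A i 0 ∎

-- Height steps, weights of arcs, and connection patterns of open lines.

module Forests where
  open Determinant using (ring)
  open import Data.Nat.Properties using (+-identityʳ; +-assoc; +-comm)
  open import Data.Nat.ListAction using (sum)
  open import Data.Rational using (ℚ; _+_; _*_; 0ℚ; 1ℚ)
  open import Data.Rational.Properties using (*-zeroˡ; *-comm)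

  inv : Step → Step
  inv up   = down
  inv flat = flat
  inv down = up

  shift : Step → ℕ → ℕ
  shift up   h       = suc h
  shift flat h       = h
  shift down zero    = zero
  shift down (suc h) = h

  Valid : Step → ℕ → Set
  Valid down zero = ⊥
  Valid _    _    = ⊤

  ∑ₛ : ℕ → (Step → ℕ → ℚ) → ℚ
  ∑ₛ zero    g = g up 1 + g flat 0
  ∑ₛ (suc h) g = g up (suc (suc h)) + (g flat (suc h) + g down h)

  -- The first argument is the step from the region outside an arc to the region inside it, the
  -- second the height outside.
  Weight : Set
  Weight = Step → ℕ → ℚ

  -- Joining the two topmost entries of a stack that leads to height h: their steps must be inverse
  -- to each other, hence the lower one also starts at height h.
  match : Weight → ℕ → Step → Step → ℚ
  match w h up   down = w down h
  match w h flat flat = w flat h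
  match w h down up   = w up h
  match w h _    _    = 0ℚ

  flatness : Step → ℚ
  flatness flat = 1ℚ
  flatness _    = 0ℚ

  -- A letter acts on the line just pushed: `up` leaves it open, `flat` ends it at an isolated
  -- vertex, around which both sides belong to the same region, and `down` joins it to the next open
  -- line.
  coef : Weight → Step → ℕ → List Step → ℚ
  coef w up   h cs             = 1ℚ
  coef w flat h []             = 0ℚ
  coef w flat h (c ∷ cs)       = flatness c
  coef w down h []             = 0ℚ
  coef w down h (c ∷ [])       = 0ℚ
  coef w down h (c ∷ c′ ∷ cs)  = match w h c c′

  unstack : Step → List Step → List Step
  unstack up   cs = cs
  unstack flat cs = drop 1 cs
  unstack down cs = drop 2 cs

  apply : Weight → Step → ℕ → (List Step → ℚ) → List Step → ℚ
  apply w α h φ cs = coef w α h cs * φ (unstack α cs)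

  pow : ℚ → ℕ → ℚ
  pow x zero    = 1ℚ
  pow x (suc n) = x * pow x n

  -- Isolates what the reductions use of the Chebyshev ratios. The conditions are symmetric in the
  -- two weights, so a letter of the second word can be treated as one of the first after an
  -- exchange of sides.
  record Dual (x : ℚ) (w w′ : Weight) : Set where
    field
      zigzag  : ∀ c h → Valid c h → w c h * w′ (inv c) (shift c h) ≡ 1ℚ
      zigzag′ : ∀ c h → Valid c h → w′ c h * w (inv c) (shift c h) ≡ 1ℚ
      flat-w  : ∀ h → w flat h ≡ 1ℚ
      flat-w′ : ∀ h → w′ flat h ≡ 1ℚ
      loop    : ∀ h → ∑ₛ h (λ c _ → w′ c h * w c h) ≡ x

  Dual-sym : ∀ {x w w′} → Dual x w w′ → Dual x w′ w
  Dual-sym {x} {w} {w′} d = record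
    { zigzag = zigzag′ ; zigzag′ = zigzag ; flat-w = flat-w′ ; flat-w′ = flat-w ; loop = loop′ }
    where
    open Dual d
    loop′ : ∀ h → ∑ₛ h (λ c _ → w c h * w′ c h) ≡ x
    loop′ zero    = trans (cong₂ _+_ (*-comm (w up 0) _) (*-comm (w flat 0) _)) (loop zero)
    loop′ (suc h) = trans (cong₂ _+_ (*-comm (w up (suc h)) _)
                      (cong₂ _+_ (*-comm (w flat (suc h)) _) (*-comm (w down (suc h)) _))) (loop (suc h))

  private
    ×-distrib₂ : ∀ k a b → k * (a + b) ≡ k * a + k * b
    ×-distrib₂ = solve-∀ ring

    ×-distrib₃ : ∀ k a b c → k * (a + (b + c)) ≡ k * a + (k * b + k * c)
    ×-distrib₃ = solve-∀ ring

    +-interchange₂ : ∀ a b a′ b′ → (a + a′) + (b + b′) ≡ (a + b) + (a′ + b′)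
    +-interchange₂ = solve-∀ ring

    +-interchange₃ : ∀ a b c a′ b′ c′ → (a + a′) + ((b + b′) + (c + c′)) ≡ (a + (b + c)) + (a′ + (b′ + c′))
    +-interchange₃ = solve-∀ ring

    first₃ : ∀ a → a + (0ℚ + 0ℚ) ≡ a
    first₃ = solve-∀ ring

    second₃ : ∀ a → 0ℚ + (a + 0ℚ) ≡ a
    second₃ = solve-∀ ring

    third₃ : ∀ a → 0ℚ + (0ℚ + a) ≡ a
    third₃ = solve-∀ ring

    first₂ : ∀ a → a + 0ℚ ≡ a
    first₂ = solve-∀ ring

    second₂ : ∀ a → 0ℚ + a ≡ a
    second₂ = solve-∀ ring

    swap-× : ∀ a b c → a * (b * c) ≡ b * (a * c)
    swap-× = solve-∀ ring

  ∑ₛ-cong : ∀ h {g g′} → (∀ c → Valid c h → g c (shift c h) ≡ g′ c (shift c h)) → ∑ₛ h g ≡ ∑ₛ h g′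
  ∑ₛ-cong zero    e = cong₂ _+_ (e up _) (e flat _)
  ∑ₛ-cong (suc h) e = cong₂ _+_ (e up _) (cong₂ _+_ (e flat _) (e down _))

  ∑ₛ-* : ∀ h k g → ∑ₛ h (λ c h′ → k * g c h′) ≡ k * ∑ₛ h g
  ∑ₛ-* zero    k g = sym (×-distrib₂ k _ _)
  ∑ₛ-* (suc h) k g = sym (×-distrib₃ k _ _ _)

  ∑ₛ-+ : ∀ h g g′ → ∑ₛ h (λ c h′ → g c h′ + g′ c h′) ≡ ∑ₛ h g + ∑ₛ h g′
  ∑ₛ-+ zero    g g′ = +-interchange₂ (g up 1) (g flat 0) (g′ up 1) (g′ flat 0)
  ∑ₛ-+ (suc h) g g′ = +-interchange₃ (g up (suc (suc h))) (g flat (suc h)) (g down h)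
                                     (g′ up (suc (suc h))) (g′ flat (suc h)) (g′ down h)

  ∑ₛ-single : ∀ c h g → Valid c h → (∀ c′ h′ → c′ ≢ c → g c′ h′ ≡ 0ℚ) → ∑ₛ h g ≡ g c (shift c h)
  ∑ₛ-single up   zero    g v z rewrite z flat 0 (λ ()) = first₂ _
  ∑ₛ-single flat zero    g v z rewrite z up 1 (λ ()) = second₂ _
  ∑ₛ-single up   (suc h) g v z rewrite z flat (suc h) (λ ()) | z down h (λ ()) = first₃ _
  ∑ₛ-single flat (suc h) g v z rewrite z up (suc (suc h)) (λ ()) | z down h (λ ()) = second₃ _
  ∑ₛ-single down (suc h) g v z rewrite z up (suc (suc h)) (λ ()) | z flat (suc h) (λ ()) = third₃ _

  inv-involutive : ∀ c → inv (inv c) ≡ c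
  inv-involutive up   = refl
  inv-involutive flat = refl
  inv-involutive down = refl

  shift-inv : ∀ c h → Valid c h → shift (inv c) (shift c h) ≡ h
  shift-inv up   h       v = refl
  shift-inv flat h       v = refl
  shift-inv down (suc h) v = refl

  Valid-inv : ∀ c h → Valid c h → Valid (inv c) (shift c h)
  Valid-inv up   h       v = _
  Valid-inv flat zero    v = _
  Valid-inv flat (suc h) v = _
  Valid-inv down h       v = _

  match-inv : ∀ w h c → match w h (inv c) c ≡ w c h
  match-inv w h up   = refl
  match-inv w h flat = refl
  match-inv w h down = refl

  match-off : ∀ w h c c′ → c′ ≢ inv c → match w h c c′ ≡ 0ℚ
  match-off w h up   up   n = refl
  match-off w h up   flat n = refl
  match-off w h up   down n = contradiction refl n
  match-off w h flat up   n = refl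
  match-off w h flat flat n = contradiction refl n
  match-off w h flat down n = refl
  match-off w h down up   n = contradiction refl n
  match-off w h down flat n = refl
  match-off w h down down n = refl

  -- Alternating walks in the middle row and the patterns that they form.

  data Side : Set where
    P Q : Side

  opp : Side → Side
  opp P = Q
  opp Q = P

  -- The edge of a middle vertex inside one of the two diagrams; `through` leads to the outer row of
  -- that diagram.
  data Link : Set where
    to                : ℕ → Link
    isolated through : Link

  weigh : (ℕ → ℕ) → List ℕ → ℕ
  weigh f xs = sum (map f xs)

  weigh-++ : ∀ f xs ys → weigh f (xs ++ ys) ≡ weigh f xs ℕ.+ weigh f ys
  weigh-++ f []       ys = refl
  weigh-++ f (x ∷ xs) ys = trans (cong (f x ℕ.+_) (weigh-++ f xs ys)) (sym (+-assoc (f x) _ _))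

  module Graph (e : Side → ℕ → Link) where

    record Edge (a : Side) (u v : ℕ) : Set where
      constructor edge
      field
        there : e a u ≡ to v
        back  : e a v ≡ to u

    flip-edge : ∀ {a u v} → Edge a u v → Edge a v u
    flip-edge (edge t b) = edge b t

    -- An alternating walk from u to v; it uses neither the a-edge at u nor the b-edge at v.
    data Walk : Side → ℕ → Side → ℕ → Set where
      one  : ∀ {a b u} → b ≡ opp a → Walk a u b u
      step : ∀ {a b c u v w} → c ≡ opp a → Edge c u w → Walk c w b v → Walk a u b v

    verts : ∀ {a u b v} → Walk a u b v → List ℕ
    verts (one {u = u} _)      = u ∷ []
    verts (step {u = u} _ _ W) = u ∷ verts W

    join : ∀ {a u b v w c z} → Walk a u b v → Edge b v w → Walk b w c z → Walk a u c z
    join (one eq)       d W = step eq d W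
    join (step eq d′ V) d W = step eq d′ (join V d W)

    verts-join : ∀ {a u b v w c z} (V : Walk a u b v) (d : Edge b v w) (W : Walk b w c z) →
      verts (join V d W) ≡ verts V ++ verts W
    verts-join (one eq)               d W = refl
    verts-join (step {u = u} eq d′ V) d W = cong (u ∷_) (verts-join V d W)

    opp-sym : ∀ {a b} → b ≡ opp a → a ≡ opp b
    opp-sym {P} refl = refl
    opp-sym {Q} refl = refl

    reverse : ∀ {a u b v} → Walk a u b v → Walk b v a u
    reverse (one eq)      = one (opp-sym eq)
    reverse (step eq d W) = join (reverse W) (flip-edge d) (one (opp-sym eq))

    vw : (ℕ → ℕ) → ∀ {a u b v} → Walk a u b v → ℕ
    vw f W = weigh f (verts W)

    vw-join : ∀ f {a u b v w c z} (V : Walk a u b v) (d : Edge b v w) (W : Walk b w c z) →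
      vw f (join V d W) ≡ vw f V ℕ.+ vw f W
    vw-join f V d W = trans (cong (weigh f) (verts-join V d W)) (weigh-++ f (verts V) (verts W))

    vw-reverse : ∀ f {a u b v} (W : Walk a u b v) → vw f (reverse W) ≡ vw f W
    vw-reverse f (one eq) = refl
    vw-reverse f (step {u = u} eq d W) = trans (vw-join f (reverse W) (flip-edge d) (one (opp-sym eq)))
      (trans (cong₂ ℕ._+_ (vw-reverse f W) (+-identityʳ (f u))) (+-comm _ (f u)))

    record Dead (a : Side) (u : ℕ) : Set where
      constructor dead
      field
        {side}  : Side
        {end}   : ℕ
        walk    : Walk a u side end
        stopped : e side end ≡ isolated

    -- The top of a stack (the part above the position list of the second index) whose entries
    -- are connected only among themselves or to isolated vertices.
    data Forest (a : Side) : List ℕ → List ℕ → Set where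
      []  : ∀ {st} → Forest a st st
      dot : ∀ {u st base} → Dead a u → Forest a st base → Forest a (u ∷ st) base
      arc : ∀ {u v inner st base} → Walk a u a v → Forest a inner (u ∷ st) → Forest a st base →
            Forest a (v ∷ inner) base

    -- The rest of a stack, up to its topmost entry connected to the other stack.
    data Core (a : Side) : List ℕ → List ℕ → Set where
      []  : Core a [] []
      opn : ∀ {u st mid os} → Forest a st mid → Core a mid os → Core a (u ∷ st) (u ∷ os)

    -- Open entries of the two stacks are paired in stack order. This and the nesting in `Forest`
    -- are the form in which planarity enters; the reductions preserve both, so nothing geometric
    -- has to be proved about crossings.
    data Links (a b : Side) : List ℕ → List ℕ → Set where
      []  : Links a b [] []
      _∷_ : ∀ {u v us vs} → Walk a u b v → Links a b us vs → Links a b (u ∷ us) (v ∷ vs)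

    record State (a b : Side) (st st′ : List ℕ) : Set where
      constructor state
      field
        {mid os mid′ os′} : List ℕ
        F : Forest a st mid
        C : Core a mid os
        G : Forest b st′ mid′
        D : Core b mid′ os′
        L : Links a b os os′

    infixr 5 _⊕_
    _⊕_ : ∀ {a st mid base} → Forest a st mid → Forest a mid base → Forest a st base
    []        ⊕ H = H
    dot d F   ⊕ H = dot d (F ⊕ H)
    arc W I F ⊕ H = arc W I (F ⊕ H)

    swapLinks : ∀ {a b us vs} → Links a b us vs → Links b a vs us
    swapLinks []      = []
    swapLinks (W ∷ L) = reverse W ∷ swapLinks L

    swap : ∀ {a b st st′} → State a b st st′ → State b a st′ st
    swap (state F C G D L) = state G D F C (swapLinks L)

    module _ (f : ℕ → ℕ) where
      vF : ∀ {a st base} → Forest a st base → ℕ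
      vF []                = 0
      vF (dot (dead W _) F) = vw f W ℕ.+ vF F
      vF (arc W I F)       = vw f W ℕ.+ vF I ℕ.+ vF F

      vC : ∀ {a st os} → Core a st os → ℕ
      vC []        = 0
      vC (opn F C) = vF F ℕ.+ vC C

      vL : ∀ {a b us vs} → Links a b us vs → ℕ
      vL []      = 0
      vL (W ∷ L) = vw f W ℕ.+ vL L

      -- With `f` arbitrary this is the multiset of all vertices on the walks of a state; equality
      -- of such sums for every `f` takes the place of permutations of lists.
      total : ∀ {a b st st′} → State a b st st′ → ℕ
      total (state F C G D L) = vF F ℕ.+ vC C ℕ.+ (vF G ℕ.+ vC D) ℕ.+ vL L

      vF-⊕ : ∀ {a st mid base} (F : Forest a st mid) (H : Forest a mid base) → vF (F ⊕ H) ≡ vF F ℕ.+ vF H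
      vF-⊕ []                 H = refl
      vF-⊕ (dot (dead W _) F) H = trans (cong (vw f W ℕ.+_) (vF-⊕ F H)) (sym (+-assoc (vw f W) _ _))
      vF-⊕ (arc W I F)        H = trans (cong (vw f W ℕ.+ vF I ℕ.+_) (vF-⊕ F H)) (sym (+-assoc (vw f W ℕ.+ vF I) _ _))

      vL-swap : ∀ {a b us vs} (L : Links a b us vs) → vL (swapLinks L) ≡ vL L
      vL-swap []      = refl
      vL-swap (W ∷ L) = cong₂ ℕ._+_ (vw-reverse f W) (vL-swap L)

      total-swap : ∀ {a b st st′} (s : State a b st st′) → total (swap s) ≡ total s
      total-swap (state F C G D L) = cong₂ ℕ._+_ (+-comm (vF G ℕ.+ vC D) _) (vL-swap L)

    Functional : Set
    Functional = ℕ → List Step → List Step → ℚ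

    -- Summation over the heights compatible with the pattern, in continuation style. Entries are
    -- pushed from the bottom of the stack upwards, a dead line with step `flat`, the ends of an arc
    -- with inverse steps around those of its inside; `φ` receives the finished stack. The region
    -- outside all arcs of the forest has height `h`.
    ⟦_⟧ : ∀ {a st base} → Forest a st base → Weight → ℕ → (List Step → ℚ) → List Step → ℚ
    ⟦ [] ⟧        w h φ cs = φ cs
    ⟦ dot _ F ⟧   w h φ cs = ⟦ F ⟧ w h (λ cs → φ (flat ∷ cs)) cs
    ⟦ arc _ I F ⟧ w h φ cs =
      ⟦ F ⟧ w h (λ cs → ∑ₛ h (λ c h′ → w c h * ⟦ I ⟧ w h′ (λ cs → φ (inv c ∷ cs)) (c ∷ cs))) cs

    ⟦⟧-cong : ∀ {a st base} (F : Forest a st base) w h {φ ψ} → (∀ cs → φ cs ≡ ψ cs) → ∀ cs → ⟦ F ⟧ w h φ cs ≡ ⟦ F ⟧ w h ψ cs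
    ⟦⟧-cong []          w h eq cs = eq cs
    ⟦⟧-cong (dot _ F)   w h eq cs = ⟦⟧-cong F w h (λ cs → eq (flat ∷ cs)) cs
    ⟦⟧-cong (arc _ I F) w h eq cs = ⟦⟧-cong F w h (λ cs → ∑ₛ-cong h (λ c _ →
      cong (w c h *_) (⟦⟧-cong I w (shift c h) (λ cs → eq (inv c ∷ cs)) (c ∷ cs)))) cs

    ⟦⟧-* : ∀ {a st base} (F : Forest a st base) w h k φ cs → ⟦ F ⟧ w h (λ cs → k * φ cs) cs ≡ k * ⟦ F ⟧ w h φ cs
    ⟦⟧-* []          w h k φ cs = refl
    ⟦⟧-* (dot _ F)   w h k φ cs = ⟦⟧-* F w h k (λ cs → φ (flat ∷ cs)) cs
    ⟦⟧-* (arc _ I F) w h k φ cs = trans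
      (⟦⟧-cong F w h (λ cs → trans (∑ₛ-cong h (λ c _ → trans
          (cong (w c h *_) (⟦⟧-* I w (shift c h) k (λ cs → φ (inv c ∷ cs)) (c ∷ cs)))
          (swap-× (w c h) k _)))
        (∑ₛ-* h k (λ c h′ → w c h * ⟦ I ⟧ w h′ (λ cs → φ (inv c ∷ cs)) (c ∷ cs)))) cs)
      (⟦⟧-* F w h k _ cs)

    ⟦⟧-+ : ∀ {a st base} (F : Forest a st base) w h φ ψ cs → ⟦ F ⟧ w h (λ cs → φ cs + ψ cs) cs ≡ ⟦ F ⟧ w h φ cs + ⟦ F ⟧ w h ψ cs
    ⟦⟧-+ []          w h φ ψ cs = refl
    ⟦⟧-+ (dot _ F)   w h φ ψ cs = ⟦⟧-+ F w h (λ cs → φ (flat ∷ cs)) (λ cs → ψ (flat ∷ cs)) cs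
    ⟦⟧-+ (arc _ I F) w h φ ψ cs = trans
      (⟦⟧-cong F w h (λ cs → trans (∑ₛ-cong h (λ c _ → trans
          (cong (w c h *_) (⟦⟧-+ I w (shift c h) (λ cs → φ (inv c ∷ cs)) (λ cs → ψ (inv c ∷ cs)) (c ∷ cs)))
          (×-distrib₂ (w c h) _ _)))
        (∑ₛ-+ h (λ c h′ → w c h * ⟦ I ⟧ w h′ (λ cs → φ (inv c ∷ cs)) (c ∷ cs))
                (λ c h′ → w c h * ⟦ I ⟧ w h′ (λ cs → ψ (inv c ∷ cs)) (c ∷ cs)))) cs)
      (⟦⟧-+ F w h _ _ cs)

    ⟦⟧-zero : ∀ {a st base} (F : Forest a st base) w h {φ} cs → (∀ cs → φ cs ≡ 0ℚ) → ⟦ F ⟧ w h φ cs ≡ 0ℚ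
    ⟦⟧-zero F w h {φ} cs z = trans (⟦⟧-cong F w h (λ cs → trans (z cs) (sym (*-zeroˡ (φ cs)))) cs)
      (trans (⟦⟧-* F w h 0ℚ φ cs) (*-zeroˡ (⟦ F ⟧ w h φ cs)))

    ⟦⟧-∑ₛ : ∀ {a st base} (F : Forest a st base) w h k (φ : Step → ℕ → List Step → ℚ) cs →
      ⟦ F ⟧ w h (λ cs → ∑ₛ k (λ c h′ → φ c h′ cs)) cs ≡ ∑ₛ k (λ c h′ → ⟦ F ⟧ w h (φ c h′) cs)
    ⟦⟧-∑ₛ F w h zero    φ cs = ⟦⟧-+ F w h (φ up 1) (φ flat 0) cs
    ⟦⟧-∑ₛ F w h (suc k) φ cs = trans (⟦⟧-+ F w h (φ up (suc (suc k))) (λ cs → φ flat (suc k) cs + φ down k cs) cs)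
      (cong (⟦ F ⟧ w h (φ up (suc (suc k))) cs +_) (⟦⟧-+ F w h (φ flat (suc k)) (φ down k) cs))

    ⟦⟧-comm : ∀ {a st base b st′ base′} (F : Forest a st base) (G : Forest b st′ base′) w w′ h h′ φ cs ds →
      ⟦ F ⟧ w h (λ cs → ⟦ G ⟧ w′ h′ (φ cs) ds) cs ≡ ⟦ G ⟧ w′ h′ (λ ds → ⟦ F ⟧ w h (λ cs → φ cs ds) cs) ds
    ⟦⟧-comm []          G w w′ h h′ φ cs ds = refl
    ⟦⟧-comm (dot _ F)   G w w′ h h′ φ cs ds = ⟦⟧-comm F G w w′ h h′ (λ cs → φ (flat ∷ cs)) cs ds
    ⟦⟧-comm (arc _ I F) G w w′ h h′ φ cs ds = trans
      (⟦⟧-cong F w h (λ cs → trans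
        (∑ₛ-cong h (λ c _ → trans
          (cong (w c h *_) (⟦⟧-comm I G w w′ (shift c h) h′ (λ cs → φ (inv c ∷ cs)) (c ∷ cs) ds))
          (sym (⟦⟧-* G w′ h′ (w c h) _ ds))))
        (sym (⟦⟧-∑ₛ G w′ h′ h (λ c h″ ds → w c h * ⟦ I ⟧ w h″ (λ cs → φ (inv c ∷ cs) ds) (c ∷ cs)) ds))) cs)
      (⟦⟧-comm F G w w′ h h′ (λ cs ds → ∑ₛ h (λ c h″ → w c h * ⟦ I ⟧ w h″ (λ cs → φ (inv c ∷ cs) ds) (c ∷ cs))) cs ds)

    ⟦⟧-⊕ : ∀ {a st mid base} (F : Forest a st mid) (H : Forest a mid base) w h φ cs →
      ⟦ F ⊕ H ⟧ w h φ cs ≡ ⟦ H ⟧ w h (⟦ F ⟧ w h φ) cs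
    ⟦⟧-⊕ []          H w h φ cs = refl
    ⟦⟧-⊕ (dot _ F)   H w h φ cs = ⟦⟧-⊕ F H w h (λ cs → φ (flat ∷ cs)) cs
    ⟦⟧-⊕ (arc _ I F) H w h φ cs = ⟦⟧-⊕ F H w h _ cs

    -- An arc above the first stack carries the weight with which the second stack closes arcs:
    -- by duality this is what makes straightening a zigzag cost nothing.
    module _ (w w′ : Weight) where
      forests : ∀ {a st mid b st′ mid′} → Forest a st mid → Forest b st′ mid′ → Functional → Functional
      forests F G φ h cs ds = ⟦ F ⟧ w′ h (λ cs → ⟦ G ⟧ w h (φ h cs) ds) cs

      -- Lines that join the two stacks are read from the bottom, starting in the region of height
      -- 0. Such a line crosses from one side to the other, so it makes the same step on both stacks
      -- and carries no weight.
      cores : ∀ {a mid os b mid′ os′} → Core a mid os → Core b mid′ os′ → Links a b os os′ → Functional → ℚ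
      cores []        []        []      φ = φ 0 [] []
      cores (opn F C) (opn G D) (_ ∷ L) φ =
        cores C D L (forests F G (λ h cs ds → ∑ₛ h (λ c h′ → φ h′ (c ∷ cs) (c ∷ ds))))

      value : ∀ {a b st st′} → State a b st st′ → Functional → ℚ
      value (state F C G D L) φ = cores C D L (forests F G φ)

    forests-cong : ∀ w w′ {a st mid b st′ mid′} (F : Forest a st mid) (G : Forest b st′ mid′) {φ ψ} →
      (∀ h cs ds → φ h cs ds ≡ ψ h cs ds) → ∀ h cs ds → forests w w′ F G φ h cs ds ≡ forests w w′ F G ψ h cs ds
    forests-cong w w′ F G eq h cs ds = ⟦⟧-cong F w′ h (λ cs → ⟦⟧-cong G w h (λ ds → eq h cs ds) ds) cs

    cores-cong : ∀ w w′ {a mid os b mid′ os′} (C : Core a mid os) (D : Core b mid′ os′) (L : Links a b os os′) {φ ψ} →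
      (∀ h cs ds → φ h cs ds ≡ ψ h cs ds) → cores w w′ C D L φ ≡ cores w w′ C D L ψ
    cores-cong w w′ []        []        []      eq = eq 0 [] []
    cores-cong w w′ (opn F C) (opn G D) (_ ∷ L) eq = cores-cong w w′ C D L
      (forests-cong w w′ F G (λ h cs ds → ∑ₛ-cong h (λ c _ → eq (shift c h) (c ∷ cs) (c ∷ ds))))

    forests-* : ∀ w w′ {a st mid b st′ mid′} (F : Forest a st mid) (G : Forest b st′ mid′) k φ h cs ds →
      forests w w′ F G (λ h cs ds → k * φ h cs ds) h cs ds ≡ k * forests w w′ F G φ h cs ds
    forests-* w w′ F G k φ h cs ds =
      trans (⟦⟧-cong F w′ h (λ cs → ⟦⟧-* G w h k (φ h cs) ds) cs) (⟦⟧-* F w′ h k _ cs)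

    cores-* : ∀ w w′ {a mid os b mid′ os′} (C : Core a mid os) (D : Core b mid′ os′) (L : Links a b os os′) k φ →
      cores w w′ C D L (λ h cs ds → k * φ h cs ds) ≡ k * cores w w′ C D L φ
    cores-* w w′ []        []        []      k φ = refl
    cores-* w w′ (opn F C) (opn G D) (_ ∷ L) k φ = trans
      (cores-cong w w′ C D L (λ h cs ds → trans
        (forests-cong w w′ F G (λ h cs ds → ∑ₛ-* h k (λ c h′ → φ h′ (c ∷ cs) (c ∷ ds))) h cs ds)
        (forests-* w w′ F G k (λ h cs ds → ∑ₛ h (λ c h′ → φ h′ (c ∷ cs) (c ∷ ds))) h cs ds)))
      (cores-* w w′ C D L k _)

    forests-swap : ∀ w w′ {a st mid b st′ mid′} (F : Forest a st mid) (G : Forest b st′ mid′) φ h cs ds →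
      forests w w′ F G φ h cs ds ≡ forests w′ w G F (λ h ds cs → φ h cs ds) h ds cs
    forests-swap w w′ F G φ h cs ds = ⟦⟧-comm F G w′ w h h (φ h) cs ds

    cores-swap : ∀ w w′ {a mid os b mid′ os′} (C : Core a mid os) (D : Core b mid′ os′) (L : Links a b os os′) φ →
      cores w w′ C D L φ ≡ cores w′ w D C (swapLinks L) (λ h ds cs → φ h cs ds)
    cores-swap w w′ []        []        []      φ = refl
    cores-swap w w′ (opn F C) (opn G D) (_ ∷ L) φ = trans
      (cores-swap w w′ C D L (forests w w′ F G (λ h cs ds → ∑ₛ h (λ c h′ → φ h′ (c ∷ cs) (c ∷ ds)))))
      (cores-cong w′ w D C (swapLinks L) (λ h ds cs → forests-swap w w′ F G (λ h cs ds → ∑ₛ h (λ c h′ → φ h′ (c ∷ cs) (c ∷ ds))) h cs ds))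

    value-swap : ∀ w w′ {a b st st′} (s : State a b st st′) φ →
      value w w′ s φ ≡ value w′ w (swap s) (λ h ds cs → φ h cs ds)
    value-swap w w′ (state F C G D L) φ = trans (cores-swap w w′ C D L (forests w w′ F G φ))
      (cores-cong w′ w D C (swapLinks L) (λ h ds cs → forests-swap w w′ F G φ h cs ds))

    value-cong : ∀ w w′ {a b st st′} (s : State a b st st′) {φ ψ} →
      (∀ h cs ds → φ h cs ds ≡ ψ h cs ds) → value w w′ s φ ≡ value w w′ s ψ
    value-cong w w′ (state F C G D L) eq = cores-cong w w′ C D L (forests-cong w w′ F G eq)

-- Local moves: the effect of one letter on a connection pattern and on its state sum.

module Reduction where
  open Determinant using (ring)
  open Forests
  open import Data.Nat using (_+_)
  open import Data.Nat.Properties using (+-identityʳ; +-comm)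
  open import Data.Nat.Tactic.RingSolver using (solve) renaming (solve-∀ to solve-∀ℕ)
  open import Data.Rational using (ℚ; _*_; 0ℚ; 1ℚ)
  open import Data.Rational.Properties using (*-identityˡ; *-zeroˡ; *-zeroʳ; *-assoc; *-comm)

  module Reducts (e : Side → ℕ → Link) where
    open Graph e

    data Completed : List ℕ → ℕ → Set where
      none  : Completed [] 0
      cycle : ∀ {a u v} (W : Walk a u a v) → Edge a v u → Completed (verts W) 1
      path  : ∀ {a u c z} (W : Walk a u c z) → e a u ≡ isolated → e c z ≡ isolated → Completed (verts W) 0

    -- `semantic` transfers the change of pattern to the state sums. `counted` keeps the vertices
    -- under control, so that the circuits found here can later be identified with those found by
    -- `loopFrom`.
    record Reduct (x : ℚ) (w w′ : Weight) (α : Step) {a b st₁ st′} (s : State a b st₁ st′) (st₀ : List ℕ) : Set where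
      field
        new        : State a b st₀ st′
        {circuits} : ℕ
        {removed}  : List ℕ
        completed  : Completed removed circuits
        semantic   : ∀ φ → value w w′ s (λ h cs ds → apply w α h (λ cs → φ h cs ds) cs) ≡ pow x circuits * value w w′ new φ
        counted    : ∀ f → total f s ≡ total f new + weigh f removed

    module _ {x w w′} (dual : Dual x w w′) where
      open Dual dual

      record ForestReduct (α : Step) (n : ℕ) {a : Side} {st st* base : List ℕ} (F : Forest a st base) (F* : Forest a st* base) : Set where
        field
          at : ∀ h Ψ cs → ⟦ F ⟧ w′ h (apply w α h Ψ) cs ≡ pow x n * ⟦ F* ⟧ w′ h Ψ cs
      open ForestReduct

      private
        match-offˡ : ∀ h c → c ≢ flat → match w h c flat ≡ 0ℚ
        match-offˡ h up   n = refl
        match-offˡ h flat n = contradiction refl n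
        match-offˡ h down n = refl

        match-offʳ : ∀ h c → c ≢ flat → match w h flat c ≡ 0ℚ
        match-offʳ h up   n = refl
        match-offʳ h flat n = contradiction refl n
        match-offʳ h down n = refl

        flatness-off : ∀ c → c ≢ flat → flatness c ≡ 0ℚ
        flatness-off up   n = refl
        flatness-off flat n = contradiction refl n
        flatness-off down n = refl

        inv-flat : ∀ c → c ≢ flat → inv c ≢ flat
        inv-flat flat n _ = n refl

        valid-flat : ∀ h → Valid flat h
        valid-flat zero    = _
        valid-flat (suc h) = _

      -- A factor `κ` concentrated on one step fixes the height inside the arc, and its value there
      -- cancels the weight of the arc.
      arc-single : ∀ {a st base} (I : Forest a st base) c₀ h (κ : Step → ℚ) Ψ cs → Valid c₀ h →
        (∀ c → c ≢ c₀ → κ c ≡ 0ℚ) → w′ c₀ h * κ c₀ ≡ 1ℚ →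
        ∑ₛ h (λ c h′ → w′ c h * ⟦ I ⟧ w′ h′ (λ cs → κ c * Ψ cs) (c ∷ cs)) ≡ ⟦ I ⟧ w′ (shift c₀ h) Ψ (c₀ ∷ cs)
      arc-single I c₀ h κ Ψ cs valid off on = begin
        ∑ₛ h (λ c h′ → w′ c h * ⟦ I ⟧ w′ h′ (λ cs → κ c * Ψ cs) (c ∷ cs))
          ≡⟨ ∑ₛ-single c₀ h _ valid (λ c h′ c≢ → trans (cong (w′ c h *_) (⟦⟧-zero I w′ h′ (c ∷ cs)
               (λ cs → trans (cong (_* Ψ cs) (off c c≢)) (*-zeroˡ (Ψ cs))))) (*-zeroʳ (w′ c h))) ⟩
        w′ c₀ h * ⟦ I ⟧ w′ (shift c₀ h) (λ cs → κ c₀ * Ψ cs) (c₀ ∷ cs)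
          ≡⟨ cong (w′ c₀ h *_) (⟦⟧-* I w′ (shift c₀ h) (κ c₀) Ψ (c₀ ∷ cs)) ⟩
        w′ c₀ h * (κ c₀ * ⟦ I ⟧ w′ (shift c₀ h) Ψ (c₀ ∷ cs))
          ≡⟨ *-assoc (w′ c₀ h) (κ c₀) _ ⟨
        w′ c₀ h * κ c₀ * ⟦ I ⟧ w′ (shift c₀ h) Ψ (c₀ ∷ cs)
          ≡⟨ cong (_* ⟦ I ⟧ w′ (shift c₀ h) Ψ (c₀ ∷ cs)) on ⟩
        1ℚ * ⟦ I ⟧ w′ (shift c₀ h) Ψ (c₀ ∷ cs)
          ≡⟨ *-identityˡ _ ⟩
        ⟦ I ⟧ w′ (shift c₀ h) Ψ (c₀ ∷ cs) ∎
        where open ≡-Reasoning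

      open-single : ∀ {b st base} (G : Forest b st base) c₀ h (κ : Step → ℕ → ℚ) (φ : ℕ → List Step → ℚ) ds → Valid c₀ h →
        (∀ c h′ → c ≢ c₀ → κ c h′ ≡ 0ℚ) →
        ∑ₛ h (λ c h′ → ⟦ G ⟧ w h′ (λ ds → κ c h′ * φ h′ ds) (c ∷ ds))
          ≡ κ c₀ (shift c₀ h) * ⟦ G ⟧ w (shift c₀ h) (φ (shift c₀ h)) (c₀ ∷ ds)
      open-single G c₀ h κ φ ds valid off = trans
        (∑ₛ-single c₀ h _ valid (λ c h′ c≢ → ⟦⟧-zero G w h′ (c ∷ ds)
           (λ ds → trans (cong (_* φ h′ ds) (off c h′ c≢)) (*-zeroˡ (φ h′ ds)))))
        (⟦⟧-* G w (shift c₀ h) (κ c₀ (shift c₀ h)) (φ (shift c₀ h)) (c₀ ∷ ds))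

      open-flat : ∀ {b st base} (G : Forest b st base) h (κ : Step → ℕ → ℚ) (φ : ℕ → List Step → ℚ) ds →
        (∀ c h′ → c ≢ flat → κ c h′ ≡ 0ℚ) → κ flat h ≡ 1ℚ →
        ∑ₛ h (λ c h′ → ⟦ G ⟧ w h′ (λ ds → κ c h′ * φ h′ ds) (c ∷ ds)) ≡ ⟦ G ⟧ w h (φ h) (flat ∷ ds)
      open-flat G h κ φ ds off on = trans (open-single G flat h κ φ ds (valid-flat h) off)
        (trans (cong (_* ⟦ G ⟧ w h (φ h) (flat ∷ ds)) on) (*-identityˡ _))

      flat-flat : ∀ {a v u st base} {d : Dead a v} {d′ : Dead a u} {F : Forest a st base} →
        ForestReduct down 0 (dot d (dot d′ F)) F
      flat-flat {F = F} .at h Ψ cs = trans (⟦⟧-cong F w′ h (λ cs → cong (_* Ψ cs) (flat-w h)) cs) (⟦⟧-* F w′ h 1ℚ Ψ cs)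

      private
        with-one : ∀ {a b} → a ≡ b → a ≡ 1ℚ * b
        with-one {b = b} eq = trans eq (sym (*-identityˡ b))

      -- Joining a dead line to the upper end of an arc makes the lower end dead: the step across
      -- the arc is forced to be flat, where all weights are 1.
      flat-down : ∀ {a v u t inner st base} {d : Dead a v} {d′ : Dead a u} {W : Walk a u a t}
        {I : Forest a inner (u ∷ st)} {F : Forest a st base} →
        ForestReduct down 0 (dot d (arc W I F)) (I ⊕ dot d′ F)
      flat-down {d′ = d′} {I = I} {F} .at h Ψ cs = with-one (trans
        (⟦⟧-cong F w′ h (λ cs → arc-single I flat h (λ c → match w h flat (inv c)) Ψ cs (valid-flat h)
          (λ c c≢ → match-offʳ h (inv c) (inv-flat c c≢)) (cong₂ _*_ (flat-w′ h) (flat-w h))) cs)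
        (sym (⟦⟧-⊕ I (dot d′ F) w′ h Ψ cs)))

      down-flat : ∀ {a v u t inner st base} {d : Dead a v} {d′ : Dead a u} {W : Walk a u a t}
        {I : Forest a inner (u ∷ st)} {F : Forest a st base} →
        ForestReduct down 0 (arc W (dot d I) F) (I ⊕ dot d′ F)
      down-flat {d′ = d′} {I = I} {F} .at h Ψ cs = with-one (trans
        (⟦⟧-cong F w′ h (λ cs → arc-single I flat h (λ c → match w h (inv c) flat) Ψ cs (valid-flat h)
          (λ c c≢ → match-offˡ h (inv c) (inv-flat c c≢)) (cong₂ _*_ (flat-w′ h) (flat-w h))) cs)
        (sym (⟦⟧-⊕ I (dot d′ F) w′ h Ψ cs)))

      -- Joining the two ends of an empty arc closes a circuit. By `loop` the sum over the heights
      -- inside is x whatever the height outside, which is why it can be taken out of the state sum.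
      up-down : ∀ {a v u st base} {W : Walk a u a v} {F : Forest a st base} →
        ForestReduct down 1 (arc W [] F) F
      up-down {F = F} .at h Ψ cs = trans
        (⟦⟧-cong F w′ h (λ cs → begin
          ∑ₛ h (λ c _ → w′ c h * (match w h (inv c) c * Ψ cs))
            ≡⟨ ∑ₛ-cong h (λ c _ → trans (cong (λ m → w′ c h * (m * Ψ cs)) (match-inv w h c)) (rotate (w′ c h) (w c h) (Ψ cs))) ⟩
          ∑ₛ h (λ c _ → Ψ cs * (w′ c h * w c h))
            ≡⟨ ∑ₛ-* h (Ψ cs) (λ c _ → w′ c h * w c h) ⟩
          Ψ cs * ∑ₛ h (λ c _ → w′ c h * w c h)
            ≡⟨ cong (Ψ cs *_) (loop h) ⟩
          Ψ cs * x
            ≡⟨ finish (Ψ cs) x ⟩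
          x * 1ℚ * Ψ cs ∎) cs)
        (⟦⟧-* F w′ h (x * 1ℚ) Ψ cs)
        where
        open ≡-Reasoning
        rotate : ∀ a b c → a * (b * c) ≡ c * (a * b)
        rotate = solve-∀ ring
        finish : ∀ a b → a * b ≡ b * 1ℚ * a
        finish = solve-∀ ring

      -- The upper ends of two nested arcs are joined, which straightens an S-shaped line. The step
      -- across the inner arc must invert that across the outer one, so `I′` returns to the height
      -- `h` outside both, and `zigzag` cancels one arc weight against the weight of the joint.
      down-down : ∀ {a v u v′ u′ inner′ inner st base} {V : Walk a u a v} {U : Walk a u′ a v′} {W : Walk a u a u′}
        {I′ : Forest a inner′ (u′ ∷ inner)} {I : Forest a inner (u ∷ st)} {F : Forest a st base} →
        ForestReduct down 0 (arc V (arc U I′ I) F) (I′ ⊕ arc W I F)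
      down-down {W = W} {I′} {I} {F} .at h Ψ cs = with-one (trans
        (⟦⟧-cong F w′ h (λ cs → ∑ₛ-cong h (λ c valid → cong (w′ c h *_)
          (⟦⟧-cong I w′ (shift c h) (λ cs → trans
            (arc-single I′ (inv c) (shift c h) (λ c′ → match w h (inv c) (inv c′)) Ψ cs (Valid-inv c h valid)
              (λ c′ c′≢ → match-off w h (inv c) (inv c′) (λ eq → c′≢ (trans (sym (inv-involutive c′)) (trans (cong inv eq) (cong inv (inv-involutive c))))))
              (trans (cong (w′ (inv c) (shift c h) *_) (trans (cong (match w h (inv c)) (inv-involutive c)) (match-inv w h c)))
                (trans (*-comm (w′ (inv c) (shift c h)) (w c h)) (zigzag c h valid))))
            (cong (λ k → ⟦ I′ ⟧ w′ k Ψ (inv c ∷ cs)) (shift-inv c h valid)))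
          (c ∷ cs)))) cs)
        (sym (⟦⟧-⊕ I′ (arc W I F) w′ h Ψ cs)))

      kill-flat : ∀ {a v st base} {d : Dead a v} {F : Forest a st base} → ForestReduct flat 0 (dot d F) F
      kill-flat {F = F} .at h Ψ cs = ⟦⟧-* F w′ h 1ℚ Ψ cs

      kill-down : ∀ {a v u inner st base} {W : Walk a u a v} {d : Dead a u}
        {I : Forest a inner (u ∷ st)} {F : Forest a st base} →
        ForestReduct flat 0 (arc W I F) (I ⊕ dot d F)
      kill-down {d = d} {I} {F} .at h Ψ cs = with-one (trans
        (⟦⟧-cong F w′ h (λ cs → arc-single I flat h (λ c → flatness (inv c)) Ψ cs (valid-flat h)
          (λ c c≢ → flatness-off (inv c) (inv-flat c c≢)) (cong (_* 1ℚ) (flat-w′ h))) cs)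
        (sym (⟦⟧-⊕ I (dot d F) w′ h Ψ cs)))

      opened-flat : ∀ {a st mid b st₁ st₂ mid′ y} (F : Forest a st mid) {d : Dead b y} (G : Forest b st₁ (y ∷ st₂))
        (G′ : Forest b st₂ mid′) {X : Functional} φ →
        (∀ h cs ds → X h cs ds ≡ ⟦ G ⟧ w h (φ h cs) (flat ∷ ds)) →
        ∀ h cs ds → forests w w′ F G′ X h cs ds ≡ forests w w′ F (G ⊕ dot d G′) φ h cs ds
      opened-flat F {d} G G′ φ eq h cs ds = ⟦⟧-cong F w′ h (λ cs → trans
        (⟦⟧-cong G′ w h (λ ds → eq h cs ds) ds) (sym (⟦⟧-⊕ G (dot d G′) w h (φ h cs) ds))) cs

      -- A line linked to the other stack is joined to the upper end of an arc, so the link moves to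
      -- the lower end and `I` comes to lie beyond it. The bend goes through an arc and the new
      -- joint, whose weights cancel by `zigzag′`.
      opened-down : ∀ {a u t inner st mid b st₁ y st₂ mid′} (W : Walk a u a t)
        (I : Forest a inner (u ∷ st)) (F : Forest a st mid) (G : Forest b st₁ (y ∷ st₂)) (G′ : Forest b st₂ mid′) φ h cs ds →
        forests w w′ (arc W I F) G′ (λ h cs ds → ∑ₛ h (λ c h′ → ⟦ G ⟧ w h′
          (λ ds → apply w down h′ (λ cs → φ h′ cs ds) (c ∷ cs)) (c ∷ ds))) h cs ds
        ≡ forests w w′ F G′ (λ h cs ds → ∑ₛ h (λ c h′ → forests w w′ I G φ h′ (c ∷ cs) (c ∷ ds))) h cs ds
      opened-down W I F G G′ φ h cs ds = ⟦⟧-cong F w′ h (λ cs → begin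
        ∑ₛ h (λ c h′ → w′ c h * ⟦ I ⟧ w′ h′ (λ cs → ⟦ G′ ⟧ w h (λ ds → ∑ₛ h (λ c₁ h₁ →
            ⟦ G ⟧ w h₁ (λ ds → match w h₁ c₁ (inv c) * φ h₁ cs ds) (c₁ ∷ ds))) ds) (c ∷ cs))
          ≡⟨ ∑ₛ-cong h (λ c valid → cancel-arc c valid cs) ⟩
        ∑ₛ h (λ c h′ → ⟦ I ⟧ w′ h′ (λ cs → ⟦ G′ ⟧ w h (λ ds → ⟦ G ⟧ w h′ (φ h′ cs) (c ∷ ds)) ds) (c ∷ cs))
          ≡⟨ ∑ₛ-cong h (λ c _ → ⟦⟧-comm I G′ w′ w (shift c h) h (λ cs ds → ⟦ G ⟧ w (shift c h) (φ (shift c h) cs) (c ∷ ds)) (c ∷ cs) ds) ⟩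
        ∑ₛ h (λ c h′ → ⟦ G′ ⟧ w h (λ ds → ⟦ I ⟧ w′ h′ (λ cs → ⟦ G ⟧ w h′ (φ h′ cs) (c ∷ ds)) (c ∷ cs)) ds)
          ≡⟨ ⟦⟧-∑ₛ G′ w h h (λ c h′ ds → ⟦ I ⟧ w′ h′ (λ cs → ⟦ G ⟧ w h′ (φ h′ cs) (c ∷ ds)) (c ∷ cs)) ds ⟨
        ⟦ G′ ⟧ w h (λ ds → ∑ₛ h (λ c h′ → forests w w′ I G φ h′ (c ∷ cs) (c ∷ ds))) ds ∎) cs
        where
        open ≡-Reasoning
        cancel-arc : ∀ c → Valid c h → ∀ cs →
          w′ c h * ⟦ I ⟧ w′ (shift c h) (λ cs → ⟦ G′ ⟧ w h (λ ds → ∑ₛ h (λ c₁ h₁ →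
            ⟦ G ⟧ w h₁ (λ ds → match w h₁ c₁ (inv c) * φ h₁ cs ds) (c₁ ∷ ds))) ds) (c ∷ cs)
          ≡ ⟦ I ⟧ w′ (shift c h) (λ cs → ⟦ G′ ⟧ w h (λ ds → ⟦ G ⟧ w (shift c h) (φ (shift c h) cs) (c ∷ ds)) ds) (c ∷ cs)
        cancel-arc c valid cs = begin
          w′ c h * ⟦ I ⟧ w′ h₁ (λ cs → ⟦ G′ ⟧ w h (λ ds → ∑ₛ h (λ c₁ h₁ →
              ⟦ G ⟧ w h₁ (λ ds → match w h₁ c₁ (inv c) * φ h₁ cs ds) (c₁ ∷ ds))) ds) (c ∷ cs)
            ≡⟨ cong (w′ c h *_) (⟦⟧-cong I w′ h₁ (λ cs → ⟦⟧-cong G′ w h (λ ds → trans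
                 (open-single G c h (λ c₁ h₁ → match w h₁ c₁ (inv c)) (λ h₁ → φ h₁ cs) ds valid
                   (λ c₁ h₁ c₁≢ → match-off w h₁ c₁ (inv c) (λ eq → c₁≢ (trans (sym (inv-involutive c₁)) (trans (cong inv (sym eq)) (inv-involutive c))))))
                 (cong (_* ⟦ G ⟧ w h₁ (φ h₁ cs) (c ∷ ds)) (trans (cong (λ c₁ → match w h₁ c₁ (inv c)) (sym (inv-involutive c))) (match-inv w h₁ (inv c))))) ds)
                 (c ∷ cs)) ⟩
          w′ c h * ⟦ I ⟧ w′ h₁ (λ cs → ⟦ G′ ⟧ w h (λ ds → w (inv c) h₁ * ⟦ G ⟧ w h₁ (φ h₁ cs) (c ∷ ds)) ds) (c ∷ cs)
            ≡⟨ cong (w′ c h *_) (trans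
                 (⟦⟧-cong I w′ h₁ (λ cs → ⟦⟧-* G′ w h (w (inv c) h₁) (λ ds → ⟦ G ⟧ w h₁ (φ h₁ cs) (c ∷ ds)) ds) (c ∷ cs))
                 (⟦⟧-* I w′ h₁ (w (inv c) h₁) (λ cs → ⟦ G′ ⟧ w h (λ ds → ⟦ G ⟧ w h₁ (φ h₁ cs) (c ∷ ds)) ds) (c ∷ cs))) ⟩
          w′ c h * (w (inv c) h₁ * R)
            ≡⟨ *-assoc (w′ c h) (w (inv c) h₁) R ⟨
          w′ c h * w (inv c) h₁ * R
            ≡⟨ trans (cong (_* R) (zigzag′ c h valid)) (*-identityˡ R) ⟩
          R ∎
          where
          h₁ : ℕ
          h₁ = shift c h
          R : ℚ
          R = ⟦ I ⟧ w′ h₁ (λ cs → ⟦ G′ ⟧ w h (λ ds → ⟦ G ⟧ w h₁ (φ h₁ cs) (c ∷ ds)) ds) (c ∷ cs)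

      -- Joining two linked lines on one stack turns their other ends into the two ends of an arc on
      -- the other stack. The weight `w` of the joint becomes the weight of that arc, as the
      -- convention for arcs demands.
      opened-opened : ∀ {a st mid b st₁ y₁ st₂ y₂ st₃ mid′} (F : Forest a st mid) (U : Walk b y₂ b y₁)
        (G : Forest b st₁ (y₁ ∷ st₂)) (G′ : Forest b st₂ (y₂ ∷ st₃)) (G″ : Forest b st₃ mid′) φ h cs ds →
        forests w w′ F G″ (λ h cs ds → ∑ₛ h (λ c h′ → ⟦ G′ ⟧ w h′ (λ ds → ∑ₛ h′ (λ c₁ h₁ →
          ⟦ G ⟧ w h₁ (λ ds → match w h₁ c₁ c * φ h₁ cs ds) (c₁ ∷ ds))) (c ∷ ds))) h cs ds
        ≡ forests w w′ F (G ⊕ arc U G′ G″) φ h cs ds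
      opened-opened F U G G′ G″ φ h cs ds = ⟦⟧-cong F w′ h (λ cs → trans
        (⟦⟧-cong G″ w h (λ ds → ∑ₛ-cong h (λ c valid → trans
          (⟦⟧-cong G′ w (shift c h) (λ ds → trans
            (open-single G (inv c) (shift c h) (λ c₁ h₁ → match w h₁ c₁ c) (λ h₁ → φ h₁ cs) ds (Valid-inv c h valid)
              (λ c₁ h₁ c₁≢ → match-off w h₁ c₁ c (λ eq → c₁≢ (trans (sym (inv-involutive c₁)) (cong inv (sym eq))))))
            (cong₂ (λ m k → m * ⟦ G ⟧ w k (φ k cs) (inv c ∷ ds))
              (trans (match-inv w (shift (inv c) (shift c h)) c) (cong (w c) (shift-inv c h valid))) (shift-inv c h valid)))
            (c ∷ ds))
          (⟦⟧-* G′ w (shift c h) (w c h) (λ ds → ⟦ G ⟧ w h (φ h cs) (inv c ∷ ds)) (c ∷ ds)))) ds)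
        (sym (⟦⟧-⊕ G (arc U G′ G″) w h (φ h cs) ds))) cs

      private
        vw-join-reverse : ∀ f {a u b v w c z} (V : Walk b v a u) (d : Edge b v w) (W : Walk b w c z) →
          vw f (join (reverse V) d W) ≡ vw f V + vw f W
        vw-join-reverse f V d W = trans (vw-join f (reverse V) d W) (cong (_+ vw f W) (vw-reverse f V))

        swap₂ : ∀ a b F {j} → j ≡ a + b → a + (b + F) ≡ F + j
        swap₂ a b F refl = solve (a ∷ b ∷ F ∷ [])

        merge-outside : ∀ a b I F {j n} → n ≡ I + (j + F) → j ≡ b + a → a + (b + I + F) ≡ n + 0
        merge-outside a b I F refl refl = solve (a ∷ b ∷ I ∷ F ∷ [])

        merge-inside : ∀ a b I F {j n} → n ≡ I + (j + F) → j ≡ a + b → a + (b + I) + F ≡ n + 0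
        merge-inside a b I F refl refl = solve (a ∷ b ∷ I ∷ F ∷ [])

        merge-arcs : ∀ a b I′ I F {j n} → n ≡ I′ + (j + I + F) → j ≡ a + b → a + (b + I′ + I) + F ≡ n + 0
        merge-arcs a b I′ I F refl refl = solve (a ∷ b ∷ I′ ∷ I ∷ F ∷ [])

        open-arc : ∀ a I F {n} → n ≡ I + (a + F) → a + I + F ≡ n + 0
        open-arc a I F refl = solve (a ∷ I ∷ F ∷ [])

        in-forest : ∀ F C B L {n r} → F ≡ n + r → F + C + B + L ≡ n + C + B + L + r
        in-forest F C B L {n} {r} refl = solve (n ∷ r ∷ C ∷ B ∷ L ∷ [])

        across : ∀ a l F C G G′ D L {j n} → n ≡ G + (j + G′) → j ≡ l + a →
          a + F + C + (G + (G′ + D)) + (l + L) ≡ F + C + (n + D) + L + 0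
        across a l F C G G′ D L refl refl = solve (a ∷ l ∷ F ∷ C ∷ G ∷ G′ ∷ D ∷ L ∷ [])

        extend-link : ∀ a l I F C B L {j} → j ≡ a + l → a + I + F + C + B + (l + L) ≡ I + (F + C) + B + (j + L) + 0
        extend-link a l I F C B L refl = solve (a ∷ l ∷ I ∷ F ∷ C ∷ B ∷ L ∷ [])

        join-links : ∀ l l′ F C G G′ G″ D L {j n} → n ≡ G + (j + G′ + G″) → j ≡ l′ + l →
          F + C + (G + (G′ + (G″ + D))) + (l + (l′ + L)) ≡ F + C + (n + D) + L + 0
        join-links l l′ F C G G′ G″ D L refl refl = solve (l ∷ l′ ∷ F ∷ C ∷ G ∷ G′ ∷ G″ ∷ D ∷ L ∷ [])

      within-forest : ∀ {α n vs a b st st* st′ mid os mid′ os′} (F : Forest a st mid) (F* : Forest a st* mid) →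
        ForestReduct α n F F* → Completed vs n → (∀ f → vF f F ≡ vF f F* + weigh f vs) →
        (C : Core a mid os) (G : Forest b st′ mid′) (D : Core b mid′ os′) (L : Links a b os os′) →
        Reduct x w w′ α (state F C G D L) st*
      within-forest {α} {n} {vs} F F* red done count C G D L = record
        { new       = state F* C G D L
        ; completed = done
        ; semantic  = λ φ → trans
            (cores-cong w w′ C D L (λ h cs ds → trans
              (⟦⟧-cong F w′ h (λ cs → ⟦⟧-* G w h (coef w α h cs) (φ h (unstack α cs)) ds) cs)
              (at red h (λ cs → ⟦ G ⟧ w h (φ h cs) ds) cs)))
            (cores-* w w′ C D L (pow x n) (forests w w′ F* G φ))
        ; counted   = λ f → in-forest (vF f F) (vC f C) (vF f G + vC f D) (vL f L) {vF f F*} {weigh f vs} (count f)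
        }

      across-stacks : ∀ {α a b st st* st′ mid os mid′ os′} {s : State a b st st′} (F* : Forest a st* mid) (C : Core a mid os)
        (G* : Forest b st′ mid′) (D : Core b mid′ os′) (L : Links a b os os′) (X : Functional → Functional) →
        (∀ φ → value w w′ s (λ h cs ds → apply w α h (λ cs → φ h cs ds) cs) ≡ cores w w′ C D L (X φ)) →
        (∀ φ h cs ds → X φ h cs ds ≡ forests w w′ F* G* φ h cs ds) →
        (∀ f → total f s ≡ total f (state F* C G* D L) + 0) → Reduct x w w′ α s st*
      across-stacks F* C G* D L X unfold eq count = record
        { new       = state F* C G* D L
        ; completed = none
        ; semantic  = λ φ → with-one (trans (unfold φ) (cores-cong w w′ C D L (eq φ)))
        ; counted   = count
        }

      -- Nine cases: the topmost entry is dead, an arc end or linked, and so is its neighbour,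
      -- except that next to an arc end one finds either the other end of the same arc or an entry
      -- inside it, never a linked one.
      reduce-down : ∀ {a b v u st₀ st′} → Edge a v u → (s : State a b (v ∷ u ∷ st₀) st′) → Reduct x w w′ down s st₀
      reduce-down ed (state F₀@(dot (dead W₁ s₁) (dot (dead W₂ s₂) F)) C G D L) =
        within-forest F₀ F flat-flat (path (join (reverse W₁) ed W₂) s₁ s₂)
          (λ f → swap₂ (vw f W₁) (vw f W₂) (vF f F) (vw-join-reverse f W₁ ed W₂)) C G D L
      reduce-down ed (state F₀@(dot (dead W₁ s₁) (arc W₂ I F)) C G D L) =
        within-forest F₀ (I ⊕ dot d F) flat-down none
          (λ f → merge-outside (vw f W₁) (vw f W₂) (vF f I) (vF f F) (vF-⊕ f I (dot d F)) (vw-join f W₂ (flip-edge ed) W₁)) C G D L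
        where
        d : Dead _ _
        d = dead (join W₂ (flip-edge ed) W₁) s₁
      reduce-down ed (state (dot (dead W₁ s₁) []) (opn F C) G (opn G′ D) (l ∷ L)) =
        across-stacks F C (G ⊕ dot d G′) D L _ (λ φ → refl)
          (λ φ → opened-flat F G G′ φ (λ h cs ds →
            open-flat G h (λ c h′ → match w h′ flat c) (λ h → φ h cs) ds (λ c h′ → match-offʳ h′ c) (flat-w h)))
          (λ f → trans (reassoc (vw f W₁) (vF f F) (vC f C) (vF f G + (vF f G′ + vC f D)) (vw f l + vL f L))
            (across (vw f W₁) (vw f l) (vF f F) (vC f C) (vF f G) (vF f G′) (vC f D) (vL f L)
              (vF-⊕ f G (dot d G′)) (vw-join-reverse f l (flip-edge ed) W₁)))
        where
        d : Dead _ _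
        d = dead (join (reverse l) (flip-edge ed) W₁) s₁
        reassoc : ∀ a F C B L → a + 0 + (F + C) + B + L ≡ a + F + C + B + L
        reassoc = solve-∀ℕ
      reduce-down ed (state F₀@(arc W [] F) C G D L) =
        within-forest F₀ F up-down (cycle W ed)
          (λ f → trans (cong (_+ vF f F) (+-identityʳ (vw f W))) (+-comm (vw f W) (vF f F))) C G D L
      reduce-down ed (state F₀@(arc W (dot (dead W₁ s₁) I) F) C G D L) =
        within-forest F₀ (I ⊕ dot d F) down-flat none
          (λ f → merge-inside (vw f W) (vw f W₁) (vF f I) (vF f F) (vF-⊕ f I (dot d F)) (vw-join f W ed W₁)) C G D L
        where
        d : Dead _ _
        d = dead (join W ed W₁) s₁
      reduce-down ed (state F₀@(arc V (arc U I′ I) F) C G D L) =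
        within-forest F₀ (I′ ⊕ arc W I F) down-down none
          (λ f → merge-arcs (vw f V) (vw f U) (vF f I′) (vF f I) (vF f F) (vF-⊕ f I′ (arc W I F))
            (trans (vw-join f V ed (reverse U)) (cong (vw f V +_) (vw-reverse f U)))) C G D L
        where
        W : Walk _ _ _ _
        W = join V ed (reverse U)
      reduce-down ed (state [] (opn (dot (dead W₁ s₁) F) C) G (opn G′ D) (l ∷ L)) =
        across-stacks F C (G ⊕ dot d G′) D L _ (λ φ → refl)
          (λ φ → opened-flat F G G′ φ (λ h cs ds →
            open-flat G h (λ c h′ → match w h′ c flat) (λ h → φ h cs) ds (λ c h′ → match-offˡ h′ c) (flat-w h)))
          (λ f → across (vw f W₁) (vw f l) (vF f F) (vC f C) (vF f G) (vF f G′) (vC f D) (vL f L)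
            (vF-⊕ f G (dot d G′)) (vw-join-reverse f l ed W₁))
        where
        d : Dead _ _
        d = dead (join (reverse l) ed W₁) s₁
      reduce-down ed (state [] (opn (arc W I F) C) G (opn G′ D) (l ∷ L)) = record
        { new       = state I (opn F C) G (opn G′ D) (join W (flip-edge ed) l ∷ L)
        ; completed = none
        ; semantic  = λ φ → with-one (cores-cong w w′ C D L (opened-down W I F G G′ φ))
        ; counted   = λ f → extend-link (vw f W) (vw f l) (vF f I) (vF f F) (vC f C)
            (vF f G + (vF f G′ + vC f D)) (vL f L) (vw-join f W (flip-edge ed) l)
        }
      reduce-down ed (state [] (opn [] (opn F C)) G (opn G′ (opn G″ D)) (l ∷ (l′ ∷ L))) =
        across-stacks F C (G ⊕ arc U G′ G″) D L _ (λ φ → refl) (λ φ → opened-opened F U G G′ G″ φ)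
          (λ f → join-links (vw f l) (vw f l′) (vF f F) (vC f C) (vF f G) (vF f G′) (vF f G″) (vC f D) (vL f L)
            (vF-⊕ f G (arc U G′ G″)) (vw-join-reverse f l′ (flip-edge ed) l))
        where
        U : Walk _ _ _ _
        U = join (reverse l′) (flip-edge ed) l

      reduce-flat : ∀ {a b v st₀ st′} → e a v ≡ isolated → (s : State a b (v ∷ st₀) st′) → Reduct x w w′ flat s st₀
      reduce-flat iso (state F₀@(dot (dead W s) F) C G D L) =
        within-forest F₀ F kill-flat (path W iso s) (λ f → +-comm (vw f W) (vF f F)) C G D L
      reduce-flat iso (state F₀@(arc W I F) C G D L) =
        within-forest F₀ (I ⊕ dot (dead W iso) F) kill-down none
          (λ f → open-arc (vw f W) (vF f I) (vF f F) (vF-⊕ f I (dot (dead W iso) F))) C G D L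
      reduce-flat iso (state [] (opn F C) G (opn G′ D) (l ∷ L)) =
        across-stacks F C (G ⊕ dot (dead (reverse l) iso) G′) D L _ (λ φ → refl)
          (λ φ → opened-flat F G G′ φ (λ h cs ds →
            open-flat G h (λ c _ → flatness c) (λ h → φ h cs) ds (λ c _ → flatness-off c) refl))
          (λ f → across 0 (vw f l) (vF f F) (vC f C) (vF f G) (vF f G′) (vC f D) (vL f L)
            (vF-⊕ f G (dot (dead (reverse l) iso) G′)) (trans (vw-reverse f l) (sym (+-identityʳ (vw f l)))))

-- Circuits and boundary lines as seen by the searches in the definition of the product.

module Loops where
  open Forests using (Side; P; Q; opp; Link; to; isolated; through; weigh; weigh-++; module Graph)
  open import Data.List.Membership.Propositional using (_∈_)
  open import Data.List.Relation.Unary.Any using (here; there)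
  open import Data.Maybe using (just; nothing)
  open import Data.Nat using (_+_; _<ᵇ_; _≡ᵇ_)
  open import Data.Nat.Properties

  ⌊_⌋ : Bool → ℕ
  ⌊ true ⌋  = 1
  ⌊ false ⌋ = 0

  is : ℕ → ℕ → ℕ
  is x v = ⌊ v ≡ᵇ x ⌋

  below : ℕ → ℕ → ℕ
  below x v = ⌊ v <ᵇ x ⌋

  ≡ᵇ-refl : ∀ x → (x ≡ᵇ x) ≡ true
  ≡ᵇ-refl zero    = refl
  ≡ᵇ-refl (suc x) = ≡ᵇ-refl x

  ≡ᵇ-≢ : ∀ {x y} → x ≢ y → (x ≡ᵇ y) ≡ false
  ≡ᵇ-≢ {zero}  {zero}  n = contradiction refl n
  ≡ᵇ-≢ {zero}  {suc y} n = refl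
  ≡ᵇ-≢ {suc x} {zero}  n = refl
  ≡ᵇ-≢ {suc x} {suc y} n = ≡ᵇ-≢ (n ∘ cong suc)

  <ᵇ-irrefl : ∀ x → (x <ᵇ x) ≡ false
  <ᵇ-irrefl zero    = refl
  <ᵇ-irrefl (suc x) = <ᵇ-irrefl x

  <ᵇ-true : ∀ {x y} → x < y → (x <ᵇ y) ≡ true
  <ᵇ-true {zero}  {suc y} _         = refl
  <ᵇ-true {suc x} {suc y} (s≤s x<y) = <ᵇ-true x<y

  <ᵇ-false : ∀ {x y} → y ≤ x → (x <ᵇ y) ≡ false
  <ᵇ-false {x}     {zero}  _         = refl
  <ᵇ-false {suc x} {suc y} (s≤s y≤x) = <ᵇ-false y≤x

  is-≢ : ∀ {x v} → is x v ≡ 0 → v ≢ x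
  is-≢ {x} e refl rewrite ≡ᵇ-refl x with () ← e

  sumFrom : (ℕ → ℕ) → ℕ → ℕ → ℕ
  sumFrom f m zero    = 0
  sumFrom f m (suc n) = f m + sumFrom f (suc m) n

  sumFrom-snoc : ∀ f m n → sumFrom f m (suc n) ≡ sumFrom f m n + f (m + n)
  sumFrom-snoc f m zero    rewrite +-identityʳ m = +-comm (f m) 0
  sumFrom-snoc f m (suc n) rewrite +-suc m n =
    trans (cong (f m +_) (sumFrom-snoc f (suc m) n)) (sym (+-assoc (f m) _ _))

  weigh-applyUpTo : ∀ f (g : ℕ → ℕ) m n → (∀ i → g i ≡ m + i) → weigh f (applyUpTo g n) ≡ sumFrom f m n
  weigh-applyUpTo f g m zero    e = refl
  weigh-applyUpTo f g m (suc n) e = cong₂ _+_ (cong f (trans (e 0) (+-identityʳ m)))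
    (weigh-applyUpTo f (g ∘ suc) (suc m) n (λ i → trans (e (suc i)) (+-suc m i)))

  weigh-upTo : ∀ f n → weigh f (upTo n) ≡ sumFrom f 0 n
  weigh-upTo f n = weigh-applyUpTo f id 0 n (λ _ → refl)

  sumFrom-is-before : ∀ x m n → x < m → sumFrom (is x) m n ≡ 0
  sumFrom-is-before x m zero    x<m = refl
  sumFrom-is-before x m (suc n) x<m rewrite ≡ᵇ-≢ (≢-sym (<⇒≢ x<m)) = sumFrom-is-before x (suc m) n (m<n⇒m<1+n x<m)

  sumFrom-is : ∀ x m n → sumFrom (is x) m n ≤ 1
  sumFrom-is x m zero = z≤n
  sumFrom-is x m (suc n) with m ≟ x
  ... | yes refl rewrite ≡ᵇ-refl x | sumFrom-is-before x (suc x) n ≤-refl = ≤-refl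
  ... | no m≢x rewrite ≡ᵇ-≢ m≢x = sumFrom-is x (suc m) n

  sumFrom-1 : ∀ m n → sumFrom (λ _ → 1) m n ≡ n
  sumFrom-1 m zero    = refl
  sumFrom-1 m (suc n) = cong suc (sumFrom-1 (suc m) n)

  weigh-1 : ∀ xs → weigh (λ _ → 1) xs ≡ length xs
  weigh-1 []       = refl
  weigh-1 (x ∷ xs) = cong suc (weigh-1 xs)

  weigh-cong : ∀ {f g} xs → (∀ x → x ∈ xs → f x ≡ g x) → weigh f xs ≡ weigh g xs
  weigh-cong []       e = refl
  weigh-cong (x ∷ xs) e = cong₂ _+_ (e x (here refl)) (weigh-cong xs (λ y y∈ → e y (there y∈)))

  weigh-zero : ∀ {f} xs → (∀ x → x ∈ xs → f x ≡ 0) → weigh f xs ≡ 0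
  weigh-zero []       e = refl
  weigh-zero (x ∷ xs) e = cong₂ _+_ (e x (here refl)) (weigh-zero xs (λ y y∈ → e y (there y∈)))

  weigh-∈ : ∀ f {x} xs → x ∈ xs → f x ≤ weigh f xs
  weigh-∈ f (x ∷ xs) (here refl) = m≤m+n (f x) _
  weigh-∈ f (y ∷ xs) (there x∈)  = ≤-trans (weigh-∈ f xs x∈) (m≤n+m _ (f y))

  least : ∀ x xs → ∃ λ m → m ∈ x ∷ xs × (∀ y → y ∈ x ∷ xs → m ≤ y)
  least x [] = x , here refl , λ { y (here refl) → ≤-refl }
  least x (y ∷ ys) with least y ys
  ... | m , m∈ , m≤ with ≤-total x m
  ...   | inj₁ x≤m = x , here refl , λ { z (here refl) → ≤-refl ; z (there z∈) → ≤-trans x≤m (m≤ z z∈) }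
  ...   | inj₂ m≤x = m , there m∈ , λ { z (here refl) → m≤x ; z (there z∈) → m≤ z z∈ }

  -- Sums of arbitrary functions stand for multisets; this one says that a list has no repetition
  -- and that its entries are smaller than k.
  Within : ℕ → List ℕ → Set
  Within k xs = ∀ f → weigh f xs ≤ sumFrom f 0 k

  -- `loopFrom` accepts a circuit only from its least vertex. A circuit has no repeated vertex, so
  -- exactly one of its vertices has none below it, and the circuit is counted once.
  one-least : ∀ k x xs → Within k (x ∷ xs) →
    weigh (λ y → ⌊ weigh (below y) (x ∷ xs) ≡ᵇ 0 ⌋) (x ∷ xs) ≡ 1
  one-least k x xs W with least x xs
  ... | m , m∈ , m≤ = trans (weigh-cong (x ∷ xs) only-m) (≤-antisym upper lower)
    where
    upper : weigh (is m) (x ∷ xs) ≤ 1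
    upper = ≤-trans (W (is m)) (sumFrom-is m 0 k)
    lower : 1 ≤ weigh (is m) (x ∷ xs)
    lower = subst (_≤ weigh (is m) (x ∷ xs)) (cong ⌊_⌋ (≡ᵇ-refl m)) (weigh-∈ (is m) (x ∷ xs) m∈)
    only-m : ∀ y → y ∈ x ∷ xs → ⌊ weigh (below y) (x ∷ xs) ≡ᵇ 0 ⌋ ≡ is m y
    only-m y y∈ with y ≟ m
    ... | yes refl = trans (cong (λ s → ⌊ s ≡ᵇ 0 ⌋) (weigh-zero (x ∷ xs) (λ z z∈ → cong ⌊_⌋ (<ᵇ-false (m≤ z z∈)))))
                           (sym (cong ⌊_⌋ (≡ᵇ-refl y)))
    ... | no y≢m = trans (cong ⌊_⌋ (positive (subst (_≤ weigh (below y) (x ∷ xs))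
                            (cong ⌊_⌋ (<ᵇ-true (≤∧≢⇒< (m≤ y y∈) (≢-sym y≢m)))) (weigh-∈ (below y) (x ∷ xs) m∈))))
                         (sym (cong ⌊_⌋ (≡ᵇ-≢ y≢m)))
      where
      positive : ∀ {n} → 1 ≤ n → (n ≡ᵇ 0) ≡ false
      positive (s≤s _) = refl

  record Represents (e : Side → ℕ → Link) (d₁ d₂ : Diagram) : Set where
    field
      arc₁      : ∀ {i j} → e P i ≡ to j → partner d₁ (bot i) ≡ just (bot j)
      isolated₁ : ∀ {i} → e P i ≡ isolated → partner d₁ (bot i) ≡ nothing
      through₁  : ∀ {i} → e P i ≡ through → ∃ λ t → partner d₁ (bot i) ≡ just (top t)
      arc₂      : ∀ {i j} → e Q i ≡ to j → partner d₂ (top i) ≡ just (top j)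
      isolated₂ : ∀ {i} → e Q i ≡ isolated → partner d₂ (top i) ≡ nothing
      through₂  : ∀ {i} → e Q i ≡ through → ∃ λ b → partner d₂ (top i) ≡ just (bot b)

  module Circuits {e : Side → ℕ → Link} {d₁ d₂ : Diagram} (rep : Represents e d₁ d₂) where
    open Graph e
    open Represents rep

    Terminal : Side → ℕ → Set
    Terminal a u = e a u ≡ isolated ⊎ e a u ≡ through

    isLoop : ℕ → ℕ
    isLoop j = ⌊ loopFrom d₁ d₂ (fuel d₁ d₂) j j ⌋

    rest : ∀ {a u b v} → Walk a u b v → List ℕ
    rest (one _)      = []
    rest (step _ _ W) = verts W

    verts-rest : ∀ {a u b v} (W : Walk a u b v) → verts W ≡ u ∷ rest W
    verts-rest (one _)      = refl
    verts-rest (step _ _ _) = refl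

    first-weight : ∀ f {a u b v} (W : Walk a u b v) → vw f W ≡ f u + weigh f (rest W)
    first-weight f W = cong (weigh f) (verts-rest W)

    private
      zero-+ˡ : ∀ a {b} → a + b ≡ 0 → a ≡ 0
      zero-+ˡ a h = m+n≡0⇒m≡0 a h

      zero-+ʳ : ∀ a {b} → a + b ≡ 0 → b ≡ 0
      zero-+ʳ a h = m+n≡0⇒n≡0 a h

      avoids : ∀ j c {a u b v} (W : Walk a u b v) → is j c + vw (is j) W ≡ 0 → is j u ≡ 0 × weigh (is j) (rest W) ≡ 0
      avoids j c {u = u} W h = zero-+ˡ (is j u) h′ , zero-+ʳ (is j u) h′
        where
        h′ : is j u + weigh (is j) (rest W) ≡ 0
        h′ = trans (sym (first-weight (is j) W)) (zero-+ʳ (is j c) h)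

    -- The search follows the walk to its end and fails there; as `j` does not occur again, it
    -- cannot succeed earlier.
    open-no-loop : ∀ f j {c b z} (W : Walk P c b z) → Terminal b z → weigh (is j) (rest W) ≡ 0 →
      loopFrom d₁ d₂ f j c ≡ false
    open-no-loop zero    j W t h = refl
    open-no-loop (suc f) j (one refl) (inj₁ t) h rewrite isolated₂ t = refl
    open-no-loop (suc f) j (one refl) (inj₂ t) h rewrite proj₂ (through₂ t) = refl
    open-no-loop (suc f) j (step refl d (one refl)) (inj₁ t) h rewrite arc₂ (Edge.there d) | isolated₁ t = refl
    open-no-loop (suc f) j (step refl d (one refl)) (inj₂ t) h rewrite arc₂ (Edge.there d) | proj₂ (through₁ t) = refl
    open-no-loop (suc f) j (step refl d (step {u = c₂} {w = c₃} refl d′ W)) t h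
      rewrite arc₂ (Edge.there d) | arc₁ (Edge.there d′) with (c₂ <ᵇ j) ∨ (c₃ <ᵇ j)
    ... | true  = refl
    ... | false rewrite ≡ᵇ-≢ (is-≢ {j} {c₃} (proj₁ (avoids j c₂ W h))) = open-no-loop f j W t (proj₂ (avoids j c₂ W h))

    -- The search goes once around the circuit and gives up only at a vertex below `j`. A round
    -- passes two vertices, so as much fuel as there are vertices suffices.
    closed-loop : ∀ f j {c v} (W : Walk P c P v) → Edge P v j → weigh (is j) (rest W) ≡ 0 → length (verts W) ≤ f →
      loopFrom d₁ d₂ f j c ≡ (weigh (below j) (rest W) ≡ᵇ 0)
    closed-loop (suc f) j (step refl d (one {u = c₂} refl)) ed h len
      rewrite arc₂ (Edge.there d) | arc₁ (Edge.there ed) | <ᵇ-irrefl j | ≡ᵇ-refl j with c₂ <ᵇ j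
    ... | true  = refl
    ... | false = refl
    closed-loop (suc f) j (step refl d (step {u = c₂} {w = c₃} refl d′ W)) ed h len
      rewrite arc₂ (Edge.there d) | arc₁ (Edge.there d′) | first-weight (below j) W with c₂ <ᵇ j
    ... | true  = refl
    ... | false with c₃ <ᵇ j
    ...   | true  = refl
    ...   | false rewrite ≡ᵇ-≢ (is-≢ {j} {c₃} (proj₁ (avoids j c₂ W h))) = closed-loop f j W ed (proj₂ (avoids j c₂ W h)) (≤-trans (n≤1+n _) (≤-pred len))

    data Split {a u b v} (W : Walk a u b v) : ℕ → Set where
      start  : Split W u
      inside : ∀ {s y x} (V : Walk a u s y) → Edge s y x → (V′ : Walk s x b v) →
               (∀ f → vw f W ≡ vw f V + vw f V′) → Split W x

    split : ∀ {a u b v x} (W : Walk a u b v) → x ∈ verts W → Split W x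
    split (one _)              (here refl) = start
    split (step _ _ _)         (here refl) = start
    split (step {u = u} eq d W) (there x∈) with split W x∈
    ... | start              = inside (one eq) d W (λ f → cong (_+ vw f W) (sym (+-identityʳ (f u))))
    ... | inside V d′ V′ sum = inside (step eq d V) d′ V′ (λ f → trans (cong (f u +_) (sum f)) (sym (+-assoc (f u) _ _)))

    Circuit : ℕ → (∀ (f : ℕ → ℕ) → ℕ) → Set
    Circuit x weight = ∃ λ y → Σ (Walk P x P y) λ W → Edge P y x × (∀ f → vw f W ≡ weight f)

    -- `loopFrom` starts at `x` along the edge of the second diagram. The circuit is therefore cut
    -- open at `x`, and traversed backwards if the cut makes it start along the other edge.
    circuit : ∀ {a u v x} (W : Walk a u a v) → Edge a v u → x ∈ verts W → Circuit x (λ f → vw f W)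
    circuit {a} {u} {v} {x} W ed x∈ with rotated
      where
      rotated : ∃ λ s → ∃ λ y → Σ (Walk s x s y) λ V → Edge s y x × (∀ f → vw f V ≡ vw f W)
      rotated with split W x∈
      ... | start = a , v , W , ed , λ f → refl
      ... | inside V d V′ sum = _ , _ , join V′ ed V , d ,
          λ f → trans (vw-join f V′ ed V) (trans (+-comm (vw f V′) (vw f V)) (sym (sum f)))
    ... | P , y , V , d , sum = y , V , d , sum
    ... | Q , y , step {w = w} refl d′ V , d , sum =
      w , step refl (flip-edge d) (reverse V) , flip-edge d′ , λ f → trans (cong (f x +_) (vw-reverse f V)) (sum f)

    module _ (k : ℕ) (size-k : size d₁ ≡ k) where

      private
        length-within : ∀ {xs} → Within k xs → length xs ≤ k
        length-within {xs} W = subst₂ _≤_ (weigh-1 xs) (sumFrom-1 0 k) (W (λ _ → 1))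

        fuel-enough : ∀ {n} → n ≤ k → n ≤ fuel d₁ d₂
        fuel-enough n≤k rewrite size-k = ≤-trans n≤k (≤-trans (m≤m+n k k) (≤-trans (n≤1+n _) (n≤1+n _)))

        once : ∀ x {r} → is x x + r ≤ 1 → r ≡ 0
        once x h rewrite ≡ᵇ-refl x = n≤0⇒n≡0 (≤-pred h)

      loops-cycle : ∀ {a u v} (W : Walk a u a v) → Edge a v u → Within k (verts W) → weigh isLoop (verts W) ≡ 1
      loops-cycle {u = u} W ed within rewrite verts-rest W = trans
        (weigh-cong (u ∷ rest W) at-vertex)
        (one-least k u (rest W) within)
        where
        at-vertex : ∀ x → x ∈ u ∷ rest W → isLoop x ≡ ⌊ weigh (below x) (u ∷ rest W) ≡ᵇ 0 ⌋
        at-vertex x x∈ with circuit W ed (subst (x ∈_) (sym (verts-rest W)) x∈)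
        ... | y , V , d , sum = cong ⌊_⌋ (trans
          (closed-loop (fuel d₁ d₂) x V d unique (fuel-enough (length-within {verts V} within-V)))
          (cong (_≡ᵇ 0) (trans (sym (trans (first-weight (below x) V) (cong (λ b → ⌊ b ⌋ + weigh (below x) (rest V)) (<ᵇ-irrefl x))))
            (trans (sum (below x)) (cong (weigh (below x)) (verts-rest W))))))
          where
          within-V : Within k (verts V)
          within-V f = subst (_≤ sumFrom f 0 k) (sym (trans (sum f) (cong (weigh f) (verts-rest W)))) (within f)
          unique : weigh (is x) (rest V) ≡ 0
          unique = once x (subst (_≤ 1) (first-weight (is x) V) (≤-trans (within-V (is x)) (sumFrom-is x 0 k)))

      loops-path : ∀ {a u b v} (W : Walk a u b v) → Terminal a u → Terminal b v → Within k (verts W) →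
        weigh isLoop (verts W) ≡ 0
      loops-path {a} {u} {b} {v} W t t′ within = weigh-zero (verts W) (λ x x∈ → cong ⌊_⌋ (at-vertex x (split W x∈)))
        where
        atMostOnce : ∀ x → vw (is x) W ≤ 1
        atMostOnce x = ≤-trans (within (is x)) (sumFrom-is x 0 k)

        at-start : ∀ s {u b v} (W : Walk s u b v) → vw (is u) W ≤ 1 → Terminal s u → Terminal b v →
          loopFrom d₁ d₂ (fuel d₁ d₂) u u ≡ false
        at-start P {u} W h _ t′ = open-no-loop (fuel d₁ d₂) u W t′ (once u (subst (_≤ 1) (first-weight (is u) W) h))
        -- The search leaves `u` on the side where the walk itself ends, so it stops at once.
        at-start Q {u} W h t _  = open-no-loop (fuel d₁ d₂) u (one refl) t refl

        at-inside : ∀ s {x y} (V : Walk a u s y) → Edge s y x → (V′ : Walk s x b v) → (∀ f → vw f W ≡ vw f V + vw f V′) →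
          loopFrom d₁ d₂ (fuel d₁ d₂) x x ≡ false
        at-inside P {x} V d V′ sum = open-no-loop (fuel d₁ d₂) x V′ t′
          (once x (subst (_≤ 1) (first-weight (is x) V′) (m+n≤o⇒n≤o (vw (is x) V) (subst (_≤ 1) (sum (is x)) (atMostOnce x)))))
        -- Here the edge of the second diagram at `x` leads back into the first part of the walk,
        -- hence the reversal.
        at-inside Q {x} V d V′ sum = open-no-loop (fuel d₁ d₂) x (step refl (flip-edge d) (reverse V)) t
          (trans (vw-reverse (is x) V) (once x (≤-trans (m≤m+n _ (weigh (is x) (rest V′))) (subst (_≤ 1) regroup (atMostOnce x)))))
          where
          regroup : vw (is x) W ≡ is x x + vw (is x) V + weigh (is x) (rest V′)
          regroup = trans (sum (is x)) (trans (cong (vw (is x) V +_) (first-weight (is x) V′))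
            (trans (sym (+-assoc (vw (is x) V) (is x x) _)) (cong (_+ weigh (is x) (rest V′)) (+-comm (vw (is x) V) (is x x)))))

        at-vertex : ∀ x → Split W x → loopFrom d₁ d₂ (fuel d₁ d₂) x x ≡ false
        at-vertex x start                         = at-start a W (atMostOnce x) t t′
        at-vertex x (inside {s = s} V d V′ sum) = at-inside s V d V′ sum

      mutual
        walkDown-bot : ∀ f {c z} (W : Walk P c Q z) → e Q z ≡ through → length (verts W) ≤ f → isBot (walkDown d₁ d₂ f c) ≡ true
        walkDown-bot (suc f) (one refl)      t len rewrite proj₂ (through₂ t) = refl
        walkDown-bot (suc f) (step refl d W) t len rewrite arc₂ (Edge.there d) = walkUp-bot f W t (≤-pred len)

        walkUp-bot : ∀ f {c z} (W : Walk Q c Q z) → e Q z ≡ through → length (verts W) ≤ f → isBot (walkUp d₁ d₂ f c) ≡ true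
        walkUp-bot (suc f) (step refl d W) t len rewrite arc₁ (Edge.there d) = walkDown-bot f W t (≤-pred len)

      NotBot : Side → ℕ → Set
      NotBot a u = e a u ≡ isolated ⊎ (a ≡ P × e a u ≡ through)

      mutual
        walkDown-notBot : ∀ f {c b z} (W : Walk P c b z) → NotBot b z → isBot (walkDown d₁ d₂ f c) ≡ false
        walkDown-notBot zero    W               t = refl
        walkDown-notBot (suc f) (one refl)      (inj₁ t) rewrite isolated₂ t = refl
        walkDown-notBot (suc f) (one refl)      (inj₂ (() , _))
        walkDown-notBot (suc f) (step refl d W) t rewrite arc₂ (Edge.there d) = walkUp-notBot f W t

        walkUp-notBot : ∀ f {c b z} (W : Walk Q c b z) → NotBot b z → isBot (walkUp d₁ d₂ f c) ≡ false
        walkUp-notBot zero    W               t = refl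
        walkUp-notBot (suc f) (one refl)      (inj₁ t) rewrite isolated₁ t = refl
        walkUp-notBot (suc f) (one refl)      (inj₂ (_ , t)) rewrite proj₂ (through₁ t) = refl
        walkUp-notBot (suc f) (step refl d W) t rewrite arc₁ (Edge.there d) = walkDown-notBot f W t

      walkDown-through : ∀ {c z} (W : Walk P c Q z) → e Q z ≡ through → Within k (verts W) →
        isBot (walkDown d₁ d₂ (fuel d₁ d₂) c) ≡ true
      walkDown-through W t within = walkDown-bot (fuel d₁ d₂) W t (fuel-enough (length-within {verts W} within))

-- The arcs and white vertices of a Motzkin path, found by one pass with a stack.

module Paths where
  open Forests using (Side; P; Q; Link; to; isolated; through; weigh)
  open Loops using (⌊_⌋; ≡ᵇ-refl; ≡ᵇ-≢; sumFrom; Represents)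
  open import Data.Bool.Properties using (T-≡)
  open import Data.List.Membership.Propositional using (_∈_; _∉_)
  open import Data.List.Membership.Propositional.Properties using (∈-filter⁺; ∈-filter⁻; ∈-upTo⁺)
  open import Data.List.Relation.Unary.All using (All; []; _∷_)
  open import Data.List.Relation.Unary.Any using (here; there)
  open import Data.Maybe using (Maybe; just; nothing)
  open import Data.Maybe.Properties using (just-injective)
  open import Data.Nat using (_+_; _≡ᵇ_)
  open import Data.Nat.Properties

  length-filter : ∀ (b : ℕ → Bool) xs → length (filter (λ x → T? (b x)) xs) ≡ weigh (λ x → ⌊ b x ⌋) xs
  length-filter b []       = refl
  length-filter b (x ∷ xs) with b x
  ... | true  = cong suc (length-filter b xs)
  ... | false = length-filter b xs

  ≡ᵇ-true : ∀ {m n} → (m ≡ᵇ n) ≡ true → m ≡ n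
  ≡ᵇ-true {m} {n} h = ≡ᵇ⇒≡ m n (Equivalence.from T-≡ h)

  eqM-true : ∀ {c n} → eqM c n ≡ true → c ≡ just n
  eqM-true {just m} h = cong just (≡ᵇ-true h)

  eqM-≢ : ∀ {c n} → eqM c n ≡ false → c ≢ just n
  eqM-≢ {just m} h refl with () ← trans (sym (≡ᵇ-refl m)) h

  firstWith-just : ∀ {Pr} xs {j} → firstWith Pr xs ≡ just j → Pr j ≡ true
  firstWith-just {Pr} (x ∷ xs) h with Pr x in eq
  firstWith-just (x ∷ xs) refl | true  = eq
  ... | false = firstWith-just xs h

  firstWith-nothing : ∀ {Pr} xs → firstWith Pr xs ≡ nothing → ∀ {j} → j ∈ xs → Pr j ≡ false
  firstWith-nothing {Pr} (x ∷ xs) h j∈ with Pr x in eq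
  firstWith-nothing (x ∷ xs) h (here refl) | false = eq
  firstWith-nothing (x ∷ xs) h (there j∈)  | false = firstWith-nothing xs h j∈

  indexOf-∈ : ∀ {a xs} → a ∈ xs → ∃ λ n → indexOf a xs ≡ just n
  indexOf-∈ {a} {x ∷ xs} a∈ with a ≟ x
  ... | yes refl rewrite ≡ᵇ-refl a = 0 , refl
  indexOf-∈ {a} {x ∷ xs} (here refl) | no a≢x = contradiction refl a≢x
  indexOf-∈ {a} {x ∷ xs} (there a∈)  | no a≢x with indexOf-∈ a∈
  ... | n , eq rewrite ≡ᵇ-≢ a≢x | eq = suc n , refl

  indexOf-∉ : ∀ {a} xs → a ∉ xs → indexOf a xs ≡ nothing
  indexOf-∉ []       a∉ = refl
  indexOf-∉ (x ∷ xs) a∉ rewrite ≡ᵇ-≢ (a∉ ∘ here) | indexOf-∉ xs (a∉ ∘ there) = refl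

  nthN-indexOf : ∀ a xs {n} → indexOf a xs ≡ just n → nthN xs n ≡ just a
  nthN-indexOf a (x ∷ xs) h with a ≡ᵇ x in eq
  nthN-indexOf a (x ∷ xs) refl | true rewrite ≡ᵇ-true {a} {x} eq = refl
  nthN-indexOf a (x ∷ xs) h    | false with indexOf a xs in eq′
  nthN-indexOf a (x ∷ xs) refl | false | just n = nthN-indexOf a xs eq′

  link : List Step → ℕ → Link
  link p i with arcPartner p i | indexOf i (whites p)
  ... | just j  | _       = to j
  ... | nothing | just _  = through
  ... | nothing | nothing = isolated

  module _ (p : List Step) {i : ℕ} where
    partner-arc : ∀ {j} → link p i ≡ to j →
      partner (dpq p p) (bot i) ≡ just (bot j) × partner (dpq p p) (top i) ≡ just (top j)
    partner-arc h with arcPartner p i | indexOf i (whites p)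
    partner-arc refl | just j | _ = refl , refl
    partner-arc () | nothing | just _
    partner-arc () | nothing | nothing

    partner-isolated : link p i ≡ isolated →
      partner (dpq p p) (bot i) ≡ nothing × partner (dpq p p) (top i) ≡ nothing
    partner-isolated h with arcPartner p i | indexOf i (whites p) in eq
    partner-isolated () | just _ | _
    partner-isolated () | nothing | just _
    partner-isolated h  | nothing | nothing rewrite eq = refl , refl

    partner-through : link p i ≡ through →
      partner (dpq p p) (bot i) ≡ just (top i) × partner (dpq p p) (top i) ≡ just (bot i)
    partner-through h with arcPartner p i | indexOf i (whites p) in eq
    partner-through () | just _ | _
    partner-through h  | nothing | just n rewrite eq | nthN-indexOf i (whites p) eq = refl , refl
    partner-through () | nothing | nothing

  links : List Step → List Step → Side → ℕ → Link
  links p q P = link p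
  links p q Q = link q

  represents : ∀ p q → Represents (links p q) (dpq p p) (dpq q q)
  represents p q = record
    { arc₁      = λ h → proj₁ (partner-arc p h)
    ; isolated₁ = λ h → proj₁ (partner-isolated p h)
    ; through₁  = λ h → _ , proj₁ (partner-through p h)
    ; arc₂      = λ h → proj₂ (partner-arc q h)
    ; isolated₂ = λ h → proj₂ (partner-isolated q h)
    ; through₂  = λ h → _ , proj₂ (partner-through q h)
    }

  -- `arcPartner` searches through all positions, whereas the state sum reads a word once from left
  -- to right. The scan puts the arcs into this second form: the stack holds the positions still
  -- unclosed, and those that remain at the end are the white ones.
  data Scan (ℓ : ℕ → Link) : List Step → ℕ → List ℕ → Set where
    done : ∀ {m st} → All (λ u → ℓ u ≡ through) st → Scan ℓ [] m st
    up   : ∀ {xs m st} → Scan ℓ xs (suc m) (m ∷ st) → Scan ℓ (up ∷ xs) m st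
    flat : ∀ {xs m st} → ℓ m ≡ isolated → Scan ℓ xs (suc m) st → Scan ℓ (flat ∷ xs) m st
    down : ∀ {xs m u st} → ℓ u ≡ to m → ℓ m ≡ to u → Scan ℓ xs (suc m) st → Scan ℓ (down ∷ xs) m (u ∷ st)

  finalStack : ∀ {ℓ xs m st} → Scan ℓ xs m st → List ℕ
  finalStack {st = st} (done _) = st
  finalStack (up S)             = finalStack S
  finalStack (flat _ S)         = finalStack S
  finalStack (down _ _ S)       = finalStack S

  length-finalStack : ∀ {ℓ xs m st} (S : Scan ℓ xs m st) → length (finalStack S) ≡ heightFrom (length st) xs
  length-finalStack (done _)     = refl
  length-finalStack (up S)       = length-finalStack S
  length-finalStack (flat _ S)   = length-finalStack S
  length-finalStack (down _ _ S) = length-finalStack S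

  nthS-dropL : ∀ m t (p : List Step) → nthS (dropL m p) t ≡ nthS p (m + t)
  nthS-dropL zero    t p       = refl
  nthS-dropL (suc m) t []      = refl
  nthS-dropL (suc m) t (_ ∷ p) = nthS-dropL m t p

  dropL-suc : ∀ m (p : List Step) {x xs} → dropL m p ≡ x ∷ xs → dropL (suc m) p ≡ xs
  dropL-suc zero    (_ ∷ p) refl = refl
  dropL-suc (suc m) (_ ∷ p) h    = dropL-suc m p h

  findClose-down : ∀ xs pos d {j} → findClose xs pos d ≡ just j → ∃ λ t → j ≡ pos + t × nthS xs t ≡ just down
  findClose-down (up ∷ xs) pos d h with findClose-down xs (suc pos) (suc d) h
  ... | t , eq , n = suc t , trans eq (sym (+-suc pos t)) , n
  findClose-down (flat ∷ xs) pos d h with findClose-down xs (suc pos) d h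
  ... | t , eq , n = suc t , trans eq (sym (+-suc pos t)) , n
  findClose-down (down ∷ xs) pos d h with d ≡ᵇ 1
  findClose-down (down ∷ xs) pos d refl | true = 0 , sym (+-identityʳ pos) , refl
  ... | false with findClose-down xs (suc pos) (d Data.Nat.∸ 1) h
  ...   | t , eq , n = suc t , trans eq (sym (+-suc pos t)) , n

  is-not : ∀ {n : Maybe Step} {x y} → n ≡ just x → x ≢ y → n ≢ just y
  is-not refl x≢y refl = x≢y refl

  module _ (p : List Step) where

    close-after : ∀ i {j} → closeOf p i ≡ just j → i < j × nthS p j ≡ just down
    close-after i h with nthS p i
    ... | just up with findClose-down (dropL (suc i) p) (suc i) 1 h
    ...   | t , refl , n = m≤m+n (suc i) t , trans (sym (nthS-dropL (suc i) t p)) n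

    close-notUp : ∀ i → nthS p i ≢ just up → closeOf p i ≡ nothing
    close-notUp i h with nthS p i
    ... | nothing   = refl
    ... | just up   = contradiction refl h
    ... | just flat = refl
    ... | just down = refl

    close-up : ∀ i → nthS p i ≡ just up → closeOf p i ≡ findClose (dropL (suc i) p) (suc i) 1
    close-up i h rewrite h = refl

    isUp-up : ∀ i → nthS p i ≡ just up → isUp p i ≡ true
    isUp-up i h rewrite h = refl

    isUp-false : ∀ i → nthS p i ≢ just up → isUp p i ≡ false
    isUp-false i h with nthS p i
    ... | nothing   = refl
    ... | just up   = contradiction refl h
    ... | just flat = refl
    ... | just down = refl

    arcPartner-just : ∀ {i j} → arcPartner p i ≡ just j → closeOf p i ≡ just j ⊎ closeOf p j ≡ just i
    arcPartner-just {i} {j} h with eqM (closeOf p i) j in eq | firstWith-just (upTo (length p)) h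
    ... | true  | _  = inj₁ (eqM-true eq)
    ... | false | eq′ = inj₂ (eqM-true eq′)

    arcPartner-nothing : ∀ {i j} → arcPartner p i ≡ nothing → j < length p → closeOf p i ≢ just j × closeOf p j ≢ just i
    arcPartner-nothing {i} {j} h j<k with eqM (closeOf p i) j in eq | firstWith-nothing (upTo (length p)) h (∈-upTo⁺ j<k)
    ... | true  | ()
    ... | false | eq′ = eqM-≢ eq , eqM-≢ eq′

    arcPartner-opener : ∀ {u m} → m < length p → nthS p u ≡ just up → closeOf p u ≡ just m → arcPartner p u ≡ just m
    arcPartner-opener {u} {m} m<k u-up c with arcPartner p u in eq
    ... | nothing = contradiction c (proj₁ (arcPartner-nothing eq m<k))
    ... | just j with arcPartner-just eq
    ...   | inj₁ c′ = trans (sym c′) c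
    ...   | inj₂ c′ = contradiction (proj₂ (close-after j c′)) (is-not u-up λ ())

    -- The search for the partner of `m` returns the first position that fits, so the opener closed
    -- at `m` must be known to be unique.
    arcPartner-closer : ∀ {u m} → u < length p → nthS p m ≢ just up → closeOf p u ≡ just m →
      (∀ i → closeOf p i ≡ just m → i ≡ u) → arcPartner p m ≡ just u
    arcPartner-closer {u} {m} u<k m-not c unique with arcPartner p m in eq
    ... | nothing = contradiction c (proj₂ (arcPartner-nothing eq u<k))
    ... | just j with arcPartner-just eq
    ...   | inj₁ c′ = contradiction (trans (sym c′) (close-notUp m m-not)) (λ ())
    ...   | inj₂ c′ = cong just (unique j c′)

    arcPartner-none : ∀ {i} → closeOf p i ≡ nothing → nthS p i ≢ just down → arcPartner p i ≡ nothing
    arcPartner-none {i} c i-not with arcPartner p i in eq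
    ... | nothing = refl
    ... | just j with arcPartner-just eq
    ...   | inj₁ c′ = contradiction (trans (sym c′) c) (λ ())
    ...   | inj₂ c′ = contradiction (proj₂ (close-after j c′)) i-not

    link-arc : ∀ {i j} → arcPartner p i ≡ just j → link p i ≡ to j
    link-arc h rewrite h = refl

    flat-not-white : ∀ {i} → nthS p i ≡ just flat → i ∉ whites p
    flat-not-white {i} i-flat i∈ = both-false (isUp-false i (is-not i-flat λ ()))
      (proj₂ (∈-filter⁻ (λ i → T? (isUp p i ∧ isNothing (closeOf p i))) {xs = upTo (length p)} i∈))
      where
      both-false : ∀ {a b} → a ≡ false → T (a ∧ b) → ⊥
      both-false refl t = t

    link-isolated : ∀ {i} → nthS p i ≡ just flat → link p i ≡ isolated
    link-isolated {i} i-flat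
      rewrite arcPartner-none {i} (close-notUp i (is-not i-flat λ ())) (is-not i-flat λ ())
            | indexOf-∉ {i} (whites p) (flat-not-white i-flat)
      = refl

    unclosed-white : ∀ {i} → i < length p → nthS p i ≡ just up → closeOf p i ≡ nothing → i ∈ whites p
    unclosed-white {i} i<k i-up c =
      ∈-filter⁺ (λ i → T? (isUp p i ∧ isNothing (closeOf p i))) (∈-upTo⁺ i<k)
        (both-true (isUp-up i i-up) (cong isNothing c))
      where
      both-true : ∀ {a b} → a ≡ true → b ≡ true → T (a ∧ b)
      both-true refl refl = _

    link-through : ∀ {i} → i < length p → nthS p i ≡ just up → closeOf p i ≡ nothing → link p i ≡ through
    link-through {i} i<k i-up c
      rewrite arcPartner-none {i} c (is-not i-up λ ()) | proj₂ (indexOf-∈ (unclosed-white i<k i-up c)) = refl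

    -- The d-th entry of the stack is closed where the remaining steps xs first go down d times.
    data Open (xs : List Step) (m : ℕ) : ℕ → List ℕ → Set where
      []  : ∀ {d} → Open xs m d []
      _∷_ : ∀ {d u st} → (u < m × nthS p u ≡ just up × closeOf p u ≡ findClose xs m (suc d)) →
            Open xs m (suc d) st → Open xs m d (u ∷ st)

    open-up : ∀ {xs m d st} → Open (up ∷ xs) m d st → Open xs (suc m) (suc d) st
    open-up []                 = []
    open-up ((l , n , c) ∷ os) = (m<n⇒m<1+n l , n , c) ∷ open-up os

    open-flat : ∀ {xs m d st} → Open (flat ∷ xs) m d st → Open xs (suc m) d st
    open-flat []                 = []
    open-flat ((l , n , c) ∷ os) = (m<n⇒m<1+n l , n , c) ∷ open-flat os

    open-down : ∀ {xs m d st} → Open (down ∷ xs) m (suc d) st → Open xs (suc m) d st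
    open-down []                 = []
    open-down ((l , n , c) ∷ os) = (m<n⇒m<1+n l , n , c) ∷ open-down os

    -- This yields uniqueness of the opener: a position off the stack cannot close at `m` or later,
    -- and entries below the top of the stack close after `m`.
    Closed : ℕ → List ℕ → Set
    Closed m st = ∀ v → v < m → v ∈ st ⊎ (∀ j → closeOf p v ≡ just j → j < m)

    deeper : ∀ {xs m d st v} → Open (down ∷ xs) m (suc d) st → v ∈ st → closeOf p v ≢ just m
    deeper {xs} {m} ((_ , _ , c) ∷ os) (here refl) h with findClose-down xs (suc m) (suc _) (trans (sym c) h)
    ... | t , eq , _ = contradiction eq (<⇒≢ (m≤m+n (suc m) t))
    deeper ((_ , _ , c) ∷ os) (there v∈) h = deeper os v∈ h

    nth-here : ∀ {x xs} m → dropL m p ≡ x ∷ xs → nthS p m ≡ just x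
    nth-here {x} {xs} m h = trans (cong (nthS p) (sym (+-identityʳ m)))
      (trans (sym (nthS-dropL m 0 p)) (cong (λ l → nthS l 0) h))

    all-through : ∀ {m d st} → m ≤ length p → Open [] m d st → All (λ u → link p u ≡ through) st
    all-through m≤ []                 = []
    all-through m≤ ((l , n , c) ∷ os) = link-through (≤-trans l m≤) n c ∷ all-through m≤ os

    scan-from : ∀ xs m st → dropL m p ≡ xs → m + length xs ≡ length p → validFrom (length st) xs ≡ true →
      Open xs m 0 st → Closed m st → Scan (link p) xs m st
    scan-from [] m st dr len val os cl = done (all-through (≤-reflexive (trans (sym (+-identityʳ m)) len)) os)
    scan-from (up ∷ xs) m st dr len val os cl =
      up (scan-from xs (suc m) (m ∷ st) dr′ (trans (sym (+-suc m _)) len) val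
           ((≤-refl , here-up , trans (close-up m here-up) (cong (λ l → findClose l (suc m) 1) dr′)) ∷ open-up os) closed)
      where
      dr′ : dropL (suc m) p ≡ xs
      dr′ = dropL-suc m p dr
      here-up : nthS p m ≡ just up
      here-up = nth-here m dr
      closed : Closed (suc m) (m ∷ st)
      closed v v<1+m with v ≟ m
      ... | yes refl = inj₁ (here refl)
      ... | no v≢m with cl v (≤∧≢⇒< (≤-pred v<1+m) v≢m)
      ...   | inj₁ v∈ = inj₁ (there v∈)
      ...   | inj₂ f  = inj₂ (λ j c → m<n⇒m<1+n (f j c))
    scan-from (flat ∷ xs) m st dr len val os cl =
      flat (link-isolated here-flat) (scan-from xs (suc m) st (dropL-suc m p dr) (trans (sym (+-suc m _)) len) val (open-flat os) closed)
      where
      here-flat : nthS p m ≡ just flat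
      here-flat = nth-here m dr
      closed : Closed (suc m) st
      closed v v<1+m with v ≟ m
      ... | yes refl = inj₂ (λ j c → contradiction (trans (sym c) (close-notUp m (is-not here-flat λ ()))) (λ ()))
      ... | no v≢m with cl v (≤∧≢⇒< (≤-pred v<1+m) v≢m)
      ...   | inj₁ v∈ = inj₁ v∈
      ...   | inj₂ f  = inj₂ (λ j c → m<n⇒m<1+n (f j c))
    scan-from (down ∷ xs) m (u ∷ st) dr len val ((u<m , u-up , c) ∷ os) cl =
      down (link-arc (arcPartner-opener m<k u-up c)) (link-arc (arcPartner-closer (<-trans u<m m<k) m-not c unique))
        (scan-from xs (suc m) st (dropL-suc m p dr) (trans (sym (+-suc m _)) len) val (open-down os) closed)
      where
      m<k : m < length p
      m<k = subst (m <_) len (≤-trans (≤-reflexive (sym (+-comm m 1))) (+-monoʳ-≤ m (s≤s z≤n)))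
      m-not : nthS p m ≢ just up
      m-not = is-not (nth-here m dr) λ ()
      unique : ∀ i → closeOf p i ≡ just m → i ≡ u
      unique i c′ with cl i (proj₁ (close-after i c′))
      ... | inj₁ (here refl) = refl
      ... | inj₁ (there i∈)  = contradiction c′ (deeper os i∈)
      ... | inj₂ f           = contradiction (f m c′) (<-irrefl refl)
      closed : Closed (suc m) st
      closed v v<1+m with v ≟ m
      ... | yes refl = inj₂ (λ j c → contradiction (trans (sym c) (close-notUp m m-not)) (λ ()))
      ... | no v≢m with cl v (≤∧≢⇒< (≤-pred v<1+m) v≢m)
      ...   | inj₁ (here refl) = inj₂ (λ j c′ → s≤s (≤-reflexive (just-injective (trans (sym c′) c))))
      ...   | inj₁ (there v∈)  = inj₁ v∈
      ...   | inj₂ f           = inj₂ (λ j c → m<n⇒m<1+n (f j c))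

  scan : ∀ p → isMotzkin p ≡ true → Scan (link p) p 0 []
  scan p val = scan-from p p 0 [] refl refl val [] (λ v ())

-- The state sum of two paths equals the corresponding Gram matrix entry.

module StateSum where
  open Determinant using (ring)
  open Forests
  open Loops
  open Paths
  open Reduction
  open import Data.List.Relation.Unary.All using (All; []; _∷_)
  open import Data.Nat using (_≡ᵇ_)
  open import Data.Nat.Properties
  open import Data.Nat.Tactic.RingSolver using () renaming (solve-∀ to solveℕ)
  open import Data.Rational as ℚ using (ℚ; _+_; _*_; 0ℚ; 1ℚ)
  open import Data.Rational.Properties as ℚ using ()

  allUp : List Step → ℚ
  allUp []          = 1ℚ
  allUp (up ∷ cs)   = allUp cs
  allUp (flat ∷ cs) = 0ℚ
  allUp (down ∷ cs) = 0ℚ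

  allUp-broken : ∀ xs c cs → c ≢ up → allUp (xs ++ c ∷ cs) ≡ 0ℚ
  allUp-broken []          up   cs n = contradiction refl n
  allUp-broken []          flat cs n = refl
  allUp-broken []          down cs n = refl
  allUp-broken (up ∷ xs)   c    cs n = allUp-broken xs c cs n
  allUp-broken (flat ∷ xs) c    cs n = refl
  allUp-broken (down ∷ xs) c    cs n = refl

  stateSum : Weight → Weight → List Step → List Step → ℕ → List Step → List Step → ℚ
  stateSum w w′ (α ∷ p) (β ∷ q) h cs ds = ∑ₛ h (λ c h′ →
    apply w α h′ (λ cs → apply w′ β h′ (λ ds → stateSum w w′ p q h′ cs ds) (c ∷ ds)) (c ∷ cs))
  stateSum w w′ _ _ h cs ds = allUp cs * allUp ds

  pow-+ : ∀ x m n → pow x m * pow x n ≡ pow x (m ℕ.+ n)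
  pow-+ x zero    n = ℚ.*-identityˡ _
  pow-+ x (suc m) n = trans (ℚ.*-assoc x (pow x m) (pow x n)) (cong (x *_) (pow-+ x m n))

  ∑ₛ-zero : ∀ h {g : Step → ℕ → ℚ} → (∀ c h′ → g c h′ ≡ 0ℚ) → ∑ₛ h g ≡ 0ℚ
  ∑ₛ-zero zero    e = cong₂ _+_ (e up _) (e flat _)
  ∑ₛ-zero (suc h) e = cong₂ _+_ (e up _) (cong₂ _+_ (e flat _) (e down _))

  module Boundary (e : Side → ℕ → Link) where
    open Graph e

    data Bare : ∀ {a st mid os} → Forest a st mid → Core a mid os → Set where
      []  : ∀ {a} → Bare {a} [] []
      opn : ∀ {a u st mid os} {F : Forest a st mid} {C : Core a mid os} → Bare F C → Bare {st = u ∷ st} [] (opn F C)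

    data Loaded : ∀ {a st mid os} → Forest a st mid → Core a mid os → Set where
      dot : ∀ {a u st mid os} {d : Dead a u} {F : Forest a st mid} {C : Core a mid os} → Loaded (dot d F) C
      arc : ∀ {a u v inner st mid os} {W : Walk a u a v} {I : Forest a inner (u ∷ st)} {F : Forest a st mid} {C : Core a mid os} →
            Loaded (arc W I F) C
      opn : ∀ {a u st mid os} {F : Forest a st mid} {C : Core a mid os} → Loaded F C → Loaded {st = u ∷ st} [] (opn F C)

    bare⊎loaded : ∀ {a st mid os} (F : Forest a st mid) (C : Core a mid os) → Bare F C ⊎ Loaded F C
    bare⊎loaded (dot _ _)   C         = inj₂ dot
    bare⊎loaded (arc _ _ _) C         = inj₂ arc
    bare⊎loaded []          []        = inj₁ []
    bare⊎loaded []          (opn F C) with bare⊎loaded F C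
    ... | inj₁ b = inj₁ (opn b)
    ... | inj₂ l = inj₂ (opn l)

    bare-stack : ∀ {a st mid os} {F : Forest a st mid} {C : Core a mid os} → Bare F C → st ≡ os
    bare-stack []            = refl
    bare-stack (opn {u = u} b) = cong (u ∷_) (bare-stack b)

    forest-length : ∀ {a st mid} → Forest a st mid → length mid ≤ length st
    forest-length []          = ≤-refl
    forest-length (dot _ F)   = m≤n⇒m≤1+n (forest-length F)
    forest-length (arc _ I F) = m≤n⇒m≤1+n (≤-trans (m≤n⇒m≤1+n (forest-length F)) (forest-length I))

    core-length : ∀ {a mid os} → Core a mid os → length os ≤ length mid
    core-length []        = z≤n
    core-length (opn F C) = s≤s (≤-trans (core-length C) (forest-length F))

    loaded-length : ∀ {a st mid os} {F : Forest a st mid} {C : Core a mid os} → Loaded F C → length os < length st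
    loaded-length (dot {F = F} {C})         = s≤s (≤-trans (core-length C) (forest-length F))
    loaded-length (arc {I = I} {F} {C = C}) = s≤s (≤-trans (core-length C) (≤-trans (≤-trans (forest-length F) (n≤1+n _)) (forest-length I)))
    loaded-length (opn l)                   = s≤s (loaded-length l)

    links-length : ∀ {a b us vs} → Links a b us vs → length us ≡ length vs
    links-length []      = refl
    links-length (_ ∷ L) = cong suc (links-length L)

    All-base : ∀ {Pr : ℕ → Set} {a st base} → Forest a st base → All Pr st → All Pr base
    All-base []          ps       = ps
    All-base (dot _ F)   (_ ∷ ps) = All-base F ps
    All-base (arc _ I F) (_ ∷ ps) with All-base I ps
    ... | _ ∷ ps′ = All-base F ps′

    module _ (w w′ : Weight) where
      Vanishing : Functional → Set
      Vanishing φ = ∀ h xs c cs ds → c ≢ up → φ h (xs ++ c ∷ cs) ds ≡ 0ℚ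

      -- A forest only pushes further steps, so `φ` is evaluated only at stacks that extend `cs`.
      ⟦⟧-support : ∀ {a st base} (F : Forest a st base) h {φ} cs → (∀ xs → φ (xs ++ cs) ≡ 0ℚ) → ⟦ F ⟧ w′ h φ cs ≡ 0ℚ
      ⟦⟧-support []          h cs z = z []
      ⟦⟧-support (dot _ F)   h cs z = ⟦⟧-support F h cs (λ xs → z (flat ∷ xs))
      ⟦⟧-support (arc _ I F) h {φ} cs z = ⟦⟧-support F h cs (λ xs → ∑ₛ-zero h (λ c h′ →
        trans (cong (w′ c h *_) (⟦⟧-support I h′ (c ∷ xs ++ cs) (λ ys →
          trans (cong φ (cong (inv c ∷_) (sym (++-assoc-∷ ys c xs cs)))) (z (inv c ∷ ys ++ c ∷ xs))))) (ℚ.*-zeroʳ (w′ c h))))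
        where
        ++-assoc-∷ : ∀ ys c xs (cs : List Step) → (ys ++ c ∷ xs) ++ cs ≡ ys ++ c ∷ xs ++ cs
        ++-assoc-∷ []       c xs cs = refl
        ++-assoc-∷ (y ∷ ys) c xs cs = cong (y ∷_) (++-assoc-∷ ys c xs cs)

      cores-zero : ∀ {a mid os b mid′ os′} (C : Core a mid os) (D : Core b mid′ os′) (L : Links a b os os′) {φ} →
        (∀ h cs ds → φ h cs ds ≡ 0ℚ) → cores w w′ C D L φ ≡ 0ℚ
      cores-zero C D L {φ} z = trans (cores-cong w w′ C D L (λ h cs ds → trans (z h cs ds) (sym (ℚ.*-zeroˡ (φ h cs ds)))))
        (trans (cores-* w w′ C D L 0ℚ φ) (ℚ.*-zeroˡ (cores w w′ C D L φ)))

      loaded-zero : ∀ {a st mid os b st′ mid′ os′} {F : Forest a st mid} {C : Core a mid os} → Loaded F C →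
        (G : Forest b st′ mid′) (D : Core b mid′ os′) (L : Links a b os os′) → ∀ {φ} → Vanishing φ →
        value w w′ (state F C G D L) φ ≡ 0ℚ
      loaded-zero (dot {F = F} {C}) G D L {φ} van = cores-zero C D L (λ h cs ds →
        ⟦⟧-zero F w′ h cs (λ cs → ⟦⟧-zero G w h ds (λ ds → van h [] flat cs ds (λ ()))))
      loaded-zero (arc {I = I} {F} {C = C}) G D L {φ} van = cores-zero C D L (λ h cs ds →
        ⟦⟧-zero F w′ h cs (λ cs → ∑ₛ-zero h (λ c h′ → trans (cong (w′ c h *_) (inner c h h′ cs ds)) (ℚ.*-zeroʳ (w′ c h)))))
        where
        inner : ∀ c h h′ cs ds → ⟦ I ⟧ w′ h′ (λ cs → ⟦ G ⟧ w h (φ h (inv c ∷ cs)) ds) (c ∷ cs) ≡ 0ℚ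
        inner up   h h′ cs ds = ⟦⟧-zero I w′ h′ (up ∷ cs) (λ cs → ⟦⟧-zero G w h ds (λ ds → van h [] down cs ds (λ ())))
        inner flat h h′ cs ds = ⟦⟧-zero I w′ h′ (flat ∷ cs) (λ cs → ⟦⟧-zero G w h ds (λ ds → van h [] flat cs ds (λ ())))
        -- The lower end of the arc is the one that steps down. The steps of the inside lie on top
        -- of it, so the forbidden step is reached through `⟦⟧-support`.
        inner down h h′ cs ds = ⟦⟧-support I h′ (down ∷ cs) (λ xs → ⟦⟧-zero G w h ds (λ ds → van h (up ∷ xs) down cs ds (λ ())))
      loaded-zero (opn l) G (opn G′ D) (_ ∷ L) {φ} van = loaded-zero l G′ D L (λ h xs c cs ds c≢ →
        ∑ₛ-zero h (λ c′ h′ → ⟦⟧-zero G w h′ (c′ ∷ ds) (λ ds → van h′ (c′ ∷ xs) c cs ds c≢)))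

      bare-one : ∀ {a st mid os b st′ mid′ os′} {F : Forest a st mid} {C : Core a mid os} {G : Forest b st′ mid′} {D : Core b mid′ os′} →
        Bare F C → Bare G D → (L : Links a b os os′) → value w w′ (state F C G D L) (λ h cs ds → allUp cs * allUp ds) ≡ 1ℚ
      bare-one []                      []                      []      = refl
      bare-one (opn {F = F} {C} b) (opn {F = G} {D} b′) (_ ∷ L) =
        trans (value-cong w w′ (state F C G D L) only-up) (bare-one b b′ L)
        where
        only-up : ∀ h cs ds → ∑ₛ h (λ c h′ → allUp (c ∷ cs) * allUp (c ∷ ds)) ≡ allUp cs * allUp ds
        only-up zero    cs ds = ℚ.+-identityʳ _
        only-up (suc h) cs ds = ℚ.+-identityʳ _

  module Pairing (x : ℚ) {w w′ : Weight} (dual : Dual x w w′) (p₀ q₀ : List Step) (k : ℕ)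
    (length-p₀ : length p₀ ≡ k) where

    e : Side → ℕ → Link
    e = links p₀ q₀

    d₁ d₂ : Diagram
    d₁ = dpq p₀ p₀
    d₂ = dpq q₀ q₀

    open Graph e
    open Reducts e
    open Boundary e
    open Circuits (represents p₀ q₀)

    bottom : ℕ → ℕ
    bottom t = ⌊ isBot (partner (composeD d₁ d₂) (top t)) ⌋

    bottom-arc : ∀ {t j} → link p₀ t ≡ to j → bottom t ≡ 0
    bottom-arc h rewrite proj₂ (partner-arc p₀ h) = refl

    bottom-isolated : ∀ {t} → link p₀ t ≡ isolated → bottom t ≡ 0
    bottom-isolated h rewrite proj₂ (partner-isolated p₀ h) = refl

    bottom-through : ∀ {t} → link p₀ t ≡ through → bottom t ≡ ⌊ isBot (walkDown d₁ d₂ (fuel d₁ d₂) t) ⌋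
    bottom-through h rewrite proj₂ (partner-through p₀ h) = refl

    bottom≤1 : ∀ t → bottom t ≤ 1
    bottom≤1 t with isBot (partner (composeD d₁ d₂) (top t))
    ... | true  = ≤-refl
    ... | false = z≤n

    scan-bottom : ∀ {xs m st} (S : Scan (link p₀) xs m st) →
      sumFrom bottom m (length xs) ℕ.+ weigh bottom st ≡ weigh bottom (finalStack S)
    scan-bottom (done _) = refl
    scan-bottom {m = m} {st} (up {xs} S) = trans (shuffle (bottom m) (sumFrom bottom (suc m) (length xs)) (weigh bottom st)) (scan-bottom S)
      where
      shuffle : ∀ a b c → a ℕ.+ b ℕ.+ c ≡ b ℕ.+ (a ℕ.+ c)
      shuffle = solveℕ
    scan-bottom (flat iso S) rewrite bottom-isolated iso = scan-bottom S
    scan-bottom (down u m S) rewrite bottom-arc u | bottom-arc m = scan-bottom S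

    bottoms≤ : ∀ st → weigh bottom st ≤ length st
    bottoms≤ []       = z≤n
    bottoms≤ (u ∷ st) = +-mono-≤ (bottom≤1 u) (bottoms≤ st)

    -- For the final stack of `p`, whose entries are the white positions, this is the rank
    -- condition: the product has full rank exactly when the line through each of them reaches the
    -- bottom row.
    full : List ℕ → Bool
    full st = weigh bottom st ≡ᵇ length st

    reached : ∀ {u v} (W : Walk P u Q v) → link p₀ u ≡ through → link q₀ v ≡ through → Within k (verts W) → bottom u ≡ 1
    reached W tu tv within = trans (bottom-through tu) (cong ⌊_⌋ (walkDown-through k length-p₀ W tv within))

    missed : ∀ {u b z} (W : Walk P u b z) → link p₀ u ≡ through → NotBot k length-p₀ b z → bottom u ≡ 0
    missed W tu n = trans (bottom-through tu) (cong ⌊_⌋ (walkDown-notBot k length-p₀ (fuel d₁ d₂) W n))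

    -- The line through a dead entry stops at an isolated vertex, and the line through an arc end
    -- returns to the top row, so at least one white position is lost to the rank.
    loaded-not-full : ∀ {st mid os} {F : Forest P st mid} {C : Core P mid os} → Loaded F C →
      All (λ u → link p₀ u ≡ through) st → weigh bottom st < length st
    loaded-not-full {u ∷ st} (dot {d = dead W iso}) (t ∷ _) rewrite missed W t (inj₁ iso) = s≤s (bottoms≤ st)
    loaded-not-full {v ∷ st} (arc {W = W} {I}) (t ∷ ts) with All-base I ts
    ... | t′ ∷ _ rewrite missed (reverse W) t (inj₂ (refl , t′)) = s≤s (bottoms≤ st)
    loaded-not-full {u ∷ st} (opn l) (_ ∷ ts) = +-mono-≤-< (bottom≤1 u) (loaded-not-full l ts)

    LinksWithin : ∀ {us vs} → Links P Q us vs → Set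
    LinksWithin L = ∀ f → vL f L ≤ sumFrom f 0 k

    module _ {us vs u v} (W : Walk P u Q v) (L : Links P Q us vs) (within : LinksWithin (W ∷ L)) where
      head-within : Within k (verts W)
      head-within f = ≤-trans (m≤m+n _ (vL f L)) (within f)

      tail-within : LinksWithin L
      tail-within f = ≤-trans (m≤n+m _ (vw f W)) (within f)

    links-full : ∀ {us vs} (L : Links P Q us vs) → All (λ u → link p₀ u ≡ through) us → All (λ v → link q₀ v ≡ through) vs →
      LinksWithin L → weigh bottom us ≡ length us
    links-full []      []        []        within = refl
    links-full (W ∷ L) (tu ∷ tus) (tv ∷ tvs) within =
      cong₂ ℕ._+_ (reached W tu tv (head-within W L within)) (links-full L tus tvs (tail-within W L within))

    links-no-loop : ∀ {us vs} (L : Links P Q us vs) → All (λ u → link p₀ u ≡ through) us → All (λ v → link q₀ v ≡ through) vs →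
      LinksWithin L → vL isLoop L ≡ 0
    links-no-loop []      []         []         within = refl
    links-no-loop (W ∷ L) (tu ∷ tus) (tv ∷ tvs) within =
      cong₂ ℕ._+_ (loops-path k length-p₀ W (inj₂ tu) (inj₂ tv) (head-within W L within))
                  (links-no-loop L tus tvs (tail-within W L within))

    bare-total : ∀ f {a st mid os} {F : Forest a st mid} {C : Core a mid os} → Bare F C → vF f F ℕ.+ vC f C ≡ 0
    bare-total f []      = refl
    bare-total f (opn b) = bare-total f b

    StateWithin : ∀ {a b st st′} → ℕ → State a b st st′ → Set
    StateWithin m s = ∀ f → total f s ≤ sumFrom f 0 m

    outcome : List ℕ → ℕ → ℚ
    outcome st n = if full st then pow x n else 0ℚ

    at-end : ∀ {st st′} (s : State P Q st st′) → All (λ u → link p₀ u ≡ through) st → All (λ v → link q₀ v ≡ through) st′ →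
      length st ≡ length st′ → StateWithin k s →
      value w w′ s (λ h cs ds → allUp cs * allUp ds) ≡ outcome st (total isLoop s ℕ.+ 0)
    at-end {st} s@(state F C G D L) ts ts′ len within with bare⊎loaded F C
    ... | inj₂ l = trans (loaded-zero w w′ l G D L vanishing) (sym (cong (λ b → if b then pow x (total isLoop s ℕ.+ 0) else 0ℚ) not-full))
      where
      vanishing : Vanishing w w′ (λ h cs ds → allUp cs * allUp ds)
      vanishing h xs c cs ds c≢ = trans (cong (_* allUp ds) (allUp-broken xs c cs c≢)) (ℚ.*-zeroˡ (allUp ds))
      not-full : full st ≡ false
      not-full = ≡ᵇ-≢ (<⇒≢ (loaded-not-full l ts))
    ... | inj₁ b with bare⊎loaded G D
    -- The links use up the whole first stack, and the second one is equally long, so it has no room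
    -- for a dead line or an arc.
    ...   | inj₂ l = contradiction (trans (cong length (sym (bare-stack b))) len)
                       (λ eq → <⇒≢ (loaded-length l) (trans (sym (links-length L)) eq))
    ...   | inj₁ b′ with bare-stack b | bare-stack b′
    ...     | refl | refl = trans (bare-one w w′ b b′ L)
                (sym (trans (cong (λ n → outcome st n) no-loops) (cong (λ b → if b then 1ℚ else 0ℚ) is-full)))
      where
      links-within : LinksWithin L
      links-within f = ≤-trans (m≤n+m _ _) (within f)
      no-loops : total isLoop s ℕ.+ 0 ≡ 0
      no-loops = trans (+-identityʳ _) (cong₂ ℕ._+_ (cong₂ ℕ._+_ (bare-total isLoop b) (bare-total isLoop b′))
        (links-no-loop L ts ts′ links-within))
      is-full : full st ≡ true
      is-full = trans (cong (_≡ᵇ length st) (links-full L ts ts′ links-within)) (≡ᵇ-refl (length st))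

    completed-loops : ∀ {vs n} → Completed vs n → Within k vs → weigh isLoop vs ≡ n
    completed-loops none              within = refl
    completed-loops (cycle W d)       within = loops-cycle k length-p₀ W d within
    completed-loops (path W iso iso′) within = loops-path k length-p₀ W (inj₁ iso) (inj₁ iso′) within

    record Advance {ℓ xs m st₁ st′} {a b} (v v′ : Weight) (α : Step) (S : Scan ℓ (α ∷ xs) m st₁) (s : State a b (m ∷ st₁) st′) : Set where
      field
        {stack}    : List ℕ
        scan′      : Scan ℓ xs (suc m) stack
        same-final : finalStack scan′ ≡ finalStack S
        reduct     : Reduct x v v′ α s stack

    advance : ∀ {v v′} → Dual x v v′ → ∀ {a b α xs m st₁ st′} (S : Scan (e a) (α ∷ xs) m st₁) (s : State a b (m ∷ st₁) st′) → Advance v v′ α S s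
    advance {v} {v′} dl (up S) s@(state F C G D L) = record
      { scan′ = S ; same-final = refl
      ; reduct = record
        { new = s ; completed = none ; counted = λ f → sym (+-identityʳ _)
        ; semantic = λ φ → trans (cores-cong v v′ C D L (forests-* v v′ F G 1ℚ φ)) (cores-* v v′ C D L 1ℚ (forests v v′ F G φ)) } }
    advance dl (flat iso S) s = record
      { scan′ = S ; same-final = refl ; reduct = reduce-flat dl iso s }
    advance dl (down u m S) s = record
      { scan′ = S ; same-final = refl ; reduct = reduce-down dl (edge m u) s }

    -- A new middle vertex opens a line on each side, and the trivial walk links the two.
    create : ∀ {st st′} m → State P Q st st′ → State P Q (m ∷ st) (m ∷ st′)
    create m (state F C G D L) = state [] (opn F C) [] (opn G D) (one refl ∷ L)

    total-create : ∀ f {st st′} m (s : State P Q st st′) → total f (create m s) ≡ total f s ℕ.+ f m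
    total-create f m (state F C G D L) = shuffle (vF f F ℕ.+ vC f C) (vF f G ℕ.+ vC f D) (f m) (vL f L)
      where
      shuffle : ∀ a b c d → a ℕ.+ b ℕ.+ (c ℕ.+ 0 ℕ.+ d) ≡ a ℕ.+ b ℕ.+ d ℕ.+ c
      shuffle = solveℕ

    sumFrom-mono : ∀ f n m → m ≤ n → sumFrom f 0 m ≤ sumFrom f 0 n
    sumFrom-mono f n m m≤n = subst (λ n → sumFrom f 0 m ≤ sumFrom f 0 n) (m+[n∸m]≡n m≤n) (extend (n ℕ.∸ m))
      where
      extend : ∀ d → sumFrom f 0 m ≤ sumFrom f 0 (m ℕ.+ d)
      extend zero    = ≤-reflexive (cong (sumFrom f 0) (sym (+-identityʳ m)))
      extend (suc d) = ≤-trans (extend d) (≤-trans (m≤m+n _ (f (m ℕ.+ d)))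
        (≤-reflexive (trans (sym (sumFrom-snoc f 0 (m ℕ.+ d))) (cong (sumFrom f 0) (sym (+-suc m d))))))

    -- At each position a line is created, the letter of the first word acts on the first stack and,
    -- after an exchange of sides, the letter of the second word on the second. Circuits already
    -- closed have left the pattern as powers of x, so the exponent still due is the number of least
    -- circuit vertices among those in the pattern and those to come.
    pairing : ∀ {xs ys m st st′} (S : Scan (link p₀) xs m st) (S′ : Scan (link q₀) ys m st′) (s : State P Q st st′) →
      length xs ≡ length ys → length (finalStack S) ≡ length (finalStack S′) → m ℕ.+ length xs ≡ k → StateWithin m s →
      value w w′ s (stateSum w w′ xs ys) ≡ outcome (finalStack S) (total isLoop s ℕ.+ sumFrom isLoop m (length xs))
    pairing {[]} {[]} {m} (done ts) (done ts′) s len same pos within =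
      at-end s ts ts′ same (λ f → subst (λ k → total f s ≤ sumFrom f 0 k) (trans (sym (+-identityʳ m)) pos) (within f))
    pairing {α ∷ xs} {β ∷ ys} {m} {st} {st′} S S′ s len same pos within = begin
      value w w′ s (stateSum w w′ (α ∷ xs) (β ∷ ys))
        ≡⟨⟩
      value w w′ s₀ (λ h cs ds → apply w α h (λ cs → apply w′ β h (λ ds → stateSum w w′ xs ys h cs ds) ds) cs)
        ≡⟨ Reduct.semantic R₁ (λ h cs ds → apply w′ β h (λ ds → stateSum w w′ xs ys h cs ds) ds) ⟩
      pow x n₁ * value w w′ s₁ (λ h cs ds → apply w′ β h (λ ds → stateSum w w′ xs ys h cs ds) ds)
        ≡⟨ cong (pow x n₁ *_) (value-swap w w′ s₁ _) ⟩
      pow x n₁ * value w′ w (swap s₁) (λ h ds cs → apply w′ β h (λ ds → stateSum w w′ xs ys h cs ds) ds)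
        ≡⟨ cong (pow x n₁ *_) (Reduct.semantic R₂ (λ h ds cs → stateSum w w′ xs ys h cs ds)) ⟩
      pow x n₁ * (pow x n₂ * value w′ w s₂ (λ h ds cs → stateSum w w′ xs ys h cs ds))
        ≡⟨ cong (λ t → pow x n₁ * (pow x n₂ * t)) (value-swap w′ w s₂ _) ⟩
      pow x n₁ * (pow x n₂ * value w w′ (swap s₂) (stateSum w w′ xs ys))
        ≡⟨ cong (λ t → pow x n₁ * (pow x n₂ * t)) (pairing (Advance.scan′ A₁) (Advance.scan′ A₂) (swap s₂)
             (suc-injective len) (trans (cong length (Advance.same-final A₁)) (trans same (cong length (sym (Advance.same-final A₂)))))
             (trans (sym (+-suc m _)) pos) within₂) ⟩
      pow x n₁ * (pow x n₂ * outcome (finalStack (Advance.scan′ A₁)) n)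
        ≡⟨ cong (λ st → pow x n₁ * (pow x n₂ * outcome st n)) (Advance.same-final A₁) ⟩
      pow x n₁ * (pow x n₂ * outcome (finalStack S) n)
        ≡⟨ absorb (full (finalStack S)) ⟩
      outcome (finalStack S) (n₁ ℕ.+ (n₂ ℕ.+ n))
        ≡⟨ cong (outcome (finalStack S)) accounting ⟩
      outcome (finalStack S) (total isLoop s ℕ.+ (isLoop m ℕ.+ sumFrom isLoop (suc m) (length xs))) ∎
      where
      open ≡-Reasoning
      s₀ : State P Q (m ∷ st) (m ∷ st′)
      s₀ = create m s
      A₁ : Advance w w′ α S s₀
      A₁ = advance dual S s₀
      R₁ : Reduct x w w′ α s₀ (Advance.stack A₁)
      R₁ = Advance.reduct A₁
      s₁ : State P Q (Advance.stack A₁) (m ∷ st′)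
      s₁ = Reduct.new R₁
      A₂ : Advance w′ w β S′ (swap s₁)
      A₂ = advance (Dual-sym dual) S′ (swap s₁)
      R₂ : Reduct x w′ w β (swap s₁) (Advance.stack A₂)
      R₂ = Advance.reduct A₂
      s₂ : State Q P (Advance.stack A₂) (Advance.stack A₁)
      s₂ = Reduct.new R₂
      n₁ n₂ n : ℕ
      n₁ = Reduct.circuits R₁
      n₂ = Reduct.circuits R₂
      n = total isLoop (swap s₂) ℕ.+ sumFrom isLoop (suc m) (length xs)
      r₁ r₂ : List ℕ
      r₁ = Reduct.removed R₁
      r₂ = Reduct.removed R₂

      balance : ∀ f → total f (swap s₂) ℕ.+ weigh f r₂ ℕ.+ weigh f r₁ ≡ total f s ℕ.+ f m
      balance f = begin
        total f (swap s₂) ℕ.+ weigh f r₂ ℕ.+ weigh f r₁  ≡⟨ cong (λ t → t ℕ.+ weigh f r₂ ℕ.+ weigh f r₁) (total-swap f s₂) ⟩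
        total f s₂ ℕ.+ weigh f r₂ ℕ.+ weigh f r₁         ≡⟨ cong (ℕ._+ weigh f r₁) (Reduct.counted R₂ f) ⟨
        total f (swap s₁) ℕ.+ weigh f r₁                 ≡⟨ cong (ℕ._+ weigh f r₁) (total-swap f s₁) ⟩
        total f s₁ ℕ.+ weigh f r₁                        ≡⟨ Reduct.counted R₁ f ⟨
        total f s₀                                       ≡⟨ total-create f m s ⟩
        total f s ℕ.+ f m                                ∎

      before : ∀ f → total f s ℕ.+ f m ≤ sumFrom f 0 (suc m)
      before f = subst (total f s ℕ.+ f m ≤_) (sym (sumFrom-snoc f 0 m)) (+-monoˡ-≤ (f m) (within f))

      m<k : suc m ≤ k
      m<k = subst (suc m ≤_) pos (≤-trans (≤-reflexive (sym (+-comm m 1))) (+-monoʳ-≤ m (s≤s z≤n)))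

      within₂ : StateWithin (suc m) (swap s₂)
      within₂ f = ≤-trans (≤-trans (≤-trans (m≤m+n (total f (swap s₂)) (weigh f r₂)) (m≤m+n _ (weigh f r₁))) (≤-reflexive (balance f))) (before f)

      removed₁ : Within k r₁
      removed₁ f = ≤-trans (≤-trans (m≤n+m (weigh f r₁) (total f (swap s₂) ℕ.+ weigh f r₂)) (≤-reflexive (balance f))) (≤-trans (before f) (sumFrom-mono f k (suc m) m<k))

      removed₂ : Within k r₂
      removed₂ f = ≤-trans (≤-trans (≤-trans (m≤n+m (weigh f r₂) (total f (swap s₂))) (m≤m+n _ (weigh f r₁))) (≤-reflexive (balance f))) (≤-trans (before f) (sumFrom-mono f k (suc m) m<k))

      accounting : n₁ ℕ.+ (n₂ ℕ.+ n) ≡ total isLoop s ℕ.+ (isLoop m ℕ.+ sumFrom isLoop (suc m) (length xs))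
      accounting
        rewrite sym (completed-loops (Reduct.completed R₁) removed₁) | sym (completed-loops (Reduct.completed R₂) removed₂) =
        trans (shuffle (weigh isLoop r₁) (weigh isLoop r₂) (total isLoop (swap s₂)) (sumFrom isLoop (suc m) (length xs)))
          (trans (cong (ℕ._+ sumFrom isLoop (suc m) (length xs)) (balance isLoop)) (+-assoc (total isLoop s) (isLoop m) _))
        where
        shuffle : ∀ a b c d → a ℕ.+ (b ℕ.+ (c ℕ.+ d)) ≡ c ℕ.+ b ℕ.+ a ℕ.+ d
        shuffle = solveℕ

      absorb : ∀ b → pow x n₁ * (pow x n₂ * (if b then pow x n else 0ℚ)) ≡ (if b then pow x (n₁ ℕ.+ (n₂ ℕ.+ n)) else 0ℚ)
      absorb true  = trans (cong (pow x n₁ *_) (pow-+ x n₂ n)) (pow-+ x n₁ (n₂ ℕ.+ n))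
      absorb false = trans (cong (pow x n₁ *_) (ℚ.*-zeroʳ (pow x n₂))) (ℚ.*-zeroʳ (pow x n₁))

  gramValue : ℚ → ℕ → List Step → List Step → ℚ
  gramValue x r p q = if rankD (composeD (dpq p p) (dpq q q)) ≡ᵇ r then pow x (loops (dpq p p) (dpq q q)) else 0ℚ

  gramValue-stateSum : ∀ x {w w′} → Dual x w w′ → ∀ {k r p q} → length p ≡ k → length q ≡ k →
    isMotzkin p ≡ true → isMotzkin q ≡ true → rank p ≡ r → rank q ≡ r →
    gramValue x r p q ≡ stateSum w w′ p q 0 [] []
  gramValue-stateSum x {w} {w′} dual {k} {r} {p} {q} len-p len-q valid-p valid-q rank-p rank-q = sym (begin
    stateSum w w′ p q 0 [] []
      ≡⟨ pairing Sp Sq (state [] [] [] [] []) (trans len-p (sym len-q))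
           (trans (length-finalStack Sp) (trans rank-p (sym (trans (length-finalStack Sq) rank-q)))) len-p (λ f → z≤n) ⟩
    (if weigh bottom (finalStack Sp) ≡ᵇ length (finalStack Sp) then pow x (sumFrom isLoop 0 (length p)) else 0ℚ)
      ≡⟨ cong₂ (λ b n → if b then pow x n else 0ℚ)
           (cong₂ _≡ᵇ_ ranks (trans (length-finalStack Sp) rank-p)) count-loops ⟩
    gramValue x r p q ∎)
    where
    open ≡-Reasoning
    open Pairing x dual p q k len-p
    open Graph (links p q)
    open Circuits (represents p q)
    Sp : Scan (link p) p 0 []
    Sp = scan p valid-p
    Sq : Scan (link q) q 0 []
    Sq = scan q valid-q
    ranks : weigh bottom (finalStack Sp) ≡ rankD (composeD d₁ d₂)
    ranks = trans (sym (trans (sym (+-identityʳ _)) (scan-bottom Sp))) (trans (sym (weigh-upTo bottom (length p)))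
      (sym (length-filter (λ t → isBot (partner (composeD d₁ d₂) (top t))) (upTo (length p)))))
    count-loops : sumFrom isLoop 0 (length p) ≡ loops d₁ d₂
    count-loops = trans (sym (weigh-upTo isLoop (length p)))
      (sym (length-filter (λ j → loopFrom d₁ d₂ (fuel d₁ d₂) j j) (upTo (length p))))

-- Splitting the state sum over height paths into contributions of the two words.

module Factorisation where
  open Determinant
  open Forests
  open StateSum
  open import Data.Bool.Properties using (T-≡; T-∧)
  open import Data.List.Relation.Unary.All as All using (All; []; _∷_)
  import Data.List.Relation.Unary.All.Properties as All
  open import Data.List.Relation.Unary.AllPairs using (AllPairs; []; _∷_)
  import Data.List.Relation.Unary.AllPairs.Properties as AllPairs
  open import Data.Nat using (_≡ᵇ_)
  open import Data.Nat.Properties using (≡ᵇ⇒≡; suc-injective; +-suc)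
  open import Data.Rational using (ℚ; _+_; _*_; 0ℚ; 1ℚ)
  open import Data.Rational.Properties using (*-identityˡ; *-zeroˡ; *-zeroʳ; +-identityʳ; +-identityˡ)

  sumOver : ∀ {A : Set} → (A → ℚ) → List A → ℚ
  sumOver f []       = 0ℚ
  sumOver f (x ∷ xs) = f x + sumOver f xs

  sumOver-++ : ∀ {A : Set} (f : A → ℚ) xs ys → sumOver f (xs ++ ys) ≡ sumOver f xs + sumOver f ys
  sumOver-++ f []       ys = sym (+-identityˡ _)
  sumOver-++ f (x ∷ xs) ys = trans (cong (f x +_) (sumOver-++ f xs ys)) (assoc (f x) (sumOver f xs) (sumOver f ys))
    where
    assoc : ∀ a b c → a + (b + c) ≡ (a + b) + c
    assoc = solve-∀ ring

  sumOver-map : ∀ {A B : Set} (f : B → ℚ) (g : A → B) xs → sumOver f (map g xs) ≡ sumOver (f ∘ g) xs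
  sumOver-map f g []       = refl
  sumOver-map f g (x ∷ xs) = cong (f (g x) +_) (sumOver-map f g xs)

  sumOver-* : ∀ {A : Set} k (f : A → ℚ) xs → sumOver (λ x → k * f x) xs ≡ k * sumOver f xs
  sumOver-* k f []       = sym (*-zeroʳ k)
  sumOver-* k f (x ∷ xs) = trans (cong (k * f x +_) (sumOver-* k f xs)) (sym (distribˡ k (f x) _))

  sumOver-cong : ∀ {A : Set} {f g : A → ℚ} xs → (∀ x → f x ≡ g x) → sumOver f xs ≡ sumOver g xs
  sumOver-cong []       e = refl
  sumOver-cong (x ∷ xs) e = cong₂ _+_ (e x) (sumOver-cong xs e)

  sumOver-zero : ∀ {A : Set} {f : A → ℚ} xs → (∀ x → f x ≡ 0ℚ) → sumOver f xs ≡ 0ℚ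
  sumOver-zero []       e = refl
  sumOver-zero (x ∷ xs) e = cong₂ _+_ (e x) (sumOver-zero xs e)

  sumOver-filter : ∀ {A : Set} {f : A → ℚ} (b : A → Bool) xs → (∀ x → b x ≡ false → f x ≡ 0ℚ) →
    sumOver f (filter (λ x → T? (b x)) xs) ≡ sumOver f xs
  sumOver-filter b []       e = refl
  sumOver-filter {f = f} b (x ∷ xs) e with b x in eq
  ... | true  = cong (f x +_) (sumOver-filter b xs e)
  ... | false = trans (sumOver-filter b xs e) (sym (trans (cong (_+ sumOver f xs) (e x eq)) (+-identityˡ _)))

  sumOver-nthP : ∀ (f : List Step → ℚ) ps → sumOver f ps ≡ ∑ (length ps) (λ i → f (nthP ps i))
  sumOver-nthP f []       = refl
  sumOver-nthP f (p ∷ ps) = cong (f p +_) (sumOver-nthP f ps)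

  sumOver-allSeqs : ∀ k (f : List Step → ℚ) → sumOver f (allSeqs (suc k)) ≡
    sumOver (f ∘ (up ∷_)) (allSeqs k) + (sumOver (f ∘ (flat ∷_)) (allSeqs k) + sumOver (f ∘ (down ∷_)) (allSeqs k))
  sumOver-allSeqs k f = begin
    sumOver f (map (up ∷_) S ++ (map (flat ∷_) S ++ (map (down ∷_) S ++ [])))
      ≡⟨ sumOver-++ f (map (up ∷_) S) _ ⟩
    sumOver f (map (up ∷_) S) + sumOver f (map (flat ∷_) S ++ (map (down ∷_) S ++ []))
      ≡⟨ cong (sumOver f (map (up ∷_) S) +_) (sumOver-++ f (map (flat ∷_) S) _) ⟩
    sumOver f (map (up ∷_) S) + (sumOver f (map (flat ∷_) S) + sumOver f (map (down ∷_) S ++ []))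
      ≡⟨ cong (λ t → sumOver f (map (up ∷_) S) + (sumOver f (map (flat ∷_) S) + t))
           (trans (sumOver-++ f (map (down ∷_) S) []) (+-identityʳ _)) ⟩
    sumOver f (map (up ∷_) S) + (sumOver f (map (flat ∷_) S) + sumOver f (map (down ∷_) S))
      ≡⟨ cong₂ _+_ (sumOver-map f (up ∷_) S) (cong₂ _+_ (sumOver-map f (flat ∷_) S) (sumOver-map f (down ∷_) S)) ⟩
    sumOver (f ∘ (up ∷_)) S + (sumOver (f ∘ (flat ∷_)) S + sumOver (f ∘ (down ∷_)) S) ∎
    where
    open ≡-Reasoning
    S : List (List Step)
    S = allSeqs k

  -- The contribution of the height path π to the word p, read with the given stack.
  run : Weight → List Step → List Step → ℕ → List Step → ℚ
  run w []      []               h       cs = allUp cs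
  run w (α ∷ p) (up ∷ π)         h       cs = coef w α (suc h) (up ∷ cs) * run w p π (suc h) (unstack α (up ∷ cs))
  run w (α ∷ p) (flat ∷ π)       h       cs = coef w α h (flat ∷ cs) * run w p π h (unstack α (flat ∷ cs))
  run w (α ∷ p) (down ∷ π)       (suc h) cs = coef w α h (down ∷ cs) * run w p π h (unstack α (down ∷ cs))
  run w _       _                h       cs = 0ℚ

  private
    factor : ∀ a b c d → (a * c) * (b * d) ≡ (a * b) * (c * d)
    factor = solve-∀ ring

    merge : ∀ a b s → (a * b) * s ≡ a * (b * s)
    merge = solve-∀ ring

  -- Once the heights along the middle row are fixed, each stack is governed by its own word alone,
  -- so the summand is a product.
  stateSum-run : ∀ w w′ p q h cs ds → length p ≡ length q →
    stateSum w w′ p q h cs ds ≡ sumOver (λ π → run w p π h cs * run w′ q π h ds) (allSeqs (length p))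
  stateSum-run w w′ []      []      h cs ds len = sym (+-identityʳ _)
  stateSum-run w w′ (α ∷ p) (β ∷ q) h cs ds len = sym (trans (sumOver-allSeqs (length p) _) (by-height h))
    where
    S : List (List Step)
    S = allSeqs (length p)
    branch : ∀ c h′ →
      sumOver (λ π → (coef w α h′ (c ∷ cs) * run w p π h′ (unstack α (c ∷ cs))) * (coef w′ β h′ (c ∷ ds) * run w′ q π h′ (unstack β (c ∷ ds)))) S
      ≡ apply w α h′ (λ cs → apply w′ β h′ (λ ds → stateSum w w′ p q h′ cs ds) (c ∷ ds)) (c ∷ cs)
    branch c h′ = trans (sumOver-cong S (λ π → factor a b (run w p π h′ (unstack α (c ∷ cs))) (run w′ q π h′ (unstack β (c ∷ ds)))))
      (trans (sumOver-* (a * b) _ S) (trans (cong (a * b *_) (sym (stateSum-run w w′ p q h′ (unstack α (c ∷ cs)) (unstack β (c ∷ ds)) (suc-injective len))))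
        (merge a b _)))
      where
      a b : ℚ
      a = coef w α h′ (c ∷ cs)
      b = coef w′ β h′ (c ∷ ds)
    by-height : ∀ h → sumOver (λ π → run w (α ∷ p) (up ∷ π) h cs * run w′ (β ∷ q) (up ∷ π) h ds) S
      + (sumOver (λ π → run w (α ∷ p) (flat ∷ π) h cs * run w′ (β ∷ q) (flat ∷ π) h ds) S
      + sumOver (λ π → run w (α ∷ p) (down ∷ π) h cs * run w′ (β ∷ q) (down ∷ π) h ds) S)
      ≡ ∑ₛ h (λ c h′ → apply w α h′ (λ cs → apply w′ β h′ (λ ds → stateSum w w′ p q h′ cs ds) (c ∷ ds)) (c ∷ cs))
    -- `run` vanishes on a down step from height 0, in accordance with the summand that `∑ₛ` lacks
    -- there.
    by-height zero    = cong₂ _+_ (branch up 1) (trans (cong₂ _+_ (branch flat 0) (sumOver-zero S (λ _ → refl))) (+-identityʳ _))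
    by-height (suc h) = cong₂ _+_ (branch up (suc (suc h))) (cong₂ _+_ (branch flat (suc h)) (branch down h))

  run-invalid : ∀ w p π h cs → validFrom h π ≡ false → run w p π h cs ≡ 0ℚ
  run-invalid w []      (_ ∷ _)    h       cs v = refl
  run-invalid w (α ∷ p) (up ∷ π)   h       cs v rewrite run-invalid w p π (suc h) (unstack α (up ∷ cs)) v = *-zeroʳ (coef w α (suc h) (up ∷ cs))
  run-invalid w (α ∷ p) (flat ∷ π) h       cs v rewrite run-invalid w p π h (unstack α (flat ∷ cs)) v = *-zeroʳ (coef w α h (flat ∷ cs))
  run-invalid w (α ∷ p) (down ∷ π) zero    cs v = refl
  run-invalid w (α ∷ p) (down ∷ π) (suc h) cs v rewrite run-invalid w p π h (unstack α (down ∷ cs)) v = *-zeroʳ (coef w α h (down ∷ cs))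

  ups downs : List Step → ℕ
  ups []          = 0
  ups (up ∷ cs)   = suc (ups cs)
  ups (_ ∷ cs)    = ups cs
  downs []          = 0
  downs (down ∷ cs) = suc (downs cs)
  downs (_ ∷ cs)    = downs cs

  -- The invariant that ties the stack to the current height: letters remove only flat steps and
  -- pairs of inverse steps, so the net rise of the stack is not affected.
  Height : ℕ → List Step → Set
  Height h cs = ups cs ≡ h ℕ.+ downs cs

  Height-push : ∀ c h cs → Valid c h → Height h cs → Height (shift c h) (c ∷ cs)
  Height-push up   h       cs v e = cong suc e
  Height-push flat h       cs v e = e
  Height-push down (suc h) cs v e = trans e (sym (+-suc h _))

  Height-allUp : ∀ h cs → Height h cs → h ≢ length cs → allUp cs ≡ 0ℚ
  Height-allUp zero    []        e n = contradiction refl n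
  Height-allUp zero    (up ∷ cs) e n with downs cs in eq
  Height-allUp zero    (up ∷ cs) e n | suc d = no-downs cs eq
    where
    no-downs : ∀ cs {d} → downs cs ≡ suc d → allUp cs ≡ 0ℚ
    no-downs (up ∷ cs)   e = no-downs cs e
    no-downs (flat ∷ cs) e = refl
    no-downs (down ∷ cs) e = refl
  Height-allUp (suc h) (up ∷ cs)  e n = Height-allUp h cs (suc-injective e) (n ∘ cong suc)
  Height-allUp h       (flat ∷ cs) e n = refl
  Height-allUp h       (down ∷ cs) e n = refl

  unstack-height : ∀ w α p c cs h → Height h (c ∷ cs) → coef w α h (c ∷ cs) ≡ 0ℚ ⊎
    (Height h (unstack α (c ∷ cs)) × heightFrom (length cs) (α ∷ p) ≡ heightFrom (length (unstack α (c ∷ cs))) p)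
  unstack-height w up   p c    cs          h e = inj₂ (e , refl)
  unstack-height w flat p up   cs          h e = inj₁ refl
  unstack-height w flat p flat cs          h e = inj₂ (e , refl)
  unstack-height w flat p down cs          h e = inj₁ refl
  unstack-height w down p c    []          h e = inj₁ refl
  unstack-height w down p up   (up ∷ cs)   h e = inj₁ refl
  unstack-height w down p up   (flat ∷ cs) h e = inj₁ refl
  unstack-height w down p up   (down ∷ cs) h e = inj₂ (suc-injective (trans e (+-suc h _)) , refl)
  unstack-height w down p flat (up ∷ cs)   h e = inj₁ refl
  unstack-height w down p flat (flat ∷ cs) h e = inj₂ (e , refl)
  unstack-height w down p flat (down ∷ cs) h e = inj₁ refl
  unstack-height w down p down (up ∷ cs)   h e = inj₂ (suc-injective (trans e (+-suc h _)) , refl)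
  unstack-height w down p down (flat ∷ cs) h e = inj₁ refl
  unstack-height w down p down (down ∷ cs) h e = inj₁ refl

  -- At the end the stack has as many entries as `p` has unclosed steps, and all must be `up`; their
  -- net rise is then the rank of `p`, but it is also the final height of `π`.
  run-height : ∀ w p π h cs → Height h cs → heightFrom h π ≢ heightFrom (length cs) p → run w p π h cs ≡ 0ℚ
  run-height w []      []         h       cs e n = Height-allUp h cs e n
  run-height w []      (_ ∷ _)    h       cs e n = refl
  run-height w (α ∷ p) []         h       cs e n = refl
  run-height w (α ∷ p) (c ∷ π)    h       cs e n = pushed c π h n e
    where
    step : ∀ c π h → Height h (c ∷ cs) → heightFrom h π ≢ heightFrom (length cs) (α ∷ p) →
      coef w α h (c ∷ cs) * run w p π h (unstack α (c ∷ cs)) ≡ 0ℚ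
    step c π h e n with unstack-height w α p c cs h e
    ... | inj₁ z        = trans (cong (_* run w p π h (unstack α (c ∷ cs))) z) (*-zeroˡ (run w p π h (unstack α (c ∷ cs))))
    ... | inj₂ (e′ , l) = trans
      (cong (coef w α h (c ∷ cs) *_) (run-height w p π h (unstack α (c ∷ cs)) e′ (λ eq → n (trans eq (sym l)))))
      (*-zeroʳ (coef w α h (c ∷ cs)))

    pushed : ∀ c π h → heightFrom h (c ∷ π) ≢ heightFrom (length cs) (α ∷ p) → Height h cs → run w (α ∷ p) (c ∷ π) h cs ≡ 0ℚ
    pushed up   π h       n e = step up π (suc h) (Height-push up h cs _ e) n
    pushed flat π h       n e = step flat π h e n
    pushed down π zero    n e = refl
    pushed down π (suc h) n e = step down π h (Height-push down (suc h) cs _ e) n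

  -- Triangularity for the lexicographic order, and the diagonal entries.

  data _≺_ : Step → Step → Set where
    up≺flat   : up ≺ flat
    up≺down   : up ≺ down
    flat≺down : flat ≺ down

  data Before : List Step → List Step → Set where
    now   : ∀ {c c′ π π′} → c ≺ c′ → Before (c ∷ π) (c′ ∷ π′)
    later : ∀ {c π π′} → Before π π′ → Before (c ∷ π) (c ∷ π′)

  -- As long as `π` follows `p`, the stack consists of `up` steps. At the first difference a letter
  -- `flat` accepts only the step `flat`, and a letter `down` only `down`, the inverse of `up`;
  -- hence a smaller step of `π` gives 0.
  run-before : ∀ w {π p} → Before π p → ∀ n h → run w p π h (replicate n up) ≡ 0ℚ
  run-before w (now {π = π} {p} up≺flat)   n       h       = *-zeroˡ (run w p π (suc h) (replicate n up))
  run-before w (now {π = π} {p} up≺down)   zero    h       = *-zeroˡ (run w p π (suc h) [])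
  run-before w (now {π = π} {p} up≺down)   (suc n) h       = *-zeroˡ (run w p π (suc h) (replicate n up))
  run-before w (now {π = π} {p} flat≺down) zero    h       = *-zeroˡ (run w p π h [])
  run-before w (now {π = π} {p} flat≺down) (suc n) h       = *-zeroˡ (run w p π h (replicate n up))
  run-before w (later {up} b)              n       h       = cong (1ℚ *_) (run-before w b (suc n) (suc h))
  run-before w (later {flat} b)            n       h       = cong (1ℚ *_) (run-before w b n h)
  run-before w (later {down} b)            n       zero    = refl
  run-before w (later {down} {π} {p} b)    zero    (suc h) = *-zeroˡ (run w p π h [])
  run-before w (later {down} b)            (suc n) (suc h) = trans (cong (w up h *_) (run-before w b n h)) (*-zeroʳ (w up h))

  allSeqs-sorted : ∀ k → AllPairs Before (allSeqs k)
  allSeqs-sorted zero    = [] ∷ []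
  allSeqs-sorted (suc k) =
    AllPairs.++⁺ (block up) (AllPairs.++⁺ (block flat) (AllPairs.++⁺ (block down) [] (All.universal (λ _ → []) _))
      (apart flat (All.++⁺ (heads flat≺down) [])))
      (apart up (All.++⁺ (heads up≺flat) (All.++⁺ (heads up≺down) [])))
    where
    S : List (List Step)
    S = allSeqs k
    block : ∀ c → AllPairs Before (map (c ∷_) S)
    block c = AllPairs.map⁺ (Data.List.Relation.Unary.AllPairs.map later (allSeqs-sorted k))
    heads : ∀ {c c′ π} → c ≺ c′ → All (Before (c ∷ π)) (map (c′ ∷_) S)
    heads lt = All.map⁺ (All.universal (λ _ → now lt) S)
    apart : ∀ c {ys} → (∀ {π} → All (Before (c ∷ π)) ys) → All (λ π → All (Before π) ys) (map (c ∷_) S)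
    apart c h = All.map⁺ (All.universal (λ _ → h) S)

  allSeqs-length : ∀ k → All (λ p → length p ≡ k) (allSeqs k)
  allSeqs-length zero    = refl ∷ []
  allSeqs-length (suc k) = All.++⁺ (block up) (All.++⁺ (block flat) (All.++⁺ (block down) []))
    where
    block : ∀ c → All (λ p → length p ≡ suc k) (map (c ∷_) (allSeqs k))
    block c = All.map⁺ (All.map (cong suc) (allSeqs-length k))

  nthP-All : ∀ {Pr : List Step → Set} {ps} → All Pr ps → ∀ i → i < length ps → Pr (nthP ps i)
  nthP-All (x ∷ xs) zero    i<n       = x
  nthP-All (x ∷ xs) (suc i) (s≤s i<n) = nthP-All xs i i<n

  nthP-AllPairs : ∀ {R : List Step → List Step → Set} {ps} → AllPairs R ps → ∀ i j → i < length ps → j < i → R (nthP ps j) (nthP ps i)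
  nthP-AllPairs (x ∷ xs) (suc i) zero    (s≤s i<n) j<i       = nthP-All x i i<n
  nthP-AllPairs (x ∷ xs) (suc i) (suc j) (s≤s i<n) (s≤s j<i) = nthP-AllPairs xs i j i<n j<i

  record IsPath (k r : ℕ) (p : List Step) : Set where
    field
      length-k : length p ≡ k
      motzkin  : isMotzkin p ≡ true
      rank-r   : rank p ≡ r

  paths-IsPath : ∀ k r → All (IsPath k r) (paths k r)
  paths-IsPath k r = All.zipWith (λ { (len , t) → record
      { length-k = len
      ; motzkin  = Equivalence.to T-≡ (proj₁ (Equivalence.to T-∧ t))
      ; rank-r   = ≡ᵇ⇒≡ _ r (proj₂ (Equivalence.to T-∧ t)) } })
    (All.filter⁺ P? (allSeqs-length k) , All.all-filter P? (allSeqs k))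
    where
    P? : ∀ p → _
    P? p = T? (isMotzkin p ∧ (rank p ≡ᵇ r))

  paths-sorted : ∀ k r → AllPairs Before (paths k r)
  paths-sorted k r = AllPairs.filter⁺ (λ p → T? (isMotzkin p ∧ (rank p ≡ᵇ r))) (allSeqs-sorted k)

  pathWeight : (ℕ → ℚ) → ℕ → List Step → ℚ
  pathWeight ρ h       []         = 1ℚ
  pathWeight ρ h       (up ∷ p)   = pathWeight ρ (suc h) p
  pathWeight ρ h       (flat ∷ p) = pathWeight ρ h p
  pathWeight ρ zero    (down ∷ p) = 1ℚ
  pathWeight ρ (suc h) (down ∷ p) = ρ h * pathWeight ρ h p

  run-diagonal : ∀ w p h → validFrom h p ≡ true → run w p p h (replicate h up) ≡ pathWeight (w up) h p
  run-diagonal w []         h       v = all-up h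
    where
    all-up : ∀ h → allUp (replicate h up) ≡ 1ℚ
    all-up zero    = refl
    all-up (suc h) = all-up h
  run-diagonal w (up ∷ p)   h       v = trans (*-identityˡ _) (run-diagonal w p (suc h) v)
  run-diagonal w (flat ∷ p) h       v = trans (*-identityˡ _) (run-diagonal w p h v)
  run-diagonal w (down ∷ p) (suc h) v = cong (w up h *_) (run-diagonal w p h v)

  pathWeight-one : ∀ {ρ} → (∀ h → ρ h ≡ 1ℚ) → ∀ h p → pathWeight ρ h p ≡ 1ℚ
  pathWeight-one e h       []         = refl
  pathWeight-one e h       (up ∷ p)   = pathWeight-one e (suc h) p
  pathWeight-one e h       (flat ∷ p) = pathWeight-one e h p
  pathWeight-one e zero    (down ∷ p) = refl
  pathWeight-one e (suc h) (down ∷ p) = trans (cong₂ _*_ (e h) (pathWeight-one e h p)) refl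

  gramValue-factors : ∀ x {w w′} → Dual x w w′ → ∀ {k r p q} → IsPath k r p → IsPath k r q →
    gramValue x r p q ≡ ∑ (mot k r) (λ i → run w p (nthP (paths k r) i) 0 [] * run w′ q (nthP (paths k r) i) 0 [])
  gramValue-factors x {w} {w′} dual {k} {r} {p} {q} isP isQ = begin
    gramValue x r p q
      ≡⟨ gramValue-stateSum x dual {p = p} {q} P.length-k Q.length-k P.motzkin Q.motzkin P.rank-r Q.rank-r ⟩
    stateSum w w′ p q 0 [] []
      ≡⟨ stateSum-run w w′ p q 0 [] [] (trans P.length-k (sym Q.length-k)) ⟩
    sumOver f (allSeqs (length p))
      ≡⟨ cong (λ k → sumOver f (allSeqs k)) P.length-k ⟩
    sumOver f (allSeqs k)
      ≡⟨ sumOver-filter (λ π → isMotzkin π ∧ (rank π ≡ᵇ r)) (allSeqs k) vanishing ⟨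
    sumOver f (paths k r)
      ≡⟨ sumOver-nthP f (paths k r) ⟩
    ∑ (mot k r) (λ i → f (nthP (paths k r) i)) ∎
    where
    open ≡-Reasoning
    module P = IsPath isP
    module Q = IsPath isQ
    f : List Step → ℚ
    f π = run w p π 0 [] * run w′ q π 0 []
    vanishing : ∀ π → isMotzkin π ∧ (rank π ≡ᵇ r) ≡ false → f π ≡ 0ℚ
    vanishing π h = trans (cong (_* run w′ q π 0 []) run-zero) (*-zeroˡ (run w′ q π 0 []))
      where
      run-zero : run w p π 0 [] ≡ 0ℚ
      run-zero with isMotzkin π in eq
      ... | false = run-invalid w p π 0 [] eq
      ... | true  = run-height w p π 0 [] refl (λ same → clash (trans same P.rank-r))
        where
        clash : rank π ≢ r
        clash refl with () ← subst T h (Data.Nat.Properties.≡⇒≡ᵇ (rank π) r refl)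

  -- Rising arcs of the second word have weight 1, which makes its factor unitriangular and leaves
  -- the whole determinant to the diagonal of the first.
  det-entries : ∀ x {w w′} → Dual x w w′ → (∀ h → w′ up h ≡ 1ℚ) → ∀ k r (g : ℕ → Column) →
    (∀ i j → g j i ≡ gramValue x r (nthP (paths k r) i) (nthP (paths k r) j)) →
    detC (mot k r) (applyUpTo g (mot k r)) ≡ ∏ (mot k r) (λ i → pathWeight (w up) 0 (nthP (paths k r) i))
  det-entries x {w} {w′} dual one k r g g-entry = begin
    detC n (applyUpTo g n)
      ≡⟨ detC-triangular n (λ i j → run w (nthP L i) (nthP L j) 0 []) (λ i j → run w′ (nthP L i) (nthP L j) 0 [])
           g (upper w) (upper w′)
           (λ i i<n → trans (diagonal w′ i i<n) (pathWeight-one one 0 (nthP L i)))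
           (λ i j i<n j<n → trans (g-entry i j) (gramValue-factors x dual (isPath i i<n) (isPath j j<n))) ⟩
    ∏ n (λ i → run w (nthP L i) (nthP L i) 0 [])
      ≡⟨ ∏-cong n (λ i i<n → diagonal w i i<n) ⟩
    ∏ n (λ i → pathWeight (w up) 0 (nthP L i)) ∎
    where
    open ≡-Reasoning
    n : ℕ
    n = mot k r
    L : List (List Step)
    L = paths k r
    isPath : ∀ i → i < n → IsPath k r (nthP L i)
    isPath = nthP-All (paths-IsPath k r)
    upper : ∀ w → UpperTriangular n (λ i j → run w (nthP L i) (nthP L j) 0 [])
    upper w i j i<n j<i = run-before w (nthP-AllPairs (paths-sorted k r) i j i<n j<i) 0 0
    diagonal : ∀ w i → i < n → run w (nthP L i) (nthP L i) 0 [] ≡ pathWeight (w up) 0 (nthP L i)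
    diagonal w i i<n = run-diagonal w (nthP L i) 0 (IsPath.motzkin (isPath i i<n))

-- The product of all path weights: recursion on the last step.

module ProductFormula where
  open Determinant
  open Forests using (pow)
  open Loops using (⌊_⌋; ≡ᵇ-≢)
  open StateSum using (pow-+)
  open Factorisation using (pathWeight)
  open import Data.List.Properties using (filter-++; length-++; length-map)
  open import Data.Nat using (_≡ᵇ_)
  open import Data.Nat.Properties hiding (*-identityˡ; *-identityʳ; *-assoc; *-zeroˡ; *-zeroʳ; *-comm)
  open import Data.Nat.Tactic.RingSolver using () renaming (solve-∀ to solveℕ)
  open import Data.Rational using (ℚ; _*_; 1ℚ)
  open import Data.Rational.Properties using (*-identityˡ; *-identityʳ; *-assoc; *-comm)

  productOver : (List Step → ℚ) → List (List Step) → ℚ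
  productOver f []       = 1ℚ
  productOver f (p ∷ ps) = f p * productOver f ps

  productOver-nthP : ∀ f ps → productOver f ps ≡ ∏ (length ps) (λ i → f (nthP ps i))
  productOver-nthP f []       = refl
  productOver-nthP f (p ∷ ps) = cong (f p *_) (productOver-nthP f ps)

  productOver-++ : ∀ f ps qs → productOver f (ps ++ qs) ≡ productOver f ps * productOver f qs
  productOver-++ f []       qs = sym (*-identityˡ _)
  productOver-++ f (p ∷ ps) qs = trans (cong (f p *_) (productOver-++ f ps qs)) (sym (*-assoc (f p) _ _))

  productOver-map : ∀ f g ps → productOver f (map g ps) ≡ productOver (f ∘ g) ps
  productOver-map f g []       = refl
  productOver-map f g (p ∷ ps) = cong (f (g p) *_) (productOver-map f g ps)

  productOver-scaled : ∀ a f ps → productOver (λ p → a * f p) ps ≡ pow a (length ps) * productOver f ps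
  productOver-scaled a f []       = refl
  productOver-scaled a f (p ∷ ps) = trans (cong (a * f p *_) (productOver-scaled a f ps)) (shuffle a (f p) _ _)
    where
    shuffle : ∀ a b c d → (a * b) * (c * d) ≡ (a * c) * (b * d)
    shuffle = solve-∀ ring

  goesTo : ℕ → ℕ → List Step → Bool
  goesTo h r p = validFrom h p ∧ (heightFrom h p ≡ᵇ r)

  pathsFrom : ℕ → ℕ → ℕ → List (List Step)
  pathsFrom h k r = filter (λ p → T? (goesTo h r p)) (allSeqs k)

  filter-map : ∀ (b b′ : List Step → Bool) (g : List Step → List Step) → (∀ p → b (g p) ≡ b′ p) → ∀ ps →
    filter (λ p → T? (b p)) (map g ps) ≡ map g (filter (λ p → T? (b′ p)) ps)
  filter-map b b′ g e []       = refl
  filter-map b b′ g e (p ∷ ps) with b (g p) | b′ p | e p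
  ... | true  | true  | refl = cong (g p ∷_) (filter-map b b′ g e ps)
  ... | false | false | refl = filter-map b b′ g e ps

  filter-none : ∀ (b : List Step → Bool) (g : List Step → List Step) → (∀ p → b (g p) ≡ false) → ∀ ps →
    filter (λ p → T? (b p)) (map g ps) ≡ []
  filter-none b g e []       = refl
  filter-none b g e (p ∷ ps) rewrite e p = filter-none b g e ps

  downward : ℕ → ℕ → ℕ → List (List Step)
  downward zero    k r = []
  downward (suc h) k r = pathsFrom h k r

  pathsFrom-suc : ∀ h k r → pathsFrom h (suc k) r ≡
    map (up ∷_) (pathsFrom (suc h) k r) ++ (map (flat ∷_) (pathsFrom h k r) ++ map (down ∷_) (downward h k r))
  pathsFrom-suc h k r = begin
    filter P? (map (up ∷_) S ++ (map (flat ∷_) S ++ (map (down ∷_) S ++ [])))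
      ≡⟨ filter-++ P? (map (up ∷_) S) _ ⟩
    filter P? (map (up ∷_) S) ++ filter P? (map (flat ∷_) S ++ (map (down ∷_) S ++ []))
      ≡⟨ cong₂ _++_ (filter-map (goesTo h r) (goesTo (suc h) r) (up ∷_) (λ _ → refl) S)
           (trans (filter-++ P? (map (flat ∷_) S) _)
             (cong₂ _++_ (filter-map (goesTo h r) (goesTo h r) (flat ∷_) (λ _ → refl) S)
               (trans (filter-++ P? (map (down ∷_) S) []) (trans (Data.List.Properties.++-identityʳ _) (descend h))))) ⟩
    map (up ∷_) (pathsFrom (suc h) k r) ++ (map (flat ∷_) (pathsFrom h k r) ++ map (down ∷_) (downward h k r)) ∎
    where
    open ≡-Reasoning
    S : List (List Step)
    S = allSeqs k
    P? : ∀ p → _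
    P? p = T? (goesTo h r p)
    descend : ∀ h → filter (λ p → T? (goesTo h r p)) (map (down ∷_) S) ≡ map (down ∷_) (downward h k r)
    descend zero    = filter-none (goesTo 0 r) (down ∷_) (λ _ → refl) S
    descend (suc h) = filter-map (goesTo (suc h) r) (goesTo h r) (down ∷_) (λ _ → refl) S

  count : ℕ → ℕ → ℕ → ℕ
  count h k r = length (pathsFrom h k r)

  -- Counts with the initial height, the final height or both lowered by one. The value 0 at the
  -- boundary expresses that there is no height below 0; the corresponding weights are 1.
  countDown countBelow countDownBelow : ℕ → ℕ → ℕ → ℕ
  countDown zero    k r = 0
  countDown (suc h) k r = count h k r
  countBelow h k zero    = 0
  countBelow h k (suc r) = count h k r
  countDownBelow zero    k r = 0
  countDownBelow (suc h) k r = countBelow h k r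

  length-downward : ∀ h k r → length (downward h k r) ≡ countDown h k r
  length-downward zero    k r = refl
  length-downward (suc h) k r = refl

  count-first : ∀ h k r → count h (suc k) r ≡ count (suc h) k r ℕ.+ (count h k r ℕ.+ countDown h k r)
  count-first h k r rewrite pathsFrom-suc h k r
    | length-++ (map (up ∷_) (pathsFrom (suc h) k r)) {map (flat ∷_) (pathsFrom h k r) ++ map (down ∷_) (downward h k r)}
    | length-++ (map (flat ∷_) (pathsFrom h k r)) {map (down ∷_) (downward h k r)}
    | length-map (up ∷_) (pathsFrom (suc h) k r) | length-map (flat ∷_) (pathsFrom h k r) | length-map (down ∷_) (downward h k r)
    | length-downward h k r
    = refl

  count-empty : ∀ h r → count h 0 r ≡ ⌊ h ≡ᵇ r ⌋
  count-empty h r with h ≡ᵇ r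
  ... | true  = refl
  ... | false = refl

  count-base : ∀ h r → h ≢ r → count h 0 r ≡ 0
  count-base h r h≢r = trans (count-empty h r) (cong ⌊_⌋ (≡ᵇ-≢ h≢r))

  count-zero : ∀ h k r → h ℕ.+ k < r → count h k r ≡ 0
  count-zero h zero    r h<r = count-base h r (<⇒≢ (subst (_< r) (+-identityʳ h) h<r))
  count-zero h (suc k) r h<r = trans (count-first h k r) (cong₂ ℕ._+_ (count-zero (suc h) k r (subst (_< r) (+-suc h k) h<r))
    (cong₂ ℕ._+_ (count-zero h k r (≤-<-trans (+-monoʳ-≤ h (n≤1+n k)) h<r)) (descend h h<r)))
    where
    descend : ∀ h → h ℕ.+ suc k < r → countDown h k r ≡ 0
    descend zero    _   = refl
    descend (suc h) h<r = count-zero h k r (≤-<-trans (≤-trans (n≤1+n _) (+-monoʳ-≤ (suc h) (n≤1+n k))) h<r)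

  countBelow-first : ∀ h k r → countBelow h (suc k) r ≡ countBelow (suc h) k r ℕ.+ (countBelow h k r ℕ.+ countDownBelow h k r)
  countBelow-first zero    k zero    = refl
  countBelow-first (suc h) k zero    = refl
  countBelow-first zero    k (suc r) = count-first zero k r
  countBelow-first (suc h) k (suc r) = count-first (suc h) k r

  mutual
    -- Words are lists, so only the decomposition by the first step is immediate. The one by the
    -- last step follows by induction, because removing a step at the front commutes with removing
    -- one at the back.
    count-last : ∀ h k r → count h (suc k) r ≡ countBelow h k r ℕ.+ (count h k r ℕ.+ count h k (suc r))
    count-last h zero r = trans (count-first h 0 r) (cong₂ (λ a b → a ℕ.+ (count h 0 r ℕ.+ b)) (below r) (above h))
      where
      below : ∀ r → count (suc h) 0 r ≡ countBelow h 0 r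
      below zero    = refl
      below (suc r) = trans (count-empty (suc h) (suc r)) (sym (count-empty h r))
      above : ∀ h → countDown h 0 r ≡ count h 0 (suc r)
      above zero    = refl
      above (suc h) = trans (count-empty h r) (sym (count-empty (suc h) (suc r)))
    count-last h (suc k) r
      rewrite count-first h (suc k) r | countDown-last h k r | count-last (suc h) k r
            | countBelow-first h k r | count-first h k (suc r)
      = trans (cong (λ t → countBelow (suc h) k r ℕ.+ (count (suc h) k r ℕ.+ count (suc h) k (suc r)) ℕ.+
                 (t ℕ.+ (countDownBelow h k r ℕ.+ (countDown h k r ℕ.+ countDown h k (suc r))))) (count-last h k r))
          (trans (shuffle (countBelow (suc h) k r) (count (suc h) k r) (count (suc h) k (suc r))
            (countBelow h k r) (count h k r) (count h k (suc r)) (countDownBelow h k r) (countDown h k r) (countDown h k (suc r)))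
          (cong (λ t → countBelow (suc h) k r ℕ.+ (countBelow h k r ℕ.+ countDownBelow h k r) ℕ.+
            (t ℕ.+ (count (suc h) k (suc r) ℕ.+ (count h k (suc r) ℕ.+ countDown h k (suc r))))) (sym (count-first h k r))))
      where
      shuffle : ∀ b₁ c₁ d₁ b c d b₀ c₀ d₀ →
        (b₁ ℕ.+ (c₁ ℕ.+ d₁)) ℕ.+ ((b ℕ.+ (c ℕ.+ d)) ℕ.+ (b₀ ℕ.+ (c₀ ℕ.+ d₀)))
        ≡ (b₁ ℕ.+ (b ℕ.+ b₀)) ℕ.+ ((c₁ ℕ.+ (c ℕ.+ c₀)) ℕ.+ (d₁ ℕ.+ (d ℕ.+ d₀)))
      shuffle = solveℕ

    countDown-last : ∀ h k r → countDown h (suc k) r ≡ countDownBelow h k r ℕ.+ (countDown h k r ℕ.+ countDown h k (suc r))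
    countDown-last zero    k r = refl
    countDown-last (suc h) k r = count-last h k r

  module Weights (ρ : ℕ → ℚ) where

    weight : ℕ → ℕ → ℕ → ℚ
    weight h k r = productOver (pathWeight ρ h) (pathsFrom h k r)

    weightDown powDown weightBelow weightDownBelow powDownBelow : ℕ → ℕ → ℕ → ℚ
    weightDown zero    k r = 1ℚ
    weightDown (suc h) k r = weight h k r
    powDown zero    k r = 1ℚ
    powDown (suc h) k r = pow (ρ h) (count h k r)
    weightBelow h k zero    = 1ℚ
    weightBelow h k (suc r) = weight h k r
    weightDownBelow zero    k r = 1ℚ
    weightDownBelow (suc h) k r = weightBelow h k r
    powDownBelow zero    k r = 1ℚ
    powDownBelow (suc h) k r = pow (ρ h) (countBelow h k r)

    weight-first : ∀ h k r → weight h (suc k) r ≡ weight (suc h) k r * (weight h k r * (powDown h k r * weightDown h k r))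
    weight-first h k r = begin
      productOver f (pathsFrom h (suc k) r)
        ≡⟨ cong (productOver f) (pathsFrom-suc h k r) ⟩
      productOver f (map (up ∷_) U ++ (map (flat ∷_) M ++ map (down ∷_) (downward h k r)))
        ≡⟨ productOver-++ f (map (up ∷_) U) _ ⟩
      productOver f (map (up ∷_) U) * productOver f (map (flat ∷_) M ++ map (down ∷_) (downward h k r))
        ≡⟨ cong₂ _*_ (productOver-map f (up ∷_) U) (trans (productOver-++ f (map (flat ∷_) M) _)
             (cong₂ _*_ (productOver-map f (flat ∷_) M) (descend h))) ⟩
      weight (suc h) k r * (weight h k r * (powDown h k r * weightDown h k r)) ∎
      where
      open ≡-Reasoning
      f : List Step → ℚ
      f = pathWeight ρ h
      U M : List (List Step)
      U = pathsFrom (suc h) k r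
      M = pathsFrom h k r
      descend : ∀ h → productOver (pathWeight ρ h) (map (down ∷_) (downward h k r)) ≡ powDown h k r * weightDown h k r
      descend zero    = refl
      descend (suc h) = trans (productOver-map (pathWeight ρ (suc h)) (down ∷_) (pathsFrom h k r))
                              (productOver-scaled (ρ h) (pathWeight ρ h) (pathsFrom h k r))

    weightBelow-first : ∀ h k r → weightBelow h (suc k) r ≡
      weightBelow (suc h) k r * (weightBelow h k r * (powDownBelow h k r * weightDownBelow h k r))
    weightBelow-first zero    k zero    = refl
    weightBelow-first (suc h) k zero    = refl
    weightBelow-first zero    k (suc r) = weight-first zero k r
    weightBelow-first (suc h) k (suc r) = weight-first (suc h) k r

    weight-base : ∀ h r → weight h 0 r ≡ 1ℚ
    weight-base h r with h ≡ᵇ r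
    ... | true  = refl
    ... | false = refl

    powDown-last : ∀ h k r → powDown h (suc k) r ≡ powDownBelow h k r * (powDown h k r * powDown h k (suc r))
    powDown-last zero    k r = refl
    powDown-last (suc h) k r = trans (cong (pow (ρ h)) (count-last h k r))
      (trans (sym (pow-+ (ρ h) (countBelow h k r) _)) (cong (pow (ρ h) (countBelow h k r) *_) (sym (pow-+ (ρ h) (count h k r) _))))

    mutual
      -- A last step down from r + 1 to r contributes an extra ρ_r for every path that ends at r +
      -- 1, whence the power. The induction is that of `count-last`.
      weight-last : ∀ h k r → weight h (suc k) r ≡
        weightBelow h k r * (weight h k r * (weight h k (suc r) * pow (ρ r) (count h k (suc r))))
      weight-last h zero r = begin
        weight h 1 r
          ≡⟨ weight-first h 0 r ⟩
        weight (suc h) 0 r * (weight h 0 r * (powDown h 0 r * weightDown h 0 r))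
          ≡⟨ cong₂ _*_ (weight-base (suc h) r) (cong₂ _*_ (weight-base h r) (cong₂ _*_ (powers h) (weightDown-base h))) ⟩
        1ℚ * (1ℚ * (pow (ρ r) (count h 0 (suc r)) * 1ℚ))
          ≡⟨ cong (λ t → 1ℚ * (1ℚ * t)) (*-comm (pow (ρ r) (count h 0 (suc r))) 1ℚ) ⟩
        1ℚ * (1ℚ * (1ℚ * pow (ρ r) (count h 0 (suc r))))
          ≡⟨ cong₂ _*_ (weightBelow-base r) (cong₂ _*_ (weight-base h r) (cong (_* pow (ρ r) (count h 0 (suc r))) (weight-base h (suc r)))) ⟨
        weightBelow h 0 r * (weight h 0 r * (weight h 0 (suc r) * pow (ρ r) (count h 0 (suc r)))) ∎
        where
        open ≡-Reasoning
        powers : ∀ h → powDown h 0 r ≡ pow (ρ r) (count h 0 (suc r))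
        powers zero    = refl
        powers (suc h) with h ≟ r
        ... | yes refl = cong (pow (ρ h)) (trans (count-empty h h) (sym (count-empty (suc h) (suc h))))
        ... | no h≢r = trans (cong (pow (ρ h)) (count-base h r h≢r))
                             (cong (pow (ρ r)) (sym (count-base (suc h) (suc r) (h≢r ∘ suc-injective))))
        weightDown-base : ∀ h → weightDown h 0 r ≡ 1ℚ
        weightDown-base zero    = refl
        weightDown-base (suc h) = weight-base h r
        weightBelow-base : ∀ r → weightBelow h 0 r ≡ 1ℚ
        weightBelow-base zero    = refl
        weightBelow-base (suc r) = weight-base h r
      weight-last h (suc k) r = begin
        weight h (suc (suc k)) r
          ≡⟨ weight-first h (suc k) r ⟩
        weight (suc h) (suc k) r * (weight h (suc k) r * (powDown h (suc k) r * weightDown h (suc k) r))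
          ≡⟨ cong₂ _*_ (weight-last (suc h) k r) (cong₂ _*_ (weight-last h k r) (cong₂ _*_ (powDown-last h k r) (weightDown-last h k r))) ⟩
        (wb₁ * (w₁ * (v₁ * p₁))) * ((wb * (w * (v * p))) * ((qb * (q * q′)) * (wb₀ * (w₀ * (v₀ * p₀)))))
          ≡⟨ shuffle wb₁ w₁ v₁ p₁ wb w v p qb q q′ wb₀ w₀ v₀ p₀ ⟩
        (wb₁ * (wb * (qb * wb₀))) * ((w₁ * (w * (q * w₀))) * ((v₁ * (v * (q′ * v₀))) * (p₁ * (p * p₀))))
          ≡⟨ cong₂ _*_ (sym (weightBelow-first h k r)) (cong₂ _*_ (sym (weight-first h k r)) (cong₂ _*_ (sym (weight-first h k (suc r))) powers)) ⟩
        weightBelow h (suc k) r * (weight h (suc k) r * (weight h (suc k) (suc r) * pow (ρ r) (count h (suc k) (suc r)))) ∎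
        where
        open ≡-Reasoning
        wb₁ w₁ v₁ p₁ wb w v p qb q q′ wb₀ w₀ v₀ p₀ : ℚ
        wb₁ = weightBelow (suc h) k r
        w₁ = weight (suc h) k r
        v₁ = weight (suc h) k (suc r)
        p₁ = pow (ρ r) (count (suc h) k (suc r))
        wb = weightBelow h k r
        w = weight h k r
        v = weight h k (suc r)
        p = pow (ρ r) (count h k (suc r))
        qb = powDownBelow h k r
        q = powDown h k r
        q′ = powDown h k (suc r)
        wb₀ = weightDownBelow h k r
        w₀ = weightDown h k r
        v₀ = weightDown h k (suc r)
        p₀ = pow (ρ r) (countDown h k (suc r))
        powers : p₁ * (p * p₀) ≡ pow (ρ r) (count h (suc k) (suc r))
        powers = trans (cong (p₁ *_) (pow-+ (ρ r) (count h k (suc r)) _))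
          (trans (pow-+ (ρ r) (count (suc h) k (suc r)) _) (cong (pow (ρ r)) (sym (count-first h k (suc r)))))
        shuffle : ∀ wb₁ w₁ v₁ p₁ wb w v p qb q q′ wb₀ w₀ v₀ p₀ →
          (wb₁ * (w₁ * (v₁ * p₁))) * ((wb * (w * (v * p))) * ((qb * (q * q′)) * (wb₀ * (w₀ * (v₀ * p₀)))))
          ≡ (wb₁ * (wb * (qb * wb₀))) * ((w₁ * (w * (q * w₀))) * ((v₁ * (v * (q′ * v₀))) * (p₁ * (p * p₀))))
        shuffle = solve-∀ ring

      weightDown-last : ∀ h k r → weightDown h (suc k) r ≡
        weightDownBelow h k r * (weightDown h k r * (weightDown h k (suc r) * pow (ρ r) (countDown h k (suc r))))
      weightDown-last zero    k r = refl
      weightDown-last (suc h) k r = weight-last h k r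

  ∏-* : ∀ n (f g : ℕ → ℚ) → ∏ n (λ i → f i * g i) ≡ ∏ n f * ∏ n g
  ∏-* zero    f g = refl
  ∏-* (suc n) f g = trans (cong (f 0 * g 0 *_) (∏-* n (f ∘ suc) (g ∘ suc))) (shuffle (f 0) (g 0) _ _)
    where
    shuffle : ∀ a b c d → (a * b) * (c * d) ≡ (a * c) * (b * d)
    shuffle = solve-∀ ring

  ∏-one : ∀ n {f : ℕ → ℚ} → (∀ i → f i ≡ 1ℚ) → ∏ n f ≡ 1ℚ
  ∏-one zero    e = refl
  ∏-one (suc n) e = trans (cong₂ _*_ (e 0) (∏-one n (e ∘ suc))) (*-identityˡ 1ℚ)

  ∏-shift : ∀ n (f : ℕ → ℚ) → f n ≡ 1ℚ → f 0 * ∏ n (f ∘ suc) ≡ ∏ n f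
  ∏-shift zero    f e = trans (*-identityʳ (f 0)) e
  ∏-shift (suc n) f e = cong (f 0 *_) (∏-shift n (f ∘ suc) e)

  -- The closed form in terms of Chebyshev values.

  module ClosedForm (ρ u : ℕ → ℚ) (ratio : ∀ j → u (suc j) ≡ ρ j * u j) where
    open Weights ρ

    m : ℕ → ℕ → ℕ
    m = count 0

    numerator denominator : ℕ → ℕ → ℕ → ℚ
    numerator   k r N = ∏ N (λ i → pow (u (suc i ℕ.+ r)) (m k (r ℕ.+ 2 ℕ.* suc i)))
    denominator k r N = ∏ N (λ i → pow (u i) (m k (r ℕ.+ 2 ℕ.* suc i)))

    private
      twice-suc : ∀ r i → r ℕ.+ 2 ℕ.* suc i ≡ suc (suc (r ℕ.+ 2 ℕ.* i))
      twice-suc = solveℕ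

      odd : ℕ → ℕ → ℕ → ℕ
      odd k r i = m k (suc (r ℕ.+ 2 ℕ.* i))

      odd-pred : ∀ k r i → m k (r ℕ.+ 2 ℕ.* suc i) ≡ odd k (suc r) i
      odd-pred k r i = cong (m k) (twice-suc r i)

      split : ∀ k r i → m (suc k) (r ℕ.+ 2 ℕ.* suc i) ≡ odd k r i ℕ.+ (m k (r ℕ.+ 2 ℕ.* suc i) ℕ.+ odd k r (suc i))
      split k r i = trans (count-last 0 k (r ℕ.+ 2 ℕ.* suc i))
        (cong (λ t → t ℕ.+ (m k (r ℕ.+ 2 ℕ.* suc i) ℕ.+ odd k r (suc i))) (below (twice-suc r i)))
        where
        below : ∀ {t} → t ≡ suc (suc (r ℕ.+ 2 ℕ.* i)) → countBelow 0 k t ≡ odd k r i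
        below refl = refl

      pow-split : ∀ a k r i → pow a (m (suc k) (r ℕ.+ 2 ℕ.* suc i))
        ≡ pow a (odd k r i) * (pow a (m k (r ℕ.+ 2 ℕ.* suc i)) * pow a (odd k r (suc i)))
      pow-split a k r i = trans (cong (pow a) (split k r i)) (trans (sym (pow-+ a (odd k r i) _))
        (cong (pow a (odd k r i) *_) (sym (pow-+ a (m k (r ℕ.+ 2 ℕ.* suc i)) _))))

      ∏-split : ∀ N (v : ℕ → ℚ) k r → ∏ N (λ i → pow (v i) (m (suc k) (r ℕ.+ 2 ℕ.* suc i)))
        ≡ ∏ N (λ i → pow (v i) (odd k r i)) * (∏ N (λ i → pow (v i) (m k (r ℕ.+ 2 ℕ.* suc i))) * ∏ N (λ i → pow (v i) (odd k r (suc i))))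
      ∏-split N v k r = trans (∏-cong N (λ i _ → pow-split (v i) k r i))
        (trans (∏-* N _ _) (cong (∏ N (λ i → pow (v i) (odd k r i)) *_) (∏-* N _ _)))

      pow-* : ∀ a b n → pow a n * pow b n ≡ pow (a * b) n
      pow-* a b zero    = refl
      pow-* a b (suc n) = trans (shuffle a b (pow a n) (pow b n)) (cong (a * b *_) (pow-* a b n))
        where
        shuffle : ∀ a b c d → (a * c) * (b * d) ≡ (a * b) * (c * d)
        shuffle = solve-∀ ring

    -- The number `N` of factors is only bounded below, since the induction compares ranks r - 1, r
    -- and r + 1 with the same `N`; surplus factors have exponent 0. In the recursion the ranks r -
    -- 1 and r + 1 bring the exponents `odd k r i`, shifted against each other by one place.
    closed-form : ∀ k r N → k ≤ suc (r ℕ.+ 2 ℕ.* N) → weight 0 k r * denominator k r N ≡ numerator k r N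
    closed-form zero r N bound = begin
      weight 0 0 r * denominator 0 r N  ≡⟨ cong₂ _*_ (weight-base 0 r) (trivial u) ⟩
      1ℚ * 1ℚ                           ≡⟨⟩
      1ℚ                                ≡⟨ trivial (λ i → u (suc i ℕ.+ r)) ⟨
      numerator 0 r N                   ∎
      where
      open ≡-Reasoning
      trivial : ∀ (v : ℕ → ℚ) → ∏ N (λ i → pow (v i) (m 0 (r ℕ.+ 2 ℕ.* suc i))) ≡ 1ℚ
      trivial v = ∏-one N (λ i → cong (pow (v i)) (count-base 0 (r ℕ.+ 2 ℕ.* suc i) (λ eq → 0≢1+n (trans eq (twice-suc r i)))))
    closed-form (suc k) r N (s≤s bound) = begin
      weight 0 (suc k) r * denominator (suc k) r N
        ≡⟨ cong₂ _*_ (weight-last 0 k r) (∏-split N u k r) ⟩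
      (weightBelow 0 k r * (weight 0 k r * (weight 0 k (suc r) * c))) * (dB * (denominator k r N * denominator k (suc r) N))
        ≡⟨ regroup (weightBelow 0 k r) (weight 0 k r) (weight 0 k (suc r)) c dB (denominator k r N) (denominator k (suc r) N) ⟩
      (weightBelow 0 k r * dB) * ((weight 0 k r * denominator k r N) * ((weight 0 k (suc r) * denominator k (suc r) N) * c))
        ≡⟨ cong₂ _*_ (belowForm r bound) (cong₂ _*_ (closed-form k r N (≤-trans bound (n≤1+n _)))
             (cong (_* c) (closed-form k (suc r) N (≤-trans bound (≤-trans (n≤1+n _) (n≤1+n _)))))) ⟩
      ∏ N X * (numerator k r N * (numerator k (suc r) N * c))
        ≡⟨ cong₂ (λ s t → s * (numerator k r N * (t * c))) (sym (∏-shift N X X-end)) above ⟩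
      (X 0 * ∏ N (X ∘ suc)) * (numerator k r N * (∏ N (Y ∘ suc) * c))
        ≡⟨ regroup′ (X 0) (∏ N (X ∘ suc)) (numerator k r N) (∏ N (Y ∘ suc)) c ⟩
      ((c * X 0) * ∏ N (Y ∘ suc)) * (numerator k r N * ∏ N (X ∘ suc))
        -- The last down steps supply what the shifted product lacks at index 0, because ρ_r u_r =
        -- u_{r+1}.
        ≡⟨ cong (λ t → (t * ∏ N (Y ∘ suc)) * (numerator k r N * ∏ N (X ∘ suc))) first ⟩
      (Y 0 * ∏ N (Y ∘ suc)) * (numerator k r N * ∏ N (X ∘ suc))
        ≡⟨ cong (_* (numerator k r N * ∏ N (X ∘ suc))) (∏-shift N Y Y-end) ⟩
      ∏ N Y * (numerator k r N * ∏ N (X ∘ suc))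
        ≡⟨ ∏-split N (λ i → u (suc i ℕ.+ r)) k r ⟨
      numerator (suc k) r N ∎
      where
      open ≡-Reasoning
      c dB : ℚ
      c = pow (ρ r) (m k (suc r))
      dB = ∏ N (λ i → pow (u i) (odd k r i))
      X Y : ℕ → ℚ
      X i = pow (u (i ℕ.+ r)) (odd k r i)
      Y i = pow (u (suc i ℕ.+ r)) (odd k r i)

      odd-end : odd k r N ≡ 0
      odd-end = count-zero 0 k _ (s≤s bound)
      X-end : X N ≡ 1ℚ
      X-end = cong (pow (u (N ℕ.+ r))) odd-end
      Y-end : Y N ≡ 1ℚ
      Y-end = cong (pow (u (suc N ℕ.+ r))) odd-end

      above : numerator k (suc r) N ≡ ∏ N (Y ∘ suc)
      above = ∏-cong N (λ i _ → cong (λ j → pow (u (suc j)) (odd k r (suc i))) (+-suc i r))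

      first : c * X 0 ≡ Y 0
      first = trans (cong (λ t → pow (ρ r) (m k (suc t)) * X 0) (sym (+-identityʳ r)))
        (trans (pow-* (ρ r) (u r) (odd k r 0)) (cong (λ t → pow t (odd k r 0)) (sym (ratio r))))

      -- For r = 0 there is no lower rank, and both products have base u_i. Otherwise this is the
      -- closed form at rank r - 1, whose exponents agree since (r - 1) + 2(i + 1) = r + 2i + 1.
      belowForm : ∀ r → k ≤ r ℕ.+ 2 ℕ.* N →
        weightBelow 0 k r * ∏ N (λ i → pow (u i) (odd k r i)) ≡ ∏ N (λ i → pow (u (i ℕ.+ r)) (odd k r i))
      belowForm zero    bound = trans (*-identityˡ _) (∏-cong N (λ i _ → cong (λ j → pow (u j) (odd k 0 i)) (sym (+-identityʳ i))))
      belowForm (suc r) bound = begin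
        weight 0 k r * ∏ N (λ i → pow (u i) (odd k (suc r) i))
          ≡⟨ cong (weight 0 k r *_) (∏-cong N (λ i _ → cong (pow (u i)) (odd-pred k r i))) ⟨
        weight 0 k r * denominator k r N
          ≡⟨ closed-form k r N bound ⟩
        numerator k r N
          ≡⟨ ∏-cong N (λ i _ → cong₂ (λ j e → pow (u j) e) (sym (+-suc i r)) (odd-pred k r i)) ⟩
        ∏ N (λ i → pow (u (i ℕ.+ suc r)) (odd k (suc r) i)) ∎

      regroup : ∀ a b e c d f g → (a * (b * (e * c))) * (d * (f * g)) ≡ (a * d) * ((b * f) * ((e * g) * c))
      regroup = solve-∀ ring
      regroup′ : ∀ a b n y c → (a * b) * (n * (y * c)) ≡ ((c * a) * y) * (n * b)
      regroup′ = solve-∀ ring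

-- Evaluation of polynomials at rational numbers, and the Chebyshev weights.

module Evaluation where
  open Determinant
  open Forests
  open StateSum using (gramValue)
  open Factorisation
  open ProductFormula using (productOver-nthP; module Weights; module ClosedForm)
  open import Data.Integer as ℤ using (ℤ; ∣_∣)
  import Data.Integer.Properties as ℤ
  open import Data.Integer.Tactic.RingSolver using () renaming (solve-∀ to solveℤ)
  open import Data.List.Properties using (map-applyUpTo; applyUpTo-∷ʳ)
  open import Data.Nat using (_<ᵇ_; ⌊_/2⌋)
  import Data.Nat.Properties as ℕ
  open import Data.Nat.Coprimality using (1-coprimeTo) renaming (sym to coprime-sym)
  open import Data.Rational using (ℚ; mkℚ; _+_; _*_; -_; 0ℚ; 1ℚ; 1/_; ↥_)
  open import Data.Rational.Properties using (toℚᵘ-injective; toℚᵘ-homo-+; toℚᵘ-homo-*; toℚᵘ-homo‿-; *-inverseʳ;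
    *-identityˡ; *-identityʳ; *-zeroʳ; *-zeroˡ; +-identityʳ; +-identityˡ; *-comm)
  import Data.Rational.Unnormalised as ℚᵘ
  import Data.Rational.Unnormalised.Properties as ℚᵘ
  open Loops using (<ᵇ-true; <ᵇ-false)

  -- Built directly as a fraction with denominator 1 (the record stores its predecessor 0), so that
  -- injectivity is read off the numerator.
  ι : ℤ → ℚ
  ι n = mkℚ n 0 (coprime-sym (1-coprimeTo ∣ n ∣))

  ι-injective : ∀ {m n} → ι m ≡ ι n → m ≡ n
  ι-injective = cong ↥_

  ι-+ : ∀ m n → ι (m ℤ.+ n) ≡ ι m + ι n
  ι-+ m n = toℚᵘ-injective (ℚᵘ.≃-trans (ℚᵘ.*≡* (eq m n)) (ℚᵘ.≃-sym (toℚᵘ-homo-+ (ι m) (ι n))))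
    where
    eq : ∀ m n → (m ℤ.+ n) ℤ.* ℤ.1ℤ ≡ (m ℤ.* ℤ.1ℤ ℤ.+ n ℤ.* ℤ.1ℤ) ℤ.* ℤ.1ℤ
    eq = solveℤ

  ι-* : ∀ m n → ι (m ℤ.* n) ≡ ι m * ι n
  ι-* m n = toℚᵘ-injective (ℚᵘ.≃-trans (ℚᵘ.*≡* refl) (ℚᵘ.≃-sym (toℚᵘ-homo-* (ι m) (ι n))))

  ι-neg : ∀ m → ι (ℤ.- m) ≡ - ι m
  ι-neg m = toℚᵘ-injective (ℚᵘ.≃-trans (ℚᵘ.*≡* refl) (ℚᵘ.≃-sym (toℚᵘ-homo‿- (ι m))))

  half-bound : ∀ n → n ≤ suc (2 ℕ.* ⌊ n /2⌋)
  half-bound zero          = z≤n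
  half-bound (suc zero)    = s≤s z≤n
  half-bound (suc (suc n)) = ℕ.≤-trans (s≤s (s≤s (half-bound n))) (ℕ.≤-reflexive (cong suc (sym (double-suc ⌊ n /2⌋))))
    where
    double-suc : ∀ n → 2 ℕ.* suc n ≡ suc (suc (2 ℕ.* n))
    double-suc n = cong suc (ℕ.+-suc n (n ℕ.+ 0))

  module At (x : ℚ) where

    ev : Poly → ℚ
    ev []      = 0ℚ
    ev (a ∷ p) = ι a + x * ev p

    ev-+ : ∀ p q → ev (p +P q) ≡ ev p + ev q
    ev-+ []      q       = sym (+-identityˡ _)
    ev-+ (a ∷ p) []      = sym (+-identityʳ _)
    ev-+ (a ∷ p) (b ∷ q) = trans (cong₂ (λ s t → s + x * t) (ι-+ a b) (ev-+ p q)) (shuffle (ι a) (ι b) x (ev p) (ev q))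
      where
      shuffle : ∀ a b x p q → (a + b) + x * (p + q) ≡ (a + x * p) + (b + x * q)
      shuffle = solve-∀ ring

    ev-neg : ∀ p → ev (negP p) ≡ - ev p
    ev-neg []      = refl
    ev-neg (a ∷ p) = trans (cong₂ (λ s t → s + x * t) (ι-neg a) (ev-neg p)) (shuffle (ι a) x (ev p))
      where
      shuffle : ∀ a x p → - a + x * (- p) ≡ - (a + x * p)
      shuffle = solve-∀ ring

    ev-scale : ∀ a p → ev (map (a ℤ.*_) p) ≡ ι a * ev p
    ev-scale a []      = sym (*-zeroʳ (ι a))
    ev-scale a (b ∷ p) = trans (cong₂ (λ s t → s + x * t) (ι-* a b) (ev-scale a p)) (shuffle (ι a) (ι b) x (ev p))
      where
      shuffle : ∀ a b x p → a * b + x * (a * p) ≡ a * (b + x * p)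
      shuffle = solve-∀ ring

    ev-* : ∀ p q → ev (p *P q) ≡ ev p * ev q
    ev-* []      q = sym (*-zeroˡ (ev q))
    ev-* (a ∷ p) q = trans (ev-+ (map (a ℤ.*_) q) (ℤ.0ℤ ∷ (p *P q)))
      (trans (cong₂ (λ s t → s + (0ℚ + x * t)) (ev-scale a q) (ev-* p q)) (shuffle (ι a) x (ev p) (ev q)))
      where
      shuffle : ∀ a x p q → a * q + (0ℚ + x * (p * q)) ≡ (a + x * p) * q
      shuffle = solve-∀ ring

    ev-one : ev oneP ≡ 1ℚ
    ev-one = trans (cong (1ℚ +_) (*-zeroʳ x)) (+-identityʳ 1ℚ)

    ev-xPow : ∀ n → ev (xPow n) ≡ pow x n
    ev-xPow zero    = ev-one
    ev-xPow (suc n) = trans (+-identityˡ _) (cong (x *_) (ev-xPow n))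

    ev-powP : ∀ p n → ev (powP p n) ≡ pow (ev p) n
    ev-powP p zero    = ev-one
    ev-powP p (suc n) = trans (ev-* p (powP p n)) (cong (ev p *_) (ev-powP p n))

    sign : ℕ → ℚ
    sign zero    = 1ℚ
    sign (suc j) = - sign j

    ev-altSign : ∀ j p → ev (altSign j p) ≡ sign j * ev p
    ev-altSign zero    p = sym (*-identityˡ _)
    ev-altSign (suc j) p = trans (ev-neg (altSign j p)) (trans (cong -_ (ev-altSign j p)) (shuffle (sign j) (ev p)))
      where
      shuffle : ∀ a b → - (a * b) ≡ (- a) * b
      shuffle = solve-∀ ring

    ev-sumP : ∀ n (F : ℕ → Poly) → ev (sumP (applyUpTo F n)) ≡ ∑ n (ev ∘ F)
    ev-sumP zero    F = refl
    ev-sumP (suc n) F = trans (ev-+ (F 0) _) (cong (ev (F 0) +_) (ev-sumP n (F ∘ suc)))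

    skip : ℕ → ℕ → ℕ
    skip j b = if b <ᵇ j then b else suc b

    applyUpTo-cong : ∀ {A : Set} n {f g : ℕ → A} → (∀ i → f i ≡ g i) → applyUpTo f n ≡ applyUpTo g n
    applyUpTo-cong zero    e = refl
    applyUpTo-cong (suc n) e = cong₂ _∷_ (e 0) (applyUpTo-cong n (e ∘ suc))

    applyUpTo-++ : ∀ {A : Set} t s {f g h : ℕ → A} → (∀ i → i < t → f i ≡ h i) → (∀ i → g i ≡ h (t ℕ.+ i)) →
      applyUpTo f t ++ applyUpTo g s ≡ applyUpTo h (t ℕ.+ s)
    applyUpTo-++ zero    s ef eg = applyUpTo-cong s eg
    applyUpTo-++ (suc t) s ef eg = cong₂ _∷_ (ef 0 (s≤s z≤n)) (applyUpTo-++ t s (λ i i<t → ef (suc i) (s≤s i<t)) eg)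

    minorColumns : ℕ → (ℕ → Column) → ℕ → List Column
    minorColumns n g j = applyUpTo (λ b → tail (g (skip j b))) n

    -- Reconciles the expansion along a list with the one by column indices, from column `t` on. The
    -- sign restarts at 1 there, because `expand` produces alternation by nested negations.
    expand-minors : ∀ n (g : ℕ → Column) t s → t ℕ.+ s ≡ suc n →
      expand n (applyUpTo (tail ∘ g) t) (applyUpTo (λ i → g (t ℕ.+ i)) s)
      ≡ ∑ s (λ i → sign i * (g (t ℕ.+ i) 0 * detC n (minorColumns n g (t ℕ.+ i))))
    expand-minors n g t zero    eq = refl
    expand-minors n g t (suc s) eq = begin
      g (t ℕ.+ 0) 0 * detC n (ps ++ map tail vs) + - expand n (ps ++ tail (g (t ℕ.+ 0)) ∷ []) vs
        ≡⟨ cong₂ (λ l e → g (t ℕ.+ 0) 0 * detC n l + - e) columns rest ⟩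
      g (t ℕ.+ 0) 0 * detC n (minorColumns n g (t ℕ.+ 0)) + - ∑ s (λ i → sign i * D (suc t ℕ.+ i))
        ≡⟨ cong₂ _+_ (sym (*-identityˡ (D (t ℕ.+ 0)))) (trans (neg-∑ s (λ i → sign i * D (suc t ℕ.+ i))) (∑-cong s (λ i _ →
             trans (shuffle (sign i) (D (suc t ℕ.+ i))) (cong (λ j → - sign i * D j) (sym (ℕ.+-suc t i)))))) ⟩
      1ℚ * D (t ℕ.+ 0) + ∑ s (λ i → - sign i * D (t ℕ.+ suc i)) ∎
      where
      open ≡-Reasoning
      ps vs : List Column
      ps = applyUpTo (tail ∘ g) t
      vs = applyUpTo (λ i → g (t ℕ.+ suc i)) s
      D : ℕ → ℚ
      D j = g j 0 * detC n (minorColumns n g j)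
      n≡ : n ≡ t ℕ.+ s
      n≡ = ℕ.suc-injective (trans (sym eq) (ℕ.+-suc t s))
      shuffle : ∀ a b → - (a * b) ≡ - a * b
      shuffle = solve-∀ ring
      neg-+ : ∀ a b → - (a + b) ≡ - a + - b
      neg-+ = solve-∀ ring
      neg-∑ : ∀ n f → - ∑ n f ≡ ∑ n (λ i → - f i)
      neg-∑ zero    f = refl
      neg-∑ (suc n) f = trans (neg-+ (f 0) _) (cong (- f 0 +_) (neg-∑ n (f ∘ suc)))
      columns : ps ++ map tail vs ≡ minorColumns n g (t ℕ.+ 0)
      columns = trans (cong (ps ++_) (map-applyUpTo (λ i → g (t ℕ.+ suc i)) tail s))
        (trans (applyUpTo-++ t s
          (λ i i<t → cong (tail ∘ g) (sym (before i i<t)))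
          (λ i → cong (tail ∘ g) (trans (ℕ.+-suc t i) (sym (after i)))))
          (cong (λ m → applyUpTo (λ b → tail (g (skip (t ℕ.+ 0) b))) m) (sym n≡)))
        where
        before : ∀ i → i < t → skip (t ℕ.+ 0) i ≡ i
        before i i<t rewrite ℕ.+-identityʳ t | <ᵇ-true i<t = refl
        after : ∀ i → skip (t ℕ.+ 0) (t ℕ.+ i) ≡ suc (t ℕ.+ i)
        after i rewrite ℕ.+-identityʳ t | <ᵇ-false {t ℕ.+ i} {t} (ℕ.m≤m+n t i) = refl
      rest : expand n (ps ++ tail (g (t ℕ.+ 0)) ∷ []) vs ≡ ∑ s (λ i → sign i * D (suc t ℕ.+ i))
      rest = trans (cong₂ (expand n)
          (trans (cong (λ j → ps ++ tail (g j) ∷ []) (ℕ.+-identityʳ t)) (applyUpTo-∷ʳ (tail ∘ g) t))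
          (applyUpTo-cong s (λ i → cong g (ℕ.+-suc t i))))
        (expand-minors n g (suc t) s (trans (sym (ℕ.+-suc t s)) eq))

    ev-det : ∀ n M → ev (det n M) ≡ detC n (applyUpTo (λ j i → ev (M i j)) n)
    ev-det zero    M = ev-one
    ev-det (suc n) M = begin
      ev (sumP (map F (upTo (suc n))))
        ≡⟨ cong (ev ∘ sumP) (map-applyUpTo id F (suc n)) ⟩
      ev (sumP (applyUpTo F (suc n)))
        ≡⟨ ev-sumP (suc n) F ⟩
      ∑ (suc n) (ev ∘ F)
        ≡⟨ ∑-cong (suc n) (λ j _ → trans (ev-altSign j (M 0 j *P det n (minor j M))) (cong (sign j *_) (trans (ev-* (M 0 j) (det n (minor j M)))
             (cong (ev (M 0 j) *_) (ev-det n (minor j M)))))) ⟩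
      ∑ (suc n) (λ j → sign j * (g j 0 * detC n (minorColumns n g j)))
        ≡⟨ expand-minors n g 0 (suc n) refl ⟨
      expand n [] (applyUpTo g (suc n)) ∎
      where
      open ≡-Reasoning
      F : ℕ → Poly
      F j = altSign j (M 0 j *P det n (minor j M))
      g : ℕ → Column
      g j i = ev (M i j)

    ev-gramEntry : ∀ r p q → ev (gramEntry r p q) ≡ gramValue x r p q
    ev-gramEntry r p q with rankD (composeD (dpq p p) (dpq q q)) ℕ.≡ᵇ r
    ... | true  = ev-xPow (loops (dpq p p) (dpq q q))
    ... | false = refl

    powF-num : ∀ f n → num (powF f n) ≡ powP (num f) n
    powF-num f zero    = refl
    powF-num f (suc n) = cong (num f *P_) (powF-num f n)

    powF-den : ∀ f n → den (powF f n) ≡ powP (den f) n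
    powF-den f zero    = refl
    powF-den f (suc n) = cong (den f *P_) (powF-den f n)

    module _ (F : ℕ → Frac) where
      ev-num-prodF : ∀ n (g : ℕ → ℕ) → ev (num (prodF (map F (map suc (applyUpTo g n))))) ≡ ∏ n (λ i → ev (num (F (suc (g i)))))
      ev-num-prodF zero    g = ev-one
      ev-num-prodF (suc n) g = trans (ev-* (num (F (suc (g 0)))) _) (cong (ev (num (F (suc (g 0)))) *_) (ev-num-prodF n (g ∘ suc)))

      ev-den-prodF : ∀ n (g : ℕ → ℕ) → ev (den (prodF (map F (map suc (applyUpTo g n))))) ≡ ∏ n (λ i → ev (den (F (suc (g i)))))
      ev-den-prodF zero    g = ev-one
      ev-den-prodF (suc n) g = trans (ev-* (den (F (suc (g 0)))) _) (cong (ev (den (F (suc (g 0)))) *_) (ev-den-prodF n (g ∘ suc)))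

    u : ℕ → ℚ
    u j = ev (uAt j)

    y : ℚ
    y = x + - 1ℚ

    u-suc-suc : ∀ j → u (suc (suc j)) ≡ y * u (suc j) + - u j
    u-suc-suc j = trans (ev-+ (xMinus1 *P uAt (suc j)) (negP (uAt j)))
      (cong₂ _+_ (trans (ev-* xMinus1 (uAt (suc j))) (cong (_* u (suc j)) ev-xMinus1)) (ev-neg (uAt j)))
      where
      ev-xMinus1 : ev xMinus1 ≡ y
      ev-xMinus1 = normalise x
        where
        normalise : ∀ x → - 1ℚ + x * (1ℚ + x * 0ℚ) ≡ x + - 1ℚ
        normalise = solve-∀ ring

    u-one : u 1 ≡ y
    u-one = normalise x
      where
      normalise : ∀ x → - 1ℚ + x * (1ℚ + x * 0ℚ) ≡ x + - 1ℚ
      normalise = solve-∀ ring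

    module _ (u⁻ : ℕ → ℚ) (u-inverse : ∀ j → u j * u⁻ j ≡ 1ℚ) where

      ρ ρ⁻ : ℕ → ℚ
      ρ j = u (suc j) * u⁻ j
      ρ⁻ j = u j * u⁻ (suc j)

      ρ-ratio : ∀ j → u (suc j) ≡ ρ j * u j
      ρ-ratio j = trans (sym (*-identityʳ _)) (trans (cong (u (suc j) *_) (sym (u-inverse j))) (shuffle (u (suc j)) (u j) (u⁻ j)))
        where
        shuffle : ∀ a b c → a * (b * c) ≡ (a * c) * b
        shuffle = solve-∀ ring

      ρ-inverse : ∀ j → ρ j * ρ⁻ j ≡ 1ℚ
      ρ-inverse j = trans (shuffle (u (suc j)) (u⁻ j) (u j) (u⁻ (suc j))) (trans (cong₂ _*_ (u-inverse (suc j)) (u-inverse j)) (*-identityˡ 1ℚ))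
        where
        shuffle : ∀ a b c d → (a * b) * (c * d) ≡ (a * d) * (c * b)
        shuffle = solve-∀ ring

      -- Among the weights allowed by the zigzag relations, these put all of ρ on the rising arcs of
      -- the first word and leave 1 on those of the second. The value of `wQ` at a down step from 0
      -- is a default, as this step is not valid.
      wP wQ : Weight
      wP up   h       = ρ h
      wP flat h       = 1ℚ
      wP down h       = 1ℚ
      wQ up   h       = 1ℚ
      wQ flat h       = 1ℚ
      wQ down zero    = 1ℚ
      wQ down (suc h) = ρ⁻ h

      dual : Dual x wP wQ
      dual = record
        { zigzag  = λ { up h _ → ρ-inverse h ; flat h _ → refl ; down (suc h) _ → refl }
        ; zigzag′ = λ { up h _ → refl ; flat h _ → refl ; down (suc h) _ → trans (*-comm (ρ⁻ h) (ρ h)) (ρ-inverse h) }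
        ; flat-w  = λ _ → refl
        ; flat-w′ = λ _ → refl
        ; loop    = loop
        }
        where
        loop : ∀ h → ∑ₛ h (λ c _ → wQ c h * wP c h) ≡ x
        loop zero = trans (cong (λ t → 1ℚ * t + 1ℚ * 1ℚ) ρ0) (normalise x)
          where
          u0-inverse : u⁻ 0 ≡ 1ℚ
          u0-inverse = trans (sym (*-identityˡ _)) (trans (cong (_* u⁻ 0) (sym ev-one)) (u-inverse 0))
          ρ0 : ρ 0 ≡ y
          ρ0 = trans (cong₂ _*_ u-one u0-inverse) (*-identityʳ y)
          normalise : ∀ x → 1ℚ * (x + - 1ℚ) + 1ℚ * 1ℚ ≡ x
          normalise = solve-∀ ring
        -- The Chebyshev recursion divided by `u (suc h)`: the steps up and down together give x -
        -- 1, the flat step gives 1.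
        loop (suc h) = begin
          1ℚ * (u (suc (suc h)) * u⁻ (suc h)) + (1ℚ * 1ℚ + (u h * u⁻ (suc h)) * 1ℚ)
            ≡⟨ cong (λ t → 1ℚ * (t * u⁻ (suc h)) + (1ℚ * 1ℚ + (u h * u⁻ (suc h)) * 1ℚ)) (u-suc-suc h) ⟩
          1ℚ * ((y * u (suc h) + - u h) * u⁻ (suc h)) + (1ℚ * 1ℚ + (u h * u⁻ (suc h)) * 1ℚ)
            ≡⟨ collect y (u (suc h)) (u h) (u⁻ (suc h)) ⟩
          y * (u (suc h) * u⁻ (suc h)) + 1ℚ
            ≡⟨ cong (λ t → y * t + 1ℚ) (u-inverse (suc h)) ⟩
          y * 1ℚ + 1ℚ
            ≡⟨ normalise x ⟩
          x ∎
          where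
          open ≡-Reasoning
          collect : ∀ y a b c → 1ℚ * ((y * a + - b) * c) + (1ℚ * 1ℚ + (b * c) * 1ℚ) ≡ y * (a * c) + 1ℚ
          collect = solve-∀ ring
          normalise : ∀ x → (x + - 1ℚ) * 1ℚ + 1ℚ ≡ x
          normalise = solve-∀ ring

      evaluated : ∀ k r → ev (detGram k r *P den (rhs k r)) ≡ ev (num (rhs k r) *P oneP)
      evaluated k r = begin
        ev (detGram k r *P den (rhs k r))
          ≡⟨ ev-* (detGram k r) (den (rhs k r)) ⟩
        ev (detGram k r) * ev (den (rhs k r))
          ≡⟨ cong₂ _*_ ev-detGram ev-den ⟩
        weight 0 k r * denominator k r N
          ≡⟨ closed-form k r N bound ⟩
        numerator k r N
          ≡⟨ trans (ev-* (num (rhs k r)) oneP) (trans (cong₂ _*_ ev-num ev-one) (*-identityʳ _)) ⟨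
        ev (num (rhs k r) *P oneP) ∎
        where
        open ≡-Reasoning
        open Weights ρ
        open ClosedForm ρ u ρ-ratio
        N : ℕ
        N = ⌊ k ℕ.∸ r /2⌋
        bound : k ≤ suc (r ℕ.+ 2 ℕ.* N)
        bound = ℕ.≤-trans (ℕ.m≤n+m∸n k r) (ℕ.≤-trans (ℕ.+-monoʳ-≤ r (half-bound (k ℕ.∸ r))) (ℕ.≤-reflexive (ℕ.+-suc r (2 ℕ.* N))))
        factorAt : ℕ → Frac
        factorAt s = powF (uAt (s ℕ.+ r) /F uAt (s ℕ.∸ 1)) (mot k (r ℕ.+ 2 ℕ.* s))
        ev-num : ev (num (rhs k r)) ≡ numerator k r N
        ev-num = trans (ev-num-prodF factorAt N id) (∏-cong N (λ i _ →
          trans (cong ev (powF-num (uAt (suc i ℕ.+ r) /F uAt i) (mot k (r ℕ.+ 2 ℕ.* suc i)))) (ev-powP (uAt (suc i ℕ.+ r)) (mot k (r ℕ.+ 2 ℕ.* suc i)))))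
        ev-den : ev (den (rhs k r)) ≡ denominator k r N
        ev-den = trans (ev-den-prodF factorAt N id) (∏-cong N (λ i _ →
          trans (cong ev (powF-den (uAt (suc i ℕ.+ r) /F uAt i) (mot k (r ℕ.+ 2 ℕ.* suc i)))) (ev-powP (uAt i) (mot k (r ℕ.+ 2 ℕ.* suc i)))))
        ev-detGram : ev (detGram k r) ≡ weight 0 k r
        ev-detGram = trans (ev-det (mot k r) (gram k r))
          (trans (det-entries x dual (λ _ → refl) k r (λ j i → ev (gram k r i j))
                   (λ i j → ev-gramEntry r (nthP (paths k r) i) (nthP (paths k r) j)))
                 (sym (productOver-nthP (pathWeight ρ 0) (paths k r))))

  -- At the integer m + 3 the values of the Chebyshev polynomials are increasing: `gap m j` is the
  -- difference of the values with indices j + 1 and j.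
  mutual
    value-at gap : ℕ → ℕ → ℕ
    value-at m zero    = 1
    value-at m (suc j) = value-at m j ℕ.+ gap m j

    gap m zero    = suc m
    gap m (suc j) = m ℕ.* value-at m (suc j) ℕ.+ gap m j

  value-at-suc : ∀ m j → ∃ λ n → value-at m j ≡ suc n
  value-at-suc m zero    = 0 , refl
  value-at-suc m (suc j) with value-at-suc m j
  ... | n , eq = n ℕ.+ gap m j , cong (ℕ._+ gap m j) eq

  point : ℕ → ℤ
  point m = ℤ.+ (3 ℕ.+ m)

  ι-pos-+ : ∀ a b → ι (ℤ.+ (a ℕ.+ b)) ≡ ι (ℤ.+ a) + ι (ℤ.+ b)
  ι-pos-+ a b = trans (cong ι (ℤ.pos-+ a b)) (ι-+ (ℤ.+ a) (ℤ.+ b))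

  ι-pos-* : ∀ a b → ι (ℤ.+ (a ℕ.* b)) ≡ ι (ℤ.+ a) * ι (ℤ.+ b)
  ι-pos-* a b = trans (cong ι (ℤ.pos-* a b)) (ι-* (ℤ.+ a) (ℤ.+ b))

  module _ (m : ℕ) where
    open At (ι (point m))

    y-at-point : y ≡ (1ℚ + 1ℚ) + ι (ℤ.+ m)
    y-at-point = trans (cong (_+ - 1ℚ) (trans (ι-pos-+ 3 m) (cong (_+ ι (ℤ.+ m)) three))) (shuffle (ι (ℤ.+ m)))
      where
      three : ι (ℤ.+ 3) ≡ (1ℚ + 1ℚ) + 1ℚ
      three = refl
      shuffle : ∀ a → (((1ℚ + 1ℚ) + 1ℚ) + a) + - 1ℚ ≡ (1ℚ + 1ℚ) + a
      shuffle = solve-∀ ring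

    -- With y = m + 2 the recursion reads u_{j+2} = u_{j+1} + (m u_{j+1} + (u_{j+1} - u_j)); written
    -- with gaps it has no subtraction, so the values are positive natural numbers. Two consecutive
    -- indices are carried along because the recursion has order two.
    u-at-point : ∀ j → u j ≡ ι (ℤ.+ value-at m j) × u (suc j) ≡ ι (ℤ.+ value-at m (suc j))
    u-at-point zero = ev-one , trans u-one (trans y-at-point (sym (trans (ι-pos-+ 1 (suc m))
      (trans (cong (1ℚ +_) (ι-pos-+ 1 m)) (shuffle (ι (ℤ.+ m)))))))
      where
      shuffle : ∀ a → 1ℚ + (1ℚ + a) ≡ (1ℚ + 1ℚ) + a
      shuffle = solve-∀ ring
    u-at-point (suc j) with u-at-point j
    ... | eq , eq′ = eq′ , (begin
      u (suc (suc j))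
        ≡⟨ u-suc-suc j ⟩
      y * u (suc j) + - u j
        ≡⟨ cong₂ (λ s t → s + - t) (cong₂ _*_ y-at-point (trans eq′ (ι-pos-+ A G))) eq ⟩
      ((1ℚ + 1ℚ) + ι (ℤ.+ m)) * (ι (ℤ.+ A) + ι (ℤ.+ G)) + - ι (ℤ.+ A)
        ≡⟨ shuffle (ι (ℤ.+ m)) (ι (ℤ.+ A)) (ι (ℤ.+ G)) ⟩
      (ι (ℤ.+ A) + ι (ℤ.+ G)) + (ι (ℤ.+ m) * (ι (ℤ.+ A) + ι (ℤ.+ G)) + ι (ℤ.+ G))
        ≡⟨ cong (λ t → t + (ι (ℤ.+ m) * t + ι (ℤ.+ G))) (ι-pos-+ A G) ⟨
      ι (ℤ.+ (A ℕ.+ G)) + (ι (ℤ.+ m) * ι (ℤ.+ (A ℕ.+ G)) + ι (ℤ.+ G))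
        ≡⟨ cong (λ t → ι (ℤ.+ (A ℕ.+ G)) + (t + ι (ℤ.+ G))) (ι-pos-* m (A ℕ.+ G)) ⟨
      ι (ℤ.+ (A ℕ.+ G)) + (ι (ℤ.+ (m ℕ.* (A ℕ.+ G))) + ι (ℤ.+ G))
        ≡⟨ cong (λ t → ι (ℤ.+ (A ℕ.+ G)) + t) (ι-pos-+ (m ℕ.* (A ℕ.+ G)) G) ⟨
      ι (ℤ.+ (A ℕ.+ G)) + ι (ℤ.+ (m ℕ.* (A ℕ.+ G) ℕ.+ G))
        ≡⟨ ι-pos-+ (A ℕ.+ G) (m ℕ.* (A ℕ.+ G) ℕ.+ G) ⟨
      ι (ℤ.+ value-at m (suc (suc j))) ∎)
      where
      open ≡-Reasoning
      A G : ℕ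
      A = value-at m j
      G = gap m j
      shuffle : ∀ m a g → ((1ℚ + 1ℚ) + m) * (a + g) + - a ≡ (a + g) + (m * (a + g) + g)
      shuffle = solve-∀ ring

    inverse-at-point : ∀ j → ∃ λ v → u j * v ≡ 1ℚ
    inverse-at-point j with value-at-suc m j
    ... | n , eq = 1/ ι (ℤ.+ suc n) , trans (cong (_* (1/ ι (ℤ.+ suc n))) (trans (proj₁ (u-at-point j)) (cong (ι ∘ ℤ.+_) eq))) (*-inverseʳ (ι (ℤ.+ suc n)))

    at-point : ∀ k r → ev (detGram k r *P den (rhs k r)) ≡ ev (num (rhs k r) *P oneP)
    at-point = evaluated (proj₁ ∘ inverse-at-point) (proj₂ ∘ inverse-at-point)

  -- Integer polynomials are determined by their values at the chosen points.

  evℤ : ℤ → Poly → ℤ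
  evℤ z []      = ℤ.0ℤ
  evℤ z (a ∷ p) = a ℤ.+ z ℤ.* evℤ z p

  ev-evℤ : ∀ z p → At.ev (ι z) p ≡ ι (evℤ z p)
  ev-evℤ z []      = refl
  ev-evℤ z (a ∷ p) = trans (cong (λ t → ι a + ι z * t) (ev-evℤ z p))
    (sym (trans (ι-+ a _) (cong (ι a +_) (ι-* z (evℤ z p)))))

  rest : Poly → Poly
  rest []      = []
  rest (_ ∷ p) = p

  coeff-rest : ∀ p n → coeff p (suc n) ≡ coeff (rest p) n
  coeff-rest []      n = refl
  coeff-rest (_ ∷ p) n = refl

  evℤ-rest : ∀ z p → evℤ z p ≡ coeff p 0 ℤ.+ z ℤ.* evℤ z (rest p)
  evℤ-rest z []      = sym (trans (ℤ.+-identityˡ _) (ℤ.*-zeroʳ z))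
  evℤ-rest z (a ∷ p) = refl

  -- Taking m = |d| makes the divisor m + 3 exceed |d|, so the cofactor must be 0.
  multiple-zero : ∀ (d : ℤ) (t : ℕ → ℤ) → (∀ m → d ≡ point m ℤ.* t m) → d ≡ ℤ.0ℤ
  multiple-zero d t e = ℤ.∣i∣≡0⇒i≡0 (small ∣ t ∣ d ∣ ∣ (trans (cong ∣_∣ (e ∣ d ∣)) (ℤ.abs-* (point ∣ d ∣) (t ∣ d ∣))))
    where
    small : ∀ s → ∣ d ∣ ≡ (3 ℕ.+ ∣ d ∣) ℕ.* s → ∣ d ∣ ≡ 0
    small zero    eq = trans eq (ℕ.*-zeroʳ (3 ℕ.+ ∣ d ∣))
    small (suc s) eq = contradiction (ℕ.≤-trans (ℕ.m≤m*n (3 ℕ.+ ∣ d ∣) (suc s)) (ℕ.≤-reflexive (sym eq)))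
                                     (ℕ.<⇒≱ (ℕ.m≤n+m (suc ∣ d ∣) 2))

  -- The difference of the constant coefficients is divisible by every evaluation point, hence zero;
  -- this argument needs integer values. The constant terms can then be cancelled and the points,
  -- being nonzero, divided out, which leaves the remaining coefficients in the same situation.
  ≈P-from-values : ∀ p q → (∀ m → evℤ (point m) p ≡ evℤ (point m) q) → p ≈P q
  ≈P-from-values p q e zero = ℤ.i-j≡0⇒i≡j (coeff p 0) (coeff q 0)
    (multiple-zero (coeff p 0 ℤ.- coeff q 0) (λ m → evℤ (point m) (rest q) ℤ.- evℤ (point m) (rest p)) difference)
    where
    rearrange : ∀ a b z s t → a ℤ.+ z ℤ.* s ≡ b ℤ.+ z ℤ.* t → a ℤ.- b ≡ z ℤ.* (t ℤ.- s)
    rearrange a b z s t h = trans (lhs a b (z ℤ.* s)) (trans (cong (λ c → c ℤ.- b ℤ.- z ℤ.* s) h) (rhs′ b z s t))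
      where
      lhs : ∀ a b c → a ℤ.- b ≡ (a ℤ.+ c) ℤ.- b ℤ.- c
      lhs = solveℤ
      rhs′ : ∀ b z s t → (b ℤ.+ z ℤ.* t) ℤ.- b ℤ.- z ℤ.* s ≡ z ℤ.* (t ℤ.- s)
      rhs′ = solveℤ
    difference : ∀ m → coeff p 0 ℤ.- coeff q 0 ≡ point m ℤ.* (evℤ (point m) (rest q) ℤ.- evℤ (point m) (rest p))
    difference m = rearrange (coeff p 0) (coeff q 0) (point m) _ _
      (trans (sym (evℤ-rest (point m) p)) (trans (e m) (evℤ-rest (point m) q)))
  ≈P-from-values p q e (suc n) = trans (coeff-rest p n) (trans (≈P-from-values (rest p) (rest q) values n) (sym (coeff-rest q n)))
    where
    values : ∀ m → evℤ (point m) (rest p) ≡ evℤ (point m) (rest q)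
    values m = ℤ.*-cancelˡ-≡ (point m) _ _ (cancelˡ (coeff p 0) (trans (sym (evℤ-rest (point m) p))
      (trans (e m) (trans (evℤ-rest (point m) q) (cong (ℤ._+ point m ℤ.* evℤ (point m) (rest q)) (sym (≈P-from-values p q e zero)))))))
      where
      cancelˡ : ∀ a {b c} → a ℤ.+ b ≡ a ℤ.+ c → b ≡ c
      cancelˡ a {b} {c} h = trans (minus a b) (trans (cong (ℤ._- a) h) (sym (minus a c)))
        where
        minus : ∀ a b → b ≡ (a ℤ.+ b) ℤ.- a
        minus = solveℤ

  gram-determinant : ∀ k r → detGram k r *P den (rhs k r) ≈P num (rhs k r) *P oneP
  gram-determinant k r = ≈P-from-values (detGram k r *P den (rhs k r)) (num (rhs k r) *P oneP) (λ m → ι-injective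
    (trans (sym (ev-evℤ (point m) (detGram k r *P den (rhs k r))))
      (trans (at-point m k r) (ev-evℤ (point m) (num (rhs k r) *P oneP)))))

mainTheorem12 : (k r : ℕ) → 0 < k → r ≤ k → polyF (detGram k r) ≈F rhs k r
mainTheorem12 k r _ _ = Evaluation.gram-determinant k r
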